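{- Let $X=(x_{ij})$ be an $n\times n$ matrix of indeterminates, and let $\alpha,\beta$ be finite multisets of the same cardinality with elements in $\{1,\dots,n\}$. The vector space $V(\alpha,\beta)$ is generated (spanned) by the monomials (bideterminants) corresponding to non-crossing bitableaux of content $(\alpha,\beta)$.
   Context: $P_{I,J}$ denotes the minor of $X$ with row set $I$ and column set $J$, $|I|=|J|$. A bideterminant is a product $M=P_{I^1,J^1}\cdots P_{I^h,J^h}$ of such minors; its content is $(\alpha,\beta)$, where $\alpha$ is the multiset union of the $I^i$ and $\beta$ the multiset union of the $J^i$. $V(\alpha,\beta)$ is the vector space (over $\mathbb{C}$) spanned by all bideterminants of content $(\alpha,\beta)$. A bitableau $(T,T')$ is a pair of fillings of the same Young diagram $\lambda$ with elements of $\{1,\dots,n\}$, with strictly increasing columns. Its monomial is $\prod_c P_{I_c,J_c}$, where $c$ runs over the columns of $\lambda$, $I_c$ is the set of entries of column $c$ of $T$, and $J_c$ is the set of entries of column $c$ of $T'$. Its content is $(\alpha,\beta)$, where $\alpha$ is the multiset of entries of $T$ and $\beta$ that of $T'$; the shape $\lambda$ may be any partition of $|\alpha|$. A bitableau $(T,T')$ is non-crossing if both $T$ and $T'$ are non-crossing in the following sense. Two disjoint finite sets of integers $a=\{a_1<\dots<a_p\}$ and $b=\{b_1<\dots<b_q\}$ with $p\ge q$ are non-crossing if: (1) for no $1\le i\le q-1$ does $a_i<b_i<a_{i+1}<b_{i+1}$ or $b_i<a_i<b_{i+1}<a_{i+1}$ hold; and (2) if $p>q$, then $a_q<b_q<a_{q+1}$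 does not hold. For a partition $\lambda$ of $N$, a (multiplicity-free) Non-Crossing Tableau of shape $\lambda$ is a set partition of $\{1,\dots,N\}$ into pairwise non-crossing blocks whose sizes are the column lengths of $\lambda$. Now let $T$ be a filling of shape $\lambda$ with strictly increasing columns in which the value $v$ occurs $\mu_v$ times, and let $B_1,B_2,\dots$ be the consecutive segments of $\{1,\dots,N\}$ of lengths $\mu_1,\mu_2,\dots$. The filling $T$ is non-crossing if: (i) there is a multiplicity-free Non-Crossing Tableau $\hat T$ of shape $\lambda$, each block of which contains at most one element of each segment $B_v$, such that replacing every element of $B_v$ by $v$ (for all $v$) turns the multiset of blocks of $\hat T$ into the multiset of columns of $T$; and (ii) the columns of equal length are arranged so that whenever a column $a$ is to the left of a different column $b$ of the same length, $a_s<b_s$ for the largest index $s$ with $a_s\ne b_s$. -}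

module Defs where

open import Algebra.Bundles using (CommutativeRing; Semiring)
open import Algebra.Core using (Op₁; Op₂)
import Algebra.Consequences.Setoid as Consequences
import Algebra.Definitions as Definitions
import Algebra.Definitions.RawMonoid as RawMonoidOps
import Algebra.Definitions.RawSemiring as RawSemiringOps
import Algebra.Properties.Ring as RingProperties
import Algebra.Solver.Ring.NaturalCoefficients.Default as NaturalSolver
open import Data.Fin as Fin using (Fin; zero; suc; toℕ; punchIn; inject≤)
import Data.Fin.Properties as Fin
open import Data.List using (List; concat; concatMap; filter; length; replicate; allFin)
import Data.List as List
open import Data.List.Relation.Binary.Permutation.Propositional using (_↭_)
open import Data.Nat as ℕ using (ℕ; zero; suc)
import Data.Nat.Properties as ℕ
open import Data.Product using (Σ; ∃-syntax; _×_; _,_; proj₁; proj₂)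
open import Data.Rational as ℚ using (ℚ; 0ℚ; 1ℚ; ½)
import Data.Rational.Properties as ℚ
open import Data.Rational.Solver using (module +-*-Solver)
open import Data.Vec using (Vec; lookup; toList; cast)
import Data.Vec as Vec
open import Data.Vec.Functional using (Vector)
open import Data.Vec.Relation.Unary.Linked using (Linked)
open import Data.Vec.Relation.Unary.Unique.Propositional using (Unique)
open import Level using (0ℓ)
open import Relation.Binary.Core using (Rel)
open import Relation.Binary.Bundles using (Setoid)
open import Relation.Binary.Structures using (IsEquivalence)
import Relation.Binary.Reasoning.Setoid as SetoidReasoning
open import Relation.Binary.PropositionalEquality
  using (_≡_; _≢_; refl; sym; trans; cong; subst)
open import Relation.Nullary using (¬_)
open import Relation.Unary using (Pred)

mkCommutativeRing :
  {A : Set} (_≈_ : Rel A 0ℓ) (_+_ _*_ : Op₂ A) (-_ : Op₁ A) (0# 1# : A) →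
  let open Definitions _≈_ in
  IsEquivalence _≈_ →
  Congruent₂ _+_ → Congruent₂ _*_ → Congruent₁ -_ →
  Associative _+_ → Commutative _+_ → LeftIdentity 0# _+_ → LeftInverse 0# -_ _+_ →
  Associative _*_ → Commutative _*_ → LeftIdentity 1# _*_ → _*_ DistributesOverˡ _+_ →
  CommutativeRing 0ℓ 0ℓ
mkCommutativeRing {A} _≈_ _+_ _*_ -_ 0# 1# equiv
  +-cong *-cong -‿cong +-assoc +-comm +-idˡ -‿invˡ *-assoc *-comm *-idˡ distribˡ = record
  { Carrier = A ; _≈_ = _≈_ ; _+_ = _+_ ; _*_ = _*_ ; -_ = -_ ; 0# = 0# ; 1# = 1#
  ; isCommutativeRing = record
    { isRing = record
      { +-isAbelianGroup = record
        { isGroup = record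
          { isMonoid = record
            { isSemigroup = record
              { isMagma = record { isEquivalence = equiv ; ∙-cong = +-cong }
              ; assoc = +-assoc }
            ; identity = C.comm∧idˡ⇒id +-comm +-idˡ }
          ; inverse = C.comm∧invˡ⇒inv +-comm -‿invˡ
          ; ⁻¹-cong = -‿cong }
        ; comm = +-comm }
      ; *-cong = *-cong
      ; *-assoc = *-assoc
      ; *-identity = C.comm∧idˡ⇒id *-comm *-idˡ
      ; distrib = C.comm∧distrˡ⇒distr +-cong *-comm distribˡ }
    ; *-comm = *-comm } }
  where
  setoid : Setoid 0ℓ 0ℓ
  setoid = record { Carrier = A ; _≈_ = _≈_ ; isEquivalence = equiv }
  module C = Consequences setoid

-- ℝ as the Cauchy sequences of rationals modulo null sequences, and ℂ = ℝ[i].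

module Cauchy where
  open import Data.Rational using (_+_; _*_; -_; _-_; ∣_∣; _<_; _≤_; Positive; 1/_)

  Vanishing : (ℕ → ℕ → ℚ) → Set
  Vanishing d = ∀ ε → 0ℚ < ε → ∃[ N ] (∀ m n → N ℕ.≤ m → N ℕ.≤ n → ∣ d m n ∣ < ε)

  Null : (ℕ → ℚ) → Set
  Null s = ∀ ε → 0ℚ < ε → ∃[ N ] (∀ n → N ℕ.≤ n → ∣ s n ∣ < ε)

  IsCauchy : (ℕ → ℚ) → Set
  IsCauchy s = Vanishing (λ m n → s m - s n)

  private
    Bounded : (ℕ → ℕ → ℚ) → Set
    Bounded b = ∃[ K ] Positive K × ∃[ N ] (∀ m n → N ℕ.≤ m → N ℕ.≤ n → ∣ b m n ∣ ≤ K)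

    diagonal : ∀ {d} → Vanishing d → Null (λ n → d n n)
    diagonal v ε ε>0 = let N , h = v ε ε>0 in N , λ n N≤n → h n n N≤n N≤n

    constantʳ : ∀ {s} → Null s → Vanishing (λ m _ → s m)
    constantʳ v ε ε>0 = let N , h = v ε ε>0 in N , λ m _ N≤m _ → h m N≤m

    vanishing-resp : ∀ {d e} → (∀ m n → d m n ≡ e m n) → Vanishing d → Vanishing e
    vanishing-resp d≡e v ε ε>0 =
      let N , h = v ε ε>0
      in N , λ m n N≤m N≤n → subst (λ x → ∣ x ∣ < ε) (d≡e m n) (h m n N≤m N≤n)

    vanishing-0 : ∀ {d} → (∀ m n → d m n ≡ 0ℚ) → Vanishing d
    vanishing-0 d≡0 ε ε>0 =
      0 , λ m n _ _ → subst (λ x → ∣ x ∣ < ε) (sym (d≡0 m n)) ε>0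

    vanishing-neg : ∀ {d} → Vanishing d → Vanishing (λ m n → - d m n)
    vanishing-neg {d} v ε ε>0 =
      let N , h = v ε ε>0
      in N , λ m n N≤m N≤n → subst (_< ε) (sym (ℚ.∣-p∣≡∣p∣ (d m n))) (h m n N≤m N≤n)

    vanishing-+ : ∀ {d e} → Vanishing d → Vanishing e → Vanishing (λ m n → d m n + e m n)
    vanishing-+ {d} {e} v w ε ε>0 = M ℕ.⊔ N , λ m n ≤m ≤n → begin-strict
        ∣ d m n + e m n ∣       ≤⟨ ℚ.∣p+q∣≤∣p∣+∣q∣ (d m n) (e m n) ⟩
        ∣ d m n ∣ + ∣ e m n ∣   <⟨ ℚ.+-mono-<
          (h m n (ℕ.m⊔n≤o⇒m≤o M N ≤m) (ℕ.m⊔n≤o⇒m≤o M N ≤n))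
          (k m n (ℕ.m⊔n≤o⇒n≤o M N ≤m) (ℕ.m⊔n≤o⇒n≤o M N ≤n)) ⟩
        ½ * ε + ½ * ε           ≡⟨ ℚ.*-distribʳ-+ ε ½ ½ ⟨
        1ℚ * ε                  ≡⟨ ℚ.*-identityˡ ε ⟩
        ε                       ∎
      where
      open ℚ.≤-Reasoning
      ε/2>0 : 0ℚ < ½ * ε
      ε/2>0 = subst (_< ½ * ε) (ℚ.*-zeroʳ ½) (ℚ.*-monoʳ-<-pos ½ ε>0)
      M = proj₁ (v (½ * ε) ε/2>0)
      N = proj₁ (w (½ * ε) ε/2>0)
      h = proj₂ (v (½ * ε) ε/2>0)
      k = proj₂ (w (½ * ε) ε/2>0)

    vanishing-* : ∀ {b d} → Bounded b → Vanishing d → Vanishing (λ m n → b m n * d m n)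
    vanishing-* {b} {d} (K , K>0 , M , ≤K) v ε ε>0 = M ℕ.⊔ N , λ m n ≤m ≤n → begin-strict
        ∣ b m n * d m n ∣       ≡⟨ ℚ.∣p*q∣≡∣p∣*∣q∣ (b m n) (d m n) ⟩
        ∣ b m n ∣ * ∣ d m n ∣   ≤⟨ ℚ.*-monoʳ-≤-nonNeg ∣ d m n ∣ {{ℚ.nonNegative (ℚ.0≤∣p∣ (d m n))}}
          (≤K m n (ℕ.m⊔n≤o⇒m≤o M N ≤m) (ℕ.m⊔n≤o⇒m≤o M N ≤n)) ⟩
        K * ∣ d m n ∣           <⟨ ℚ.*-monoʳ-<-pos K
          (h m n (ℕ.m⊔n≤o⇒n≤o M N ≤m) (ℕ.m⊔n≤o⇒n≤o M N ≤n)) ⟩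
        K * (1/ K * ε)          ≡⟨ ℚ.*-assoc K (1/ K) ε ⟨
        (K * 1/ K) * ε          ≡⟨ cong (_* ε) (ℚ.*-inverseʳ K) ⟩
        1ℚ * ε                  ≡⟨ ℚ.*-identityˡ ε ⟩
        ε                       ∎
      where
      open ℚ.≤-Reasoning
      instance
        K-positive = K>0
        K-nonZero = ℚ.pos⇒nonZero K
        1/K-positive = ℚ.1/pos⇒pos K
      δ>0 : 0ℚ < 1/ K * ε
      δ>0 = subst (_< 1/ K * ε) (ℚ.*-zeroʳ (1/ K)) (ℚ.*-monoʳ-<-pos (1/ K) ε>0)
      N = proj₁ (v (1/ K * ε) δ>0)
      h = proj₂ (v (1/ K * ε) δ>0)

    0<1 : 0ℚ < 1ℚ
    0<1 = ℚ.positive⁻¹ 1ℚ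

    tail-bound : ∀ {s} (c : IsCauchy s) → let N = proj₁ (c 1ℚ 0<1) in
                 ∀ m → N ℕ.≤ m → ∣ s m ∣ ≤ 1ℚ + ∣ s N ∣
    tail-bound {s} c m N≤m = begin
        ∣ s m ∣                     ≡⟨ cong ∣_∣ (p≡p-q+q (s m) (s N)) ⟩
        ∣ (s m - s N) + s N ∣       ≤⟨ ℚ.∣p+q∣≤∣p∣+∣q∣ (s m - s N) (s N) ⟩
        ∣ s m - s N ∣ + ∣ s N ∣     ≤⟨ ℚ.+-monoˡ-≤ ∣ s N ∣
          (ℚ.<⇒≤ (proj₂ (c 1ℚ 0<1) m N N≤m ℕ.≤-refl)) ⟩
        1ℚ + ∣ s N ∣                ∎
      where
      open ℚ.≤-Reasoning
      open +-*-Solver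
      N = proj₁ (c 1ℚ 0<1)
      p≡p-q+q : ∀ p q → p ≡ (p - q) + q
      p≡p-q+q = solve 2 (λ p q → p := (p :- q) :+ q) refl

    bound-positive : ∀ p → Positive (1ℚ + ∣ p ∣)
    bound-positive p = ℚ.positive (ℚ.+-mono-<-≤ 0<1 (ℚ.0≤∣p∣ p))

    boundedˡ : ∀ {s} → IsCauchy s → Bounded (λ m _ → s m)
    boundedˡ {s} c = _ , bound-positive (s (proj₁ (c 1ℚ 0<1))) , _ , λ m _ N≤m _ → tail-bound {s} c m N≤m

    boundedʳ : ∀ {s} → IsCauchy s → Bounded (λ _ n → s n)
    boundedʳ {s} c = _ , bound-positive (s (proj₁ (c 1ℚ 0<1))) , _ , λ _ n _ N≤n → tail-bound {s} c n N≤n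

  record ℝ : Set where
    field
      seq    : ℕ → ℚ
      cauchy : IsCauchy seq
  open ℝ

  infix 4 _≈_
  _≈_ : Rel ℝ 0ℓ
  x ≈ y = Null (λ n → seq x n - seq y n)

  constant : ℚ → ℝ
  constant q = record { seq = λ _ → q ; cauchy = vanishing-0 (λ _ _ → ℚ.+-inverseʳ q) }

  private
    open +-*-Solver

    diffProduct : ∀ a b c d → a * (b - d) + d * (a - c) ≡ a * b - c * d
    diffProduct = solve 4 (λ a b c d →
      a :* (b :- d) :+ d :* (a :- c) := a :* b :- c :* d) refl

    diffSum : ∀ a b c d → (a - c) + (b - d) ≡ (a + b) - (c + d)
    diffSum = solve 4 (λ a b c d → (a :- c) :+ (b :- d) := (a :+ b) :- (c :+ d)) refl

    diffNeg : ∀ a b → - (a - b) ≡ - a - - b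
    diffNeg = solve 2 (λ a b → :- (a :- b) := :- a :- :- b) refl

    diffFlip : ∀ a b → - (a - b) ≡ b - a
    diffFlip = solve 2 (λ a b → :- (a :- b) := b :- a) refl

    diffTrans : ∀ a b c → (a - b) + (b - c) ≡ a - c
    diffTrans = solve 3 (λ a b c → (a :- b) :+ (b :- c) := a :- c) refl

  _+ᴿ_ : Op₂ ℝ
  x +ᴿ y = record
    { seq = λ n → seq x n + seq y n
    ; cauchy = vanishing-resp (λ m n → diffSum (seq x m) (seq y m) (seq x n) (seq y n))
                 (vanishing-+ (cauchy x) (cauchy y)) }

  _*ᴿ_ : Op₂ ℝ
  x *ᴿ y = record
    { seq = λ n → seq x n * seq y n
    ; cauchy = vanishing-resp (λ m n → diffProduct (seq x m) (seq y m) (seq x n) (seq y n))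
                 (vanishing-+ (vanishing-* (boundedˡ {seq x} (cauchy x)) (cauchy y))
                              (vanishing-* (boundedʳ {seq y} (cauchy y)) (cauchy x))) }

  -ᴿ_ : Op₁ ℝ
  -ᴿ x = record
    { seq = λ n → - seq x n
    ; cauchy = vanishing-resp (λ m n → diffNeg (seq x m) (seq x n)) (vanishing-neg (cauchy x)) }

  private
    pointwise : ∀ x y → (∀ n → seq x n ≡ seq y n) → x ≈ y
    pointwise x y x≡y = diagonal (vanishing-0 {d = λ m _ → seq x m - seq y m}
      (λ m _ → trans (cong (_- seq y m) (x≡y m)) (ℚ.+-inverseʳ (seq y m))))

    ≈-isEquivalence : IsEquivalence _≈_
    ≈-isEquivalence = record
      { refl = λ {x} → pointwise x x (λ _ → refl)
      ; sym = λ {x} {y} x≈y → diagonal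
          (vanishing-resp (λ m _ → diffFlip (seq x m) (seq y m)) (vanishing-neg (constantʳ x≈y)))
      ; trans = λ {x} {y} {z} x≈y y≈z → diagonal
          (vanishing-resp (λ m _ → diffTrans (seq x m) (seq y m) (seq z m))
            (vanishing-+ (constantʳ x≈y) (constantʳ y≈z))) }

  ℝ-commutativeRing : CommutativeRing 0ℓ 0ℓ
  ℝ-commutativeRing = mkCommutativeRing _≈_ _+ᴿ_ _*ᴿ_ -ᴿ_ (constant 0ℚ) (constant 1ℚ)
    ≈-isEquivalence
    (λ {x} {x′} {y} {y′} x≈x′ y≈y′ → diagonal
      (vanishing-resp (λ m _ → diffSum (seq x m) (seq y m) (seq x′ m) (seq y′ m))
        (vanishing-+ (constantʳ x≈x′) (constantʳ y≈y′))))
    (λ {x} {x′} {y} {y′} x≈x′ y≈y′ → diagonal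
      (vanishing-resp (λ m _ → diffProduct (seq x m) (seq y m) (seq x′ m) (seq y′ m))
        (vanishing-+ (vanishing-* (boundedˡ {seq x} (cauchy x)) (constantʳ y≈y′))
                     (vanishing-* (boundedˡ {seq y′} (cauchy y′)) (constantʳ x≈x′)))))
    (λ {x} {y} x≈y → diagonal
      (vanishing-resp (λ m _ → diffNeg (seq x m) (seq y m)) (vanishing-neg (constantʳ x≈y))))
    (λ x y z → pointwise ((x +ᴿ y) +ᴿ z) (x +ᴿ (y +ᴿ z)) λ n → ℚ.+-assoc (seq x n) (seq y n) (seq z n))
    (λ x y → pointwise (x +ᴿ y) (y +ᴿ x) λ n → ℚ.+-comm (seq x n) (seq y n))
    (λ x → pointwise (constant 0ℚ +ᴿ x) x λ n → ℚ.+-identityˡ (seq x n))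
    (λ x → pointwise ((-ᴿ x) +ᴿ x) (constant 0ℚ) λ n → ℚ.+-inverseˡ (seq x n))
    (λ x y z → pointwise ((x *ᴿ y) *ᴿ z) (x *ᴿ (y *ᴿ z)) λ n → ℚ.*-assoc (seq x n) (seq y n) (seq z n))
    (λ x y → pointwise (x *ᴿ y) (y *ᴿ x) λ n → ℚ.*-comm (seq x n) (seq y n))
    (λ x → pointwise (constant 1ℚ *ᴿ x) x λ n → ℚ.*-identityˡ (seq x n))
    (λ x y z → pointwise (x *ᴿ (y +ᴿ z)) ((x *ᴿ y) +ᴿ (x *ᴿ z))
      λ n → ℚ.*-distribˡ-+ (seq x n) (seq y n) (seq z n))

module AdjoinI (R : CommutativeRing 0ℓ 0ℓ) where
  open CommutativeRing R using (Carrier; _≈_; _+_; _*_; _-_; -_; 0#; 1#)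
  private
    module R = CommutativeRing R
    -1# = - 1#

    sub : ∀ x y → x - y ≈ x + -1# * y
    sub x y = R.+-congˡ (R.sym (RingProperties.-1*x≈-x R.ring y))

  open NaturalSolver R.commutativeSemiring using (solve; _:=_; _:+_; _:*_; con)
  open SetoidReasoning R.setoid

  commutativeRing : CommutativeRing 0ℓ 0ℓ
  commutativeRing = mkCommutativeRing {A = Carrier × Carrier}
    (λ (a , b) (c , d) → a ≈ c × b ≈ d)
    (λ (a , b) (c , d) → a + c , b + d)
    (λ (a , b) (c , d) → a * c - b * d , a * d + b * c)
    (λ (a , b) → - a , - b)
    (0# , 0#) (1# , 0#)
    (record { refl = R.refl , R.refl
            ; sym = λ (p , q) → R.sym p , R.sym q
            ; trans = λ (p , q) (r , s) → R.trans p r , R.trans q s })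
    (λ (p , q) (r , s) → R.+-cong p r , R.+-cong q s)
    (λ (p , q) (r , s) → R.+-cong (R.*-cong p r) (R.-‿cong (R.*-cong q s))
                       , R.+-cong (R.*-cong p s) (R.*-cong q r))
    (λ (p , q) → R.-‿cong p , R.-‿cong q)
    (λ (a , b) (c , d) (e , f) → R.+-assoc a c e , R.+-assoc b d f)
    (λ (a , b) (c , d) → R.+-comm a c , R.+-comm b d)
    (λ (a , b) → R.+-identityˡ a , R.+-identityˡ b)
    (λ (a , b) → R.-‿inverseˡ a , R.-‿inverseˡ b)
    (λ (a , b) (c , d) (e , f) →
      (begin
        (a * c - b * d) * e - (a * d + b * c) * f
          ≈⟨ sub _ _ ⟩
        (a * c - b * d) * e + -1# * ((a * d + b * c) * f)
          ≈⟨ R.+-congʳ (R.*-congʳ (sub _ _)) ⟩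
        (a * c + -1# * (b * d)) * e + -1# * ((a * d + b * c) * f)
          ≈⟨ solve 7 (λ u a b c d e f →
               (a :* c :+ u :* (b :* d)) :* e :+ u :* ((a :* d :+ b :* c) :* f)
               := a :* (c :* e :+ u :* (d :* f)) :+ u :* (b :* (c :* f :+ d :* e)))
               R.refl -1# a b c d e f ⟩
        a * (c * e + -1# * (d * f)) + -1# * (b * (c * f + d * e))
          ≈⟨ R.+-congʳ (R.*-congˡ (sub _ _)) ⟨
        a * (c * e - d * f) + -1# * (b * (c * f + d * e))
          ≈⟨ sub _ _ ⟨
        a * (c * e - d * f) - b * (c * f + d * e) ∎)
      , (begin
        (a * c - b * d) * f + (a * d + b * c) * e
          ≈⟨ R.+-congʳ (R.*-congʳ (sub _ _)) ⟩
        (a * c + -1# * (b * d)) * f + (a * d + b * c) * e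
          ≈⟨ solve 7 (λ u a b c d e f →
               (a :* c :+ u :* (b :* d)) :* f :+ (a :* d :+ b :* c) :* e
               := a :* (c :* f :+ d :* e) :+ b :* (c :* e :+ u :* (d :* f)))
               R.refl -1# a b c d e f ⟩
        a * (c * f + d * e) + b * (c * e + -1# * (d * f))
          ≈⟨ R.+-congˡ (R.*-congˡ (sub _ _)) ⟨
        a * (c * f + d * e) + b * (c * e - d * f) ∎))
    (λ (a , b) (c , d) →
      R.+-cong (R.*-comm a c) (R.-‿cong (R.*-comm b d))
      , solve 4 (λ a b c d → a :* d :+ b :* c := c :* b :+ d :* a) R.refl a b c d)
    (λ (a , b) →
      (begin
        1# * a - 0# * b         ≈⟨ sub _ _ ⟩
        1# * a + -1# * (0# * b)
          ≈⟨ solve 3 (λ u a b → con 1 :* a :+ u :* (con 0 :* b) := a) R.refl -1# a b ⟩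
        a                       ∎)
      , solve 2 (λ a b → con 1 :* b :+ con 0 :* a := b) R.refl a b)
    (λ (a , b) (c , d) (e , f) →
      (begin
        a * (c + e) - b * (d + f)
          ≈⟨ sub _ _ ⟩
        a * (c + e) + -1# * (b * (d + f))
          ≈⟨ solve 7 (λ u a b c d e f →
               a :* (c :+ e) :+ u :* (b :* (d :+ f))
               := (a :* c :+ u :* (b :* d)) :+ (a :* e :+ u :* (b :* f)))
               R.refl -1# a b c d e f ⟩
        (a * c + -1# * (b * d)) + (a * e + -1# * (b * f))
          ≈⟨ R.+-cong (sub _ _) (sub _ _) ⟨
        (a * c - b * d) + (a * e - b * f) ∎)
      , solve 6 (λ a b c d e f →
          a :* (d :+ f) :+ b :* (c :+ e)
          := (a :* d :+ b :* c) :+ (a :* f :+ b :* e)) R.refl a b c d e f)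

ℂ-commutativeRing : CommutativeRing 0ℓ 0ℓ
ℂ-commutativeRing = AdjoinI.commutativeRing Cauchy.ℝ-commutativeRing

-- The polynomial ring R[Var], presented as ring expressions over R and Var
-- modulo the congruence generated by the laws of commutative R-algebras.

module Polynomials (R : CommutativeRing 0ℓ 0ℓ) (Var : Set) where
  private module R = CommutativeRing R

  infixl 6 _+_
  infixl 7 _*_
  infix  8 -_
  infix  4 _≈_

  data Poly : Set where
    con     : R.Carrier → Poly
    var     : Var → Poly
    _+_ _*_ : Poly → Poly → Poly
    -_      : Poly → Poly

  data _≈_ : Poly → Poly → Set where
    ≈-refl    : ∀ {p} → p ≈ p
    ≈-sym     : ∀ {p q} → p ≈ q → q ≈ p
    ≈-trans   : ∀ {p q r} → p ≈ q → q ≈ r → p ≈ r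
    +-cong    : ∀ {p p′ q q′} → p ≈ p′ → q ≈ q′ → p + q ≈ p′ + q′
    *-cong    : ∀ {p p′ q q′} → p ≈ p′ → q ≈ q′ → p * q ≈ p′ * q′
    -‿cong    : ∀ {p p′} → p ≈ p′ → - p ≈ - p′
    con-cong  : ∀ {c d} → c R.≈ d → con c ≈ con d
    con-+     : ∀ c d → con (c R.+ d) ≈ con c + con d
    con-*     : ∀ c d → con (c R.* d) ≈ con c * con d
    +-assoc   : ∀ p q r → (p + q) + r ≈ p + (q + r)
    +-comm    : ∀ p q → p + q ≈ q + p
    +-idˡ     : ∀ p → con R.0# + p ≈ p
    -‿invˡ    : ∀ p → - p + p ≈ con R.0#
    *-assoc   : ∀ p q r → (p * q) * r ≈ p * (q * r)
    *-comm    : ∀ p q → p * q ≈ q * p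
    *-idˡ     : ∀ p → con R.1# * p ≈ p
    distribˡ  : ∀ p q r → p * (q + r) ≈ p * q + p * r

  commutativeRing : CommutativeRing 0ℓ 0ℓ
  commutativeRing = mkCommutativeRing _≈_ _+_ _*_ -_ (con R.0#) (con R.1#)
    (record { refl = ≈-refl ; sym = ≈-sym ; trans = ≈-trans })
    +-cong *-cong -‿cong +-assoc +-comm +-idˡ -‿invˡ *-assoc *-comm *-idˡ distribˡ

  open RawMonoidOps (CommutativeRing.+-rawMonoid commutativeRing) public using (sum)
  open RawMonoidOps (CommutativeRing.*-rawMonoid commutativeRing) public
    using () renaming (sum to product)

  Span : {I : Set} → (I → Poly) → Pred Poly 0ℓ
  Span {I} f p = ∃[ k ] Σ (Vector R.Carrier k) λ c → Σ (Vector I k) λ i →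
    p ≈ sum (λ j → con (c j) * f (i j))

module Determinant (R : CommutativeRing 0ℓ 0ℓ) where
  open CommutativeRing R using (Carrier; _*_; -_; 1#; +-rawMonoid; semiring)
  open RawMonoidOps +-rawMonoid using (sum)
  open RawSemiringOps (Semiring.rawSemiring semiring) using (_^_)

  -- Laplace expansion along the first row.
  det : ∀ {k} → (Fin k → Fin k → Carrier) → Carrier
  det {zero}  A = 1#
  det {suc k} A = sum λ j →
    (- 1#) ^ toℕ j * (A zero j * det (λ r c → A (suc r) (punchIn j c)))

-- A k-element subset of Fin m, listed increasingly.
record FinSet (m k : ℕ) : Set where
  field
    elems      : Vec (Fin m) k
    increasing : Linked Fin._<_ elems
open FinSet public

infixl 9 _!_
_!_ : ∀ {m k} → FinSet m k → Fin k → Fin m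
a ! i = lookup (elems a) i

-- Column c of a filling is a set of size s c; when s lists the column lengths of
-- a Young diagram this is the same as a filling with strictly increasing columns.
Filling : ℕ → ∀ {h} → Vector ℕ h → Set
Filling m {h} s = (c : Fin h) → FinSet m (s c)

columns : ∀ {m h} {s : Vector ℕ h} → Filling m s → List (List (Fin m))
columns T = List.tabulate (λ c → toList (elems (T c)))

entries : ∀ {m h} {s : Vector ℕ h} → Filling m s → List (Fin m)
entries T = concat (columns T)

record IsYoungDiagram {h} (s : Vector ℕ h) : Set where
  field
    positive   : ∀ c → 0 ℕ.< s c
    decreasing : ∀ {c d} → c Fin.< d → s d ℕ.≤ s c

-- In the second clause p > q is forced by j : Fin p with toℕ j ≡ q.
NonCrossing : ∀ {m p q} → q ℕ.≤ p → FinSet m p → FinSet m q → Set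
NonCrossing {m} {p} {q} q≤p a b =
  (∀ (i i⁺ : Fin q) → toℕ i⁺ ≡ suc (toℕ i) →
     ¬ (a↾ i Fin.< b ! i × b ! i Fin.< a↾ i⁺ × a↾ i⁺ Fin.< b ! i⁺)
   × ¬ (b ! i Fin.< a↾ i × a↾ i Fin.< b ! i⁺ × b ! i⁺ Fin.< a↾ i⁺))
  × (∀ (i : Fin q) (j : Fin p) → suc (toℕ i) ≡ q → toℕ j ≡ q →
     ¬ (a↾ i Fin.< b ! i × b ! i Fin.< a ! j))
  where
  a↾ : Fin q → Fin m
  a↾ i = a ! inject≤ i q≤p

record IsMultiplicityFreeNCT {N h} {s : Vector ℕ h}
         (λ-diagram : IsYoungDiagram s) (T̂ : Filling N s) : Set where
  open IsYoungDiagram λ-diagram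
  field
    partition   : entries T̂ ↭ allFin N
    noncrossing : ∀ {c d} (c<d : c Fin.< d) → NonCrossing (decreasing c<d) (T̂ c) (T̂ d)

multiplicity : ∀ {m h} {s : Vector ℕ h} → Filling m s → Fin m → ℕ
multiplicity T v = length (filter (v Fin.≟_) (entries T))

-- The weakly increasing word 0…0 1…1 2…2 … with μ v letters v; its position i
-- belongs to the segment B_v exactly when the i-th letter is v.
segments : ∀ {m} → (Fin m → ℕ) → List (Fin m)
segments {m} μ = concatMap (λ v → replicate (μ v) v) (allFin m)

relabel : ∀ {A : Set} {k} (w : List A) → FinSet (length w) k → Vec A k
relabel w a = Vec.map (List.lookup w) (elems a)

_≺_ : ∀ {m k} → Vec (Fin m) k → Vec (Fin m) k → Set
a ≺ b = ∃[ s ] lookup a s Fin.< lookup b s × (∀ t → s Fin.< t → lookup a t ≡ lookup b t)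

record IsNonCrossing {n h} {s : Vector ℕ h}
         (λ-diagram : IsYoungDiagram s) (T : Filling n s) : Set where
  word : List (Fin n)
  word = segments (multiplicity T)
  field
    T̂           : Filling (length word) s
    T̂-isNCT     : IsMultiplicityFreeNCT λ-diagram T̂
    transversal : ∀ c → Unique (relabel word (T̂ c))
    relabelled  : List.tabulate (λ c → toList (relabel word (T̂ c))) ↭ columns T
    arranged    : ∀ {c d} → c Fin.< d → (eq : s c ≡ s d) →
                  cast eq (elems (T c)) ≢ elems (T d) → cast eq (elems (T c)) ≺ elems (T d)

module Bideterminants (n : ℕ) where
  open Polynomials ℂ-commutativeRing (Fin n × Fin n) public
  open Determinant commutativeRing public

  X : Fin n → Fin n → Poly
  X i j = var (i , j)

  minor : ∀ {k} → FinSet n k → FinSet n k → Poly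
  minor I J = det (λ r c → X (I ! r) (J ! c))

  record Bideterminant (α β : List (Fin n)) : Set where
    field
      {factors} : ℕ
      {size}    : Vector ℕ factors
      rows cols : Filling n size
      content   : entries rows ↭ α × entries cols ↭ β

  ⟦_⟧ : ∀ {α β} → Bideterminant α β → Poly
  ⟦ M ⟧ = product (λ i → minor (rows i) (cols i))
    where open Bideterminant M

  V : (α β : List (Fin n)) → Pred Poly 0ℓ
  V α β = Span (⟦_⟧ {α} {β})

  record NonCrossingBitableau (α β : List (Fin n)) : Set where
    field
      {width}      : ℕ
      {shape}      : Vector ℕ width
      diagram      : IsYoungDiagram shape
      T T′         : Filling n shape
      noncrossing  : IsNonCrossing diagram T
      noncrossing′ : IsNonCrossing diagram T′
      content      : entries T ↭ α × entries T′ ↭ β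

  monomial : ∀ {α β} → NonCrossingBitableau α β → Poly
  monomial B = product (λ c → minor (T c) (T′ c))
    where open NonCrossingBitableau B

{-# OPTIONS --safe #-}
module Submission where

open import Defs
open import Algebra.Bundles using (CommutativeRing; RawMonoid; Semiring)
import Algebra.Definitions.RawMonoid as RawMonoidOps
import Algebra.Definitions.RawSemiring as RawSemiringOps
import Algebra.Properties.CommutativeSemigroup as CommutativeSemigroupProperties
import Algebra.Properties.Ring as RingProperties
import Algebra.Solver.Ring.NaturalCoefficients.Default as NaturalSolver
open import Data.Empty using (⊥-elim)
open import Data.Fin as Fin using (Fin; zero; suc; toℕ; punchIn; inject≤)
import Data.Fin.Properties as Fin
open import Data.List as List
  using (List; []; _∷_; _++_; map; length; zip; reverse; replicate; concat; tabulate; allFin; filter)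
import Data.List.Properties as List
open import Data.List.Relation.Binary.Equality.Propositional using (≋⇒≡)
open import Data.List.Relation.Binary.Permutation.Propositional
  using (_↭_; prep; ↭-sym; ↭-trans; ↭-refl; ↭-reflexive; ↭⇒↭ₛ)
import Data.List.Relation.Binary.Permutation.Propositional.Properties as Perm
open import Data.List.Relation.Unary.All as All using (All; []; _∷_)
import Data.List.Relation.Unary.All.Properties as All
open import Data.List.Relation.Unary.AllPairs using (AllPairs; []; _∷_)
import Data.List.Relation.Unary.AllPairs.Properties as AllPairs
open import Data.List.Relation.Unary.Linked.Properties using (AllPairs⇒Linked)
open import Data.List.Relation.Unary.Sorted.TotalOrder.Properties using (↗↭↗⇒≋)
open import Data.Nat as ℕ using (ℕ; zero; suc; _≤_; _<_; z≤n; s≤s; _≤?_)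
open import Data.Nat.Induction using (<-wellFounded)
import Data.Nat.Properties as ℕ
open import Data.Nat.Solver using (module +-*-Solver)
open import Data.Product using (∃-syntax; _×_; _,_; proj₁; proj₂)
open import Data.Sum using (_⊎_; inj₁; inj₂)
open import Data.Vec as Vec using (Vec; []; _∷_; lookup; toList; fromList; removeAt)
import Data.Vec.Functional as Vector
import Data.Vec.Properties as Vec
import Data.Vec.Relation.Unary.All as VecAll
import Data.Vec.Relation.Unary.AllPairs as VecAllPairs
open import Data.Vec.Relation.Unary.Linked as VecLinked using ([]; [-]; _∷_)
open import Data.Vec.Relation.Unary.Unique.Propositional using (Unique)
open import Function using (_∘_; id)
open import Induction.WellFounded using (Acc; acc)
open import Level using (0ℓ)
open import Relation.Binary.Definitions using (DecidableEquality; tri<; tri≈; tri>)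
open import Relation.Binary.PropositionalEquality
  using (_≡_; _≢_; refl; sym; trans; cong; cong₂; subst; subst₂)
open import Relation.Nullary using (¬_; yes; no; Dec; ¬?; _×-dec_; map′)
open import Relation.Unary using (_≐_)

-- Lift α and β to their sorted words, with letters (labels) 1, …, N.  A bideterminant
-- is a labelling f of the rows and g of the columns by its factors, and up to sign it
-- is the determinant D f g of the N × N matrix with entries [f i = g j] x.  Multilinearity
-- makes the raising operator of a pair of factors on f adjoint to the lowering operator
-- on g, so the image of a lowering operator consists of bideterminants of more dominant
-- shape.  For two factors a, b, a labelling is a lattice path; modulo those images and
-- paths that stray further from 0, it equals up to sign the path reflected in 0.
-- Hence f may be changed by exchanging a and b in any balanced prefix, at the price of
-- labellings that are larger in dominance order.  These exchanges uncross any crossing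
-- and sort columns of equal length, and a suitable sum over the arcs of f decreases.
-- The same applies to g, and a terminal pair is a non-crossing bitableau, unless a value
-- is repeated in a column and the determinant vanishes.

-- A reflection lowers several letters at once, and powers of a lowering operator would bring in
-- factorials. In `exp F` every subset of the letters occurs once, with coefficient 1. Since `D f g`
-- vanishes unless f and g give each factor the same size, a single weight of the exponential
-- survives, and in it the divided power. The adjoint of the exponential is found entry by entry in
-- the matrix, so no operator is ever iterated. The signs of the exchanges are not followed: 𝓘 is
-- closed under negation, so "equal up to sign modulo 𝓘" is only used in the form "one lies in 𝓘 if
-- and only if the other does". Four quantities carry the induction, in this order: `q` of the
-- shape, which the adjunction raises; `μ` of the labelling, which the error terms raise at fixed
-- shape; then `Π` and `Θ`, which exchanges lower at fixed `μ`. Rows are normalised against a fixed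
-- column labelling, then columns against fixed rows; a term with larger `q` returns to the
-- outermost induction, where rows and columns start afresh.

record AdditiveSubgroup (R : CommutativeRing 0ℓ 0ℓ) : Set₁ where
  open CommutativeRing R hiding (refl; sym; trans)
  private module R = CommutativeRing R
  field
    Mem  : Carrier → Set
    resp : ∀ {x y} → x ≈ y → Mem x → Mem y
    0∈   : Mem 0#
    +∈   : ∀ {x y} → Mem x → Mem y → Mem (x + y)
    -∈   : ∀ {x} → Mem x → Mem (- x)

  +-cancelʳ∈ : ∀ {x y} → Mem (x + y) → Mem y → Mem x
  +-cancelʳ∈ {x} {y} s m = resp
    (R.trans (+-assoc x y (- y)) (R.trans (+-congˡ (-‿inverseʳ y)) (+-identityʳ x)))
    (+∈ s (-∈ m))

  +-cancelˡ∈ : ∀ {x y} → Mem (x + y) → Mem x → Mem y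
  +-cancelˡ∈ s m = +-cancelʳ∈ (resp (+-comm _ _) s) m

-- Lattice paths of a pair of columns

-- Words in the letters of two distinguished columns A and B; every other column
-- is passive.  A word is read from its last letter to its first.

data Letter (T : Set) : Set where
  A B : Letter T
  O   : T → Letter T

module _ {T : Set} where

  #A #B : List (Letter T) → ℕ
  #A []        = 0
  #A (A ∷ w)   = suc (#A w)
  #A (B ∷ w)   = #A w
  #A (O _ ∷ w) = #A w
  #B []        = 0
  #B (A ∷ w)   = #B w
  #B (B ∷ w)   = suc (#B w)
  #B (O _ ∷ w) = #B w

  -- The lattice path #A − #B of |w| is the absolute value of the path of w.
  ∣_∣ʷ : List (Letter T) → List (Letter T)
  ∣ [] ∣ʷ      = []
  ∣ O t ∷ w ∣ʷ = O t ∷ ∣ w ∣ʷ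
  ∣ A ∷ w ∣ʷ with #B w ≤? #A w
  ... | yes _ = A ∷ ∣ w ∣ʷ
  ... | no _  = B ∷ ∣ w ∣ʷ
  ∣ B ∷ w ∣ʷ with #A w ≤? #B w
  ... | yes _ = A ∷ ∣ w ∣ʷ
  ... | no _  = B ∷ ∣ w ∣ʷ

  infixr 5 O∷_

  -- The path of z is nonnegative and dominates the absolute value of the path of w.
  data Dominates : List (Letter T) → List (Letter T) → Set where
    []   : Dominates [] []
    O∷_  : ∀ {z w t} → Dominates z w → Dominates (O t ∷ z) (O t ∷ w)
    A∷A  : ∀ {z w} → Dominates z w → Dominates (A ∷ z) (A ∷ w)
    A∷B  : ∀ {z w} → Dominates z w → Dominates (A ∷ z) (B ∷ w)
    B∷A  : ∀ {z w} → Dominates z w → #A w < #A z → Dominates (B ∷ z) (A ∷ w)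
    B∷B  : ∀ {z w} → Dominates z w → #B w < #A z → Dominates (B ∷ z) (B ∷ w)

  dominates-length : ∀ {z w} → Dominates z w → length z ≡ length w
  dominates-length []        = refl
  dominates-length (O∷ d)    = cong suc (dominates-length d)
  dominates-length (A∷A d)   = cong suc (dominates-length d)
  dominates-length (A∷B d)   = cong suc (dominates-length d)
  dominates-length (B∷A d _) = cong suc (dominates-length d)
  dominates-length (B∷B d _) = cong suc (dominates-length d)

  dominates-#A : ∀ {z w} → Dominates z w → #A w ≤ #A z
  dominates-#B : ∀ {z w} → Dominates z w → #B w ≤ #A z
  dominates-#A []        = z≤n
  dominates-#A (O∷ d)    = dominates-#A d
  dominates-#A (A∷A d)   = s≤s (dominates-#A d)
  dominates-#A (A∷B d)   = ℕ.m≤n⇒m≤1+n (dominates-#A d)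
  dominates-#A (B∷A d l) = l
  dominates-#A (B∷B d l) = dominates-#A d
  dominates-#B []        = z≤n
  dominates-#B (O∷ d)    = dominates-#B d
  dominates-#B (A∷A d)   = ℕ.m≤n⇒m≤1+n (dominates-#B d)
  dominates-#B (A∷B d)   = s≤s (dominates-#B d)
  dominates-#B (B∷A d l) = dominates-#B d
  dominates-#B (B∷B d l) = l

  dominates-sum : ∀ {z w} → Dominates z w → #A z ℕ.+ #B z ≡ #A w ℕ.+ #B w
  dominates-sum []        = refl
  dominates-sum (O∷ d)    = dominates-sum d
  dominates-sum (A∷A d)   = cong suc (dominates-sum d)
  dominates-sum {_} {B ∷ w} (A∷B d)   =
    trans (cong suc (dominates-sum d)) (sym (ℕ.+-suc (#A w) (#B w)))
  dominates-sum {B ∷ z} (B∷A d _) =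
    trans (ℕ.+-suc (#A z) (#B z)) (cong suc (dominates-sum d))
  dominates-sum {B ∷ z} {B ∷ w} (B∷B d _) =
    trans (ℕ.+-suc (#A z) (#B z))
      (trans (cong suc (dominates-sum d)) (sym (ℕ.+-suc (#A w) (#B w))))

  #A-∣∣ : ∀ w → #A ∣ w ∣ʷ ≡ #A w ℕ.⊔ #B w
  #A-∣∣ []        = refl
  #A-∣∣ (O t ∷ w) = #A-∣∣ w
  #A-∣∣ (A ∷ w) with #B w ≤? #A w
  ... | yes b≤a = trans (cong suc (trans (#A-∣∣ w) (ℕ.m≥n⇒m⊔n≡m b≤a)))
                        (sym (ℕ.m≥n⇒m⊔n≡m (ℕ.m≤n⇒m≤1+n b≤a)))
  ... | no b≰a  = trans (trans (#A-∣∣ w) (ℕ.m≤n⇒m⊔n≡n (ℕ.<⇒≤ (ℕ.≰⇒> b≰a))))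
                        (sym (ℕ.m≤n⇒m⊔n≡n (ℕ.≰⇒> b≰a)))
  #A-∣∣ (B ∷ w) with #A w ≤? #B w
  ... | yes a≤b = trans (cong suc (trans (#A-∣∣ w) (ℕ.m≤n⇒m⊔n≡n a≤b)))
                        (sym (ℕ.m≤n⇒m⊔n≡n (ℕ.m≤n⇒m≤1+n a≤b)))
  ... | no a≰b  = trans (trans (#A-∣∣ w) (ℕ.m≥n⇒m⊔n≡m (ℕ.<⇒≤ (ℕ.≰⇒> a≰b))))
                        (sym (ℕ.m≥n⇒m⊔n≡m (ℕ.≰⇒> a≰b)))

  #A-∣∣-≥ : ∀ w → #B w ≤ #A w → #A ∣ w ∣ʷ ≡ #A w
  #A-∣∣-≥ w l = trans (#A-∣∣ w) (ℕ.m≥n⇒m⊔n≡m l)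

  #A-∣∣-≤ : ∀ w → #A w ≤ #B w → #A ∣ w ∣ʷ ≡ #B w
  #A-∣∣-≤ w l = trans (#A-∣∣ w) (ℕ.m≤n⇒m⊔n≡n l)

  ∣∣-dominates : ∀ w → Dominates ∣ w ∣ʷ w
  ∣∣-dominates []        = []
  ∣∣-dominates (O t ∷ w) = O∷ ∣∣-dominates w
  ∣∣-dominates (A ∷ w) with #B w ≤? #A w
  ... | yes _   = A∷A (∣∣-dominates w)
  ... | no b≰a  = B∷A (∣∣-dominates w)
    (subst (#A w <_) (sym (#A-∣∣-≤ w (ℕ.<⇒≤ (ℕ.≰⇒> b≰a)))) (ℕ.≰⇒> b≰a))
  ∣∣-dominates (B ∷ w) with #A w ≤? #B w
  ... | yes _   = A∷B (∣∣-dominates w)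
  ... | no a≰b  = B∷B (∣∣-dominates w)
    (subst (#B w <_) (sym (#A-∣∣-≥ w (ℕ.<⇒≤ (ℕ.≰⇒> a≰b)))) (ℕ.≰⇒> a≰b))

  -- The words that occur when `Y` is expanded: any set of letters `B` is turned into `A`.
  data Raises : List (Letter T) → List (Letter T) → Set where
    []   : Raises [] []
    keep : ∀ {y z} x → Raises y z → Raises (x ∷ y) (x ∷ z)
    lift : ∀ {y z} → Raises y z → Raises (A ∷ y) (B ∷ z)

  raises-#A : ∀ {y z} → Raises y z → #A z ≤ #A y
  raises-#A []             = z≤n
  raises-#A (keep A r)     = s≤s (raises-#A r)
  raises-#A (keep B r)     = raises-#A r
  raises-#A (keep (O _) r) = raises-#A r
  raises-#A (lift r)       = ℕ.m≤n⇒m≤1+n (raises-#A r)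

  raises-dominates : ∀ {y z w} → Raises y z → Dominates z w → Dominates y w
  raises-dominates []             []        = []
  raises-dominates (keep _ r)     (O∷ d)    = O∷ raises-dominates r d
  raises-dominates (keep _ r)     (A∷A d)   = A∷A (raises-dominates r d)
  raises-dominates (keep _ r)     (A∷B d)   = A∷B (raises-dominates r d)
  raises-dominates (keep _ r)     (B∷A d l) = B∷A (raises-dominates r d) (ℕ.<-≤-trans l (raises-#A r))
  raises-dominates (keep _ r)     (B∷B d l) = B∷B (raises-dominates r d) (ℕ.<-≤-trans l (raises-#A r))
  raises-dominates (lift r)       (B∷A d l) = A∷A (raises-dominates r d)
  raises-dominates (lift r)       (B∷B d l) = A∷B (raises-dominates r d)

-- The exponentials of sl₂ and the reflection of a path

module Substitution (R : CommutativeRing 0ℓ 0ℓ) {T : Set} where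
  open CommutativeRing R using (Carrier; _+_; _-_)

  -- X extends Ψ linearly along the substitution A ↦ A + B, and Y along B ↦ B − A;
  -- they are the actions of exp F and exp (−E) for sl₂.
  X Y : (List (Letter T) → Carrier) → List (Letter T) → Carrier
  X Ψ []        = Ψ []
  X Ψ (A ∷ z)   = X (Ψ ∘ (A ∷_)) z + X (Ψ ∘ (B ∷_)) z
  X Ψ (B ∷ z)   = X (Ψ ∘ (B ∷_)) z
  X Ψ (O t ∷ z) = X (Ψ ∘ (O t ∷_)) z
  Y Ψ []        = Ψ []
  Y Ψ (A ∷ z)   = Y (Ψ ∘ (A ∷_)) z
  Y Ψ (B ∷ z)   = Y (Ψ ∘ (B ∷_)) z - Y (Ψ ∘ (A ∷_)) z
  Y Ψ (O t ∷ z) = Y (Ψ ∘ (O t ∷_)) z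

module Reflection (R : CommutativeRing 0ℓ 0ℓ) (𝓘 : AdditiveSubgroup R) {T : Set} where
  open CommutativeRing R hiding (refl; sym; trans)
  private module R = CommutativeRing R
  open RingProperties ring using (-‿+-comm)
  open AdditiveSubgroup 𝓘
  open Substitution R {T}

  X∈-≤ : ∀ {Ψ} z → (∀ v → length v ≡ length z → #A v ≤ #A z → Mem (Ψ v)) → Mem (X Ψ z)
  X∈-≤ []        h = h [] refl z≤n
  X∈-≤ (A ∷ z)   h = +∈ (X∈-≤ z (λ v e l → h (A ∷ v) (cong suc e) (s≤s l)))
                        (X∈-≤ z (λ v e l → h (B ∷ v) (cong suc e) (ℕ.m≤n⇒m≤1+n l)))
  X∈-≤ (B ∷ z)   h = X∈-≤ z (λ v e l → h (B ∷ v) (cong suc e) l)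
  X∈-≤ (O t ∷ z) h = X∈-≤ z (λ v e l → h (O t ∷ v) (cong suc e) l)

  -- In the expansion of `X Ψ z` every term other than `Ψ z` has turned some `A` into `B`, so it has
  -- strictly lower weight.
  X∈-top : ∀ {Ψ} z → (∀ v → length v ≡ length z → #A v < #A z → Mem (Ψ v)) →
           (Mem (Ψ z) → Mem (X Ψ z)) × (Mem (X Ψ z) → Mem (Ψ z))
  X∈-top []        h = id , id
  X∈-top {Ψ} (A ∷ z) h =
      (λ m → +∈ (proj₁ ih m) low)
    , (λ m → proj₂ ih (+-cancelʳ∈ m low))
    where
    ih = X∈-top {Ψ ∘ (A ∷_)} z (λ v e l → h (A ∷ v) (cong suc e) (s≤s l))
    low = X∈-≤ z (λ v e l → h (B ∷ v) (cong suc e) (s≤s l))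
  X∈-top (B ∷ z)   h = X∈-top z (λ v e l → h (B ∷ v) (cong suc e) l)
  X∈-top (O t ∷ z) h = X∈-top z (λ v e l → h (O t ∷ v) (cong suc e) l)

  Y-+ : ∀ Ψ Φ z → Y (λ v → Ψ v + Φ v) z ≈ Y Ψ z + Y Φ z
  Y-+ Ψ Φ []        = R.refl
  Y-+ Ψ Φ (A ∷ z)   = Y-+ _ _ z
  Y-+ Ψ Φ (B ∷ z)   = R.trans (+-cong (Y-+ _ _ z) (R.trans (-‿cong (Y-+ _ _ z)) (R.sym (-‿+-comm _ _))))
    (interchange _ _ _ _)
    where
    open CommutativeSemigroupProperties
      +-commutativeSemigroup using (interchange)
  Y-+ Ψ Φ (O t ∷ z) = Y-+ _ _ z

  -- Y followed by X substitutes A ↦ A + B and B ↦ − A.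
  YX∈ : ∀ {Ψ} z → (∀ v → length v ≡ length z → #B z ≤ #A v → Mem (Ψ v)) → Mem (Y (X Ψ) z)
  YX∈ []        h = h [] refl z≤n
  YX∈ (A ∷ z)   h = resp (R.sym (Y-+ _ _ z))
    (+∈ (YX∈ z (λ v e l → h (A ∷ v) (cong suc e) (ℕ.m≤n⇒m≤1+n l))) (YX∈ z (λ v e l → h (B ∷ v) (cong suc e) l)))
  YX∈ {Ψ} (B ∷ z)   h = resp (R.sym cancel) (-∈ (YX∈ z (λ v e l → h (A ∷ v) (cong suc e) (s≤s l))))
    where
    cancel : Y (X (Ψ ∘ (B ∷_))) z - Y (λ v → X (Ψ ∘ (A ∷_)) v + X (Ψ ∘ (B ∷_)) v) z
             ≈ - Y (X (Ψ ∘ (A ∷_))) z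
    cancel = R.trans (+-congˡ (R.trans (-‿cong (R.trans (Y-+ _ _ z) (+-comm _ _)))
                                       (R.sym (-‿+-comm _ _))))
      (R.trans (R.sym (+-assoc _ _ _)) (R.trans (+-congʳ (-‿inverseʳ _)) (+-identityˡ _)))
  YX∈ (O t ∷ z) h = YX∈ z (λ v e l → h (O t ∷ v) (cong suc e) l)

  Y∈ : ∀ {G} z → (∀ y → Raises y z → Mem (G y)) → Mem (Y G z)
  Y∈ []        h = h [] []
  Y∈ (A ∷ z)   h = Y∈ z (λ y r → h (A ∷ y) (keep A r))
  Y∈ (B ∷ z)   h = +∈ (Y∈ z (λ y r → h (B ∷ y) (keep B r))) (-∈ (Y∈ z (λ y r → h (A ∷ y) (lift r))))
  Y∈ (O t ∷ z) h = Y∈ z (λ y r → h (O t ∷ y) (keep _ r))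

  -- `Y` is unitriangular for the number of letters `A`: `G z` has coefficient 1, and all other
  -- terms sit at proper raisings of `z`.
  Y∈⁻ : ∀ {G} z → (∀ y → Raises y z → #A z < #A y → Mem (G y)) → Mem (Y G z) → Mem (G z)
  Y∈⁻ []        h m = m
  Y∈⁻ (A ∷ z)   h m = Y∈⁻ z (λ y r l → h (A ∷ y) (keep A r) (s≤s l)) m
  Y∈⁻ (B ∷ z)   h m = Y∈⁻ z (λ y r l → h (B ∷ y) (keep B r) l)
    (+-cancelʳ∈ m (-∈ (Y∈ z (λ y r → h (A ∷ y) (lift r) (s≤s (raises-#A r))))))
  Y∈⁻ (O t ∷ z) h m = Y∈⁻ z (λ y r l → h (O t ∷ y) (keep _ r) l) m

  -- If Ψ lives in a single weight and the relations X Ψ z ∈ 𝓘 hold for all z ≠ |w|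
  -- above w, then w and |w| have the same image modulo 𝓘 up to sign.
  reflect : ∀ {Ψ} w →
    (∀ v → length v ≡ length w → #A v ≢ #A w → Mem (Ψ v)) →
    (∀ z → Dominates z w → z ≢ ∣ w ∣ʷ → Mem (X Ψ z)) →
    (Mem (Ψ w) → Mem (X Ψ ∣ w ∣ʷ)) × (Mem (X Ψ ∣ w ∣ʷ) → Mem (Ψ w))
  reflect []        supp rel = id , id
  reflect (O t ∷ w) supp rel = reflect w (λ v e → supp (O t ∷ v) (cong suc e))
    (λ z d z≢ → rel (O t ∷ z) (O∷ d) (λ { refl → z≢ refl }))
  reflect {Ψ} (A ∷ w) supp rel with #B w ≤? #A w
  ... | yes b≤a = (λ m → +∈ (proj₁ ih m) low) , (λ m → proj₂ ih (+-cancelʳ∈ m low))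
    where
    -- All words of this expansion have the form `B ∷ v` with at most `#A w` letters `A`, one too
    -- few for the weight of `A ∷ w`.
    lower : ∀ z → length z ≡ length w → #A z ≤ #A w → Mem (X (Ψ ∘ (B ∷_)) z)
    lower z ez l = X∈-≤ z (λ v ev l′ → supp (B ∷ v) (cong suc (trans ev ez)) (λ e → ℕ.<-irrefl e (s≤s (ℕ.≤-trans l′ l))))
    low = lower ∣ w ∣ʷ (dominates-length (∣∣-dominates w)) (ℕ.≤-reflexive (#A-∣∣-≥ w b≤a))
    relA : ∀ z → Dominates z w → z ≢ ∣ w ∣ʷ → Mem (X (Ψ ∘ (A ∷_)) z)
    relA z d z≢ = +-cancelʳ∈ (rel (A ∷ z) (A∷A d) (λ { refl → z≢ refl })) relB
      where
      relB : Mem (X (Ψ ∘ (B ∷_)) z)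
      relB with suc (#A w) ≤? #A z
      ... | yes l = rel (B ∷ z) (B∷A d l) (λ ())
      ... | no ≰  = lower z (dominates-length d) (ℕ.≤-pred (ℕ.≰⇒> ≰))
    ih = reflect w (λ v e ≢ → supp (A ∷ v) (cong suc e) (≢ ∘ ℕ.suc-injective)) relA
  -- The path of `w` is negative and `A` brings it towards 0, so the absolute path continues with
  -- `B`. The relation at `A ∷ ∣ w ∣ʷ` trades the first letter `A` for `B`; this is where the sign
  -- changes.
  ... | no b≰a = (λ m → +-cancelˡ∈ both (proj₁ ih m)) , (λ m → proj₂ ih (+-cancelʳ∈ both m))
    where
    relA : ∀ z → Dominates z w → z ≢ ∣ w ∣ʷ → Mem (X (Ψ ∘ (A ∷_)) z)
    relA z d z≢ = +-cancelʳ∈ (rel (A ∷ z) (A∷A d) (λ ()))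
      (rel (B ∷ z) (B∷A d (ℕ.<-≤-trans (ℕ.≰⇒> b≰a) (dominates-#B d))) (λ { refl → z≢ refl }))
    ih = reflect w (λ v e ≢ → supp (A ∷ v) (cong suc e) (≢ ∘ ℕ.suc-injective)) relA
    both = rel (A ∷ ∣ w ∣ʷ) (A∷A (∣∣-dominates w)) (λ ())
  reflect {Ψ} (B ∷ w) supp rel with #A w ≤? #B w
  ... | no a≰b = reflect w (λ v e → supp (B ∷ v) (cong suc e)) (λ z d z≢ →
    rel (B ∷ z) (B∷B d (ℕ.<-≤-trans (ℕ.≰⇒> a≰b) (dominates-#A d))) (λ { refl → z≢ refl }))
  ... | yes a≤b = (λ m → +∈ relA∣∣ (proj₁ ih m)) , (λ m → proj₂ ih (+-cancelˡ∈ m relA∣∣))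
    where
    -- The relations above do not reach this case, so the inverse substitution is used. In
    -- `Y (X (Ψ ∘ (A ∷_))) z` every word has at least `#B z = #A w` letters `A` besides the leading
    -- one, too many for the weight of `B ∷ w`. The proper raisings of `z` are removed by two
    -- relations each.
    relA : ∀ z → Dominates z w → #A z ≡ #B w → Mem (X (Ψ ∘ (A ∷_)) z)
    relA z d a≡b = Y∈⁻ z raised (YX∈ z (λ v ev l → supp (A ∷ v) (cong suc (trans ev (dominates-length d))) λ e →
        ℕ.<-irrefl (sym e) (s≤s (subst (_≤ #A v) #Bz≡#Aw l))))
      where
      #Bz≡#Aw : #B z ≡ #A w
      #Bz≡#Aw = ℕ.+-cancelˡ-≡ (#B w) _ _
        (trans (cong (ℕ._+ #B z) (sym a≡b)) (trans (dominates-sum d) (ℕ.+-comm (#A w) (#B w))))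
      raised : ∀ y → Raises y z → #A z < #A y → Mem (X (Ψ ∘ (A ∷_)) y)
      raised y r l = +-cancelʳ∈
        (rel (A ∷ y) (A∷B dy) (λ { refl → ℕ.<-irrefl (trans a≡b (sym (#A-∣∣-≤ w a≤b))) l }))
        (rel (B ∷ y) (B∷B dy (subst (_< #A y) a≡b l)) (λ ()))
        where dy = raises-dominates r d
    relA∣∣ = relA ∣ w ∣ʷ (∣∣-dominates w) (#A-∣∣-≤ w a≤b)
    relB : ∀ z → Dominates z w → z ≢ ∣ w ∣ʷ → Mem (X (Ψ ∘ (B ∷_)) z)
    relB z d z≢ with suc (#B w) ≤? #A z
    ... | yes l = rel (B ∷ z) (B∷B d l) (λ ())
    ... | no ≰  = +-cancelˡ∈ (rel (A ∷ z) (A∷B d) (λ { refl → z≢ refl }))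
      (relA z d (ℕ.≤-antisym (ℕ.≤-pred (ℕ.≰⇒> ≰)) (dominates-#B d)))
    ih = reflect w (λ v e → supp (B ∷ v) (cong suc e)) relB

-- Alternating sums and Laplace expansion

-- Restricts the congruence of `alt` to the pairs that really occur in the expansion, so that a
-- summand may be rewritten by a fact about `xs`.
data Pick {C : Set} (y : C) : List C → List C → Set where
  here  : ∀ {xs} → Pick y xs (y ∷ xs)
  there : ∀ {x xs ys} → Pick y ys xs → Pick y (x ∷ ys) (x ∷ xs)

data AdjacentEqual {C : Set} : List C → Set where
  here  : ∀ {x xs} → AdjacentEqual (x ∷ x ∷ xs)
  there : ∀ {x xs} → AdjacentEqual xs → AdjacentEqual (x ∷ xs)

module Laplace (R : CommutativeRing 0ℓ 0ℓ) where
  open CommutativeRing R hiding (refl; sym; trans)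
  private module R = CommutativeRing R
  open RingProperties ring using (-‿+-comm; -0#≈0#; -‿distribʳ-*; -‿involutive)
  open CommutativeSemigroupProperties
    +-commutativeSemigroup using (interchange)
  open CommutativeSemigroupProperties
    *-commutativeSemigroup
    using () renaming (x∙yz≈y∙xz to x*yz≈y*xz)

  -- Σᵢ (−1)ⁱ φ xᵢ (xs without xᵢ)
  alt : {C : Set} → (C → List C → Carrier) → List C → Carrier
  alt φ []       = 0#
  alt φ (x ∷ xs) = φ x xs - alt (λ y ys → φ y (x ∷ ys)) xs

  -- Expansion along the first row; detL vanishes when the numbers of rows and columns
  -- differ.
  detL : {P Q : Set} → (P → Q → Carrier) → List P → List Q → Carrier
  detL k []       []      = 1#
  detL k []       (_ ∷ _) = 0#
  detL k (r ∷ rs) cs      = alt (λ c cs′ → k r c * detL k rs cs′) cs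

  module _ {C : Set} where

    alt-cong : ∀ {φ ψ : C → List C → Carrier} xs →
               (∀ {y ys} → Pick y ys xs → φ y ys ≈ ψ y ys) → alt φ xs ≈ alt ψ xs
    alt-cong []       h = R.refl
    alt-cong (x ∷ xs) h = +-cong (h here) (-‿cong (alt-cong xs (λ p → h (there p))))

    alt-0 : ∀ {φ : C → List C → Carrier} xs →
            (∀ {y ys} → Pick y ys xs → φ y ys ≈ 0#) → alt φ xs ≈ 0#
    alt-0 []       h = R.refl
    alt-0 (x ∷ xs) h = R.trans (+-cong (h here) (R.trans (-‿cong (alt-0 xs (λ p → h (there p)))) -0#≈0#))
                               (+-identityˡ 0#)

    alt-+ : ∀ (φ ψ : C → List C → Carrier) xs →
            alt (λ y ys → φ y ys + ψ y ys) xs ≈ alt φ xs + alt ψ xs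
    alt-+ φ ψ []       = R.sym (+-identityˡ 0#)
    alt-+ φ ψ (x ∷ xs) = R.trans
      (+-congˡ (R.trans (-‿cong (alt-+ _ _ xs)) (R.sym (-‿+-comm _ _)))) (interchange _ _ _ _)

    alt-neg : ∀ (φ : C → List C → Carrier) xs → alt (λ y ys → - φ y ys) xs ≈ - alt φ xs
    alt-neg φ []       = R.sym -0#≈0#
    alt-neg φ (x ∷ xs) = R.trans (+-congˡ (-‿cong (alt-neg _ xs))) (-‿+-comm _ _)

    alt-*ˡ : ∀ k (φ : C → List C → Carrier) xs → alt (λ y ys → k * φ y ys) xs ≈ k * alt φ xs
    alt-*ˡ k φ []       = R.sym (zeroʳ k)
    alt-*ˡ k φ (x ∷ xs) = R.trans
      (+-congˡ (R.trans (-‿cong (alt-*ˡ k _ xs)) (-‿distribʳ-* k _))) (R.sym (distribˡ k _ _))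

    -- Two entries are deleted in either order with opposite signs, and the summand does not see the
    -- order.
    alt-alt-0 : ∀ (φ : C → C → List C → Carrier) → (∀ x y zs → φ x y zs ≈ φ y x zs) →
                ∀ xs → alt (λ x → alt (φ x)) xs ≈ 0#
    alt-alt-0 φ φ-sym []       = R.refl
    alt-alt-0 φ φ-sym (x ∷ xs) = R.trans (+-congˡ (-‿cong (R.trans
        (R.trans (alt-+ (λ y ys → φ y x ys) _ xs) (+-congˡ (alt-neg _ xs)))
        (R.trans (+-congˡ (R.trans (-‿cong (alt-alt-0 (λ y y′ ys → φ y y′ (x ∷ ys))
                                       (λ y y′ ys → φ-sym y y′ (x ∷ ys)) xs)) -0#≈0#))
          (R.trans (+-identityʳ _) (alt-cong xs (λ {y} {ys} _ → φ-sym y x ys)))))))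
      (-‿inverseʳ _)

  -- Deleting one or the other of the two equal neighbours leaves the same list with opposite sign;
  -- any other deletion leaves a repetition behind.
  alt-adjacent-0 : ∀ {C : Set} (φ : C → List C → Carrier) →
    (∀ y {ys} → AdjacentEqual ys → φ y ys ≈ 0#) →
    ∀ {xs} → AdjacentEqual xs → alt φ xs ≈ 0#
  alt-adjacent-0 φ h (here {x} {xs}) = R.trans (+-congˡ (R.trans (R.sym (-‿+-comm _ _))
      (+-congˡ (R.trans (-‿involutive _) (alt-0 xs (λ {y} _ → h y here))))))
    (R.trans (+-congˡ (+-identityʳ _)) (-‿inverseʳ _))
  alt-adjacent-0 φ h (there {x} eq) = R.trans
    (+-cong (h x eq) (R.trans (-‿cong (alt-adjacent-0 _ (λ y e → h y (there e)) eq)) -0#≈0#))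
    (+-identityˡ 0#)

  module _ {P Q : Set} where

    detL-cong : ∀ {k l : P → Q → Carrier} → (∀ r c → k r c ≈ l r c) →
                ∀ rs cs → detL k rs cs ≈ detL l rs cs
    detL-cong h []       []      = R.refl
    detL-cong h []       (_ ∷ _) = R.refl
    detL-cong h (r ∷ rs) cs      = alt-cong cs (λ {c} {cs′} _ → *-cong (h r c) (detL-cong h rs cs′))

    detL-equalRows : ∀ (k : P → Q → Carrier) {rs} → AdjacentEqual rs → ∀ cs → detL k rs cs ≈ 0#
    detL-equalRows k (here {r} {rs}) cs = R.trans
      (alt-cong cs (λ {c} {cs′} _ → R.sym (alt-*ˡ (k r c) (λ c′ cs″ → k r c′ * detL k rs cs″) cs′)))
      (alt-alt-0 (λ c c′ cs″ → k r c * (k r c′ * detL k rs cs″)) (λ c c′ cs″ → x*yz≈y*xz _ _ _) cs)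
    detL-equalRows k (there eq)      cs =
      alt-0 cs (λ {c} {cs′} _ → R.trans (*-congˡ (detL-equalRows k eq cs′)) (zeroʳ _))

    detL-equalColumns : ∀ (k : P → Q → Carrier) rs {cs} → AdjacentEqual cs → detL k rs cs ≈ 0#
    detL-equalColumns k []       here       = R.refl
    detL-equalColumns k []       (there eq) = R.refl
    detL-equalColumns k (r ∷ rs) eq         = alt-adjacent-0 _
      (λ c e → R.trans (*-congˡ (detL-equalColumns k rs e)) (zeroʳ _)) eq

  detL-map : ∀ {P Q P′ Q′ : Set} (k : P → Q → Carrier) (p : P′ → P) (q : Q′ → Q) rs cs →
             detL k (map p rs) (map q cs) ≈ detL (λ r c → k (p r) (q c)) rs cs
  detL-map k p q []       []       = R.refl
  detL-map k p q []       (_ ∷ _)  = R.refl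
  detL-map k p q (r ∷ rs) cs       = alt-map _ _ cs (λ {c} {cs′} → *-congˡ (detL-map k p q rs cs′))
    where
    alt-map : ∀ φ ψ cs → (∀ {c cs′} → φ (q c) (map q cs′) ≈ ψ c cs′) → alt φ (map q cs) ≈ alt ψ cs
    alt-map φ ψ []       h = R.refl
    alt-map φ ψ (c ∷ cs) h = +-cong h (-‿cong (alt-map _ _ cs h))

-- Raising rows and lowering columns of a determinant

module LetterTags {T : Set} (_≟_ : DecidableEquality T) where

  record Other (a b : T) : Set where
    constructor other
    field
      tag : T
      ≢a  : tag ≢ a
      ≢b  : tag ≢ b

  toTag : ∀ {a b} → Letter (Other a b) → T
  toTag {a}     A     = a
  toTag {_} {b} B     = b
  toTag         (O t) = Other.tag t

  toLetter : ∀ a b → T → Letter (Other a b)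
  toLetter a b t with t ≟ a | t ≟ b
  ... | yes _ | _     = A
  ... | no _  | yes _ = B
  ... | no ≢a | no ≢b = O (other t ≢a ≢b)

  toTag-toLetter : ∀ a b t → toTag (toLetter a b t) ≡ t
  toTag-toLetter a b t with t ≟ a | t ≟ b
  ... | yes t≡a | _       = sym t≡a
  ... | no _    | yes t≡b = sym t≡b
  ... | no _    | no _    = refl

  map-toTag-toLetter : ∀ a b w → map toTag (map (toLetter a b) w) ≡ w
  map-toTag-toLetter a b w = trans (sym (List.map-∘ w))
    (trans (List.map-cong (toTag-toLetter a b) w) (List.map-id w))

module Adjunction (R : CommutativeRing 0ℓ 0ℓ) {T : Set} (_≟_ : DecidableEquality T) where
  open CommutativeRing R hiding (refl; sym; trans)
  private module R = CommutativeRing R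
  open RingProperties ring using (-‿+-comm)
  open CommutativeSemigroupProperties
    +-commutativeSemigroup using (interchange)
  open Laplace R
  open Substitution R
  open LetterTags _≟_

  X-cong : ∀ {T : Set} {Ψ Φ : List (Letter T) → Carrier} z → (∀ v → Ψ v ≈ Φ v) → X Ψ z ≈ X Φ z
  X-cong []        h = h []
  X-cong (A ∷ z)   h = +-cong (X-cong z (λ v → h (A ∷ v))) (X-cong z (λ v → h (B ∷ v)))
  X-cong (B ∷ z)   h = X-cong z (λ v → h (B ∷ v))
  X-cong (O t ∷ z) h = X-cong z (λ v → h (O t ∷ v))

  X-+ : ∀ {T : Set} (Ψ Φ : List (Letter T) → Carrier) z → X (λ v → Ψ v + Φ v) z ≈ X Ψ z + X Φ z
  X-+ Ψ Φ []        = R.refl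
  X-+ Ψ Φ (A ∷ z)   = R.trans (+-cong (X-+ _ _ z) (X-+ _ _ z)) (interchange _ _ _ _)
  X-+ Ψ Φ (B ∷ z)   = X-+ _ _ z
  X-+ Ψ Φ (O t ∷ z) = X-+ _ _ z

  X-++ : ∀ {T : Set} (Ψ : List (Letter T) → Carrier) z z′ →
         X Ψ (z ++ z′) ≈ X (λ v → X (λ v′ → Ψ (v ++ v′)) z′) z
  X-++ Ψ []        z′ = R.refl
  X-++ Ψ (A ∷ z)   z′ = +-cong (X-++ _ z z′) (X-++ _ z z′)
  X-++ Ψ (B ∷ z)   z′ = X-++ _ z z′
  X-++ Ψ (O t ∷ z) z′ = X-++ _ z z′

  -- The substitution acts letter by letter, so the end from which a word is read does not matter.
  -- Label words start with the last position, whereas the determinant takes rows in order.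
  X-reverse : ∀ {T : Set} (Ψ : List (Letter T) → Carrier) z →
              X (λ v → Ψ (reverse v)) z ≈ X Ψ (reverse z)
  X-reverse Ψ []      = R.refl
  X-reverse {T} Ψ (x ∷ z) = R.trans (step x)
    (R.trans (R.sym (X-++ Ψ (reverse z) (x ∷ []))) (R.reflexive (cong (X Ψ) (sym (List.unfold-reverse x z)))))
    where
    snoc : ∀ y → X (λ v → Ψ (reverse (y ∷ v))) z ≈ X (λ v → Ψ (v ++ y ∷ [])) (reverse z)
    snoc y = R.trans (X-cong z (λ v → R.reflexive (cong Ψ (List.unfold-reverse y v)))) (X-reverse _ z)
    step : ∀ x → X (λ v → Ψ (reverse v)) (x ∷ z) ≈ X (λ v → X (λ v′ → Ψ (v ++ v′)) (x ∷ [])) (reverse z)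
    step A     = R.trans (+-cong (snoc A) (snoc B)) (R.sym (X-+ _ _ (reverse z)))
    step B     = snoc B
    step (O t) = snoc (O t)

  module _ {a b : T} where

    substitute : Letter (Other a b) → (T → Carrier) → Carrier
    substitute A     φ = φ a + φ b
    substitute B     φ = φ b
    substitute (O t) φ = φ (Other.tag t)

    substitute-cong : ∀ l {φ ψ} → (∀ t → φ t ≈ ψ t) → substitute l φ ≈ substitute l ψ
    substitute-cong A     h = +-cong (h a) (h b)
    substitute-cong B     h = h b
    substitute-cong (O t) h = h _

    substitute-0 : ∀ l → substitute l (λ _ → 0#) ≈ 0#
    substitute-0 A     = +-identityˡ 0#
    substitute-0 B     = R.refl
    substitute-0 (O t) = R.refl

    substitute-+ : ∀ l φ ψ → substitute l (λ t → φ t + ψ t) ≈ substitute l φ + substitute l ψ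
    substitute-+ A     φ ψ = interchange _ _ _ _
    substitute-+ B     φ ψ = R.refl
    substitute-+ (O t) φ ψ = R.refl

    substitute-neg : ∀ l φ → substitute l (λ t → - φ t) ≈ - substitute l φ
    substitute-neg A     φ = -‿+-comm _ _
    substitute-neg B     φ = R.refl
    substitute-neg (O t) φ = R.refl

    substitute-*ʳ : ∀ l φ k → substitute l (λ t → φ t * k) ≈ substitute l φ * k
    substitute-*ʳ A     φ k = R.sym (distribʳ k _ _)
    substitute-*ʳ B     φ k = R.refl
    substitute-*ʳ (O t) φ k = R.refl

    substitute-swap : ∀ l l′ (φ : T → T → Carrier) →
      substitute l (λ t → substitute l′ (φ t)) ≈ substitute l′ (λ t′ → substitute l (λ t → φ t t′))
    substitute-swap A     A     φ = interchange _ _ _ _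
    substitute-swap A     B     φ = R.refl
    substitute-swap A     (O _) φ = R.refl
    substitute-swap B     _     φ = R.refl
    substitute-swap (O _) _     φ = R.refl

    substitute-alt : ∀ {C : Set} l (φ : T → C → List C → Carrier) cs →
      substitute l (λ t → alt (φ t) cs) ≈ alt (λ c cs′ → substitute l (λ t → φ t c cs′)) cs
    substitute-alt A     φ cs = R.sym (alt-+ _ _ cs)
    substitute-alt B     φ cs = R.refl
    substitute-alt (O _) φ cs = R.refl

    module _ {V : Set} where

      -- `X` on words whose positions also carry a value that stays put: a row of the matrix is a
      -- tag with its value.
      Xᵥ : (List (T × V) → Carrier) → List (Letter (Other a b) × V) → Carrier
      Xᵥ Ψ []            = Ψ []
      Xᵥ Ψ ((l , v) ∷ z) = substitute l (λ t → Xᵥ (λ u → Ψ ((t , v) ∷ u)) z)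

      X-zip : ∀ Ψ z (vs : List V) → length z ≡ length vs →
              X (λ u → Ψ (zip (map toTag u) vs)) z ≈ Xᵥ Ψ (zip z vs)
      X-zip Ψ []        []       _  = R.refl
      X-zip Ψ (A ∷ z)   (v ∷ vs) eq = +-cong (X-zip _ z vs (ℕ.suc-injective eq))
                                             (X-zip _ z vs (ℕ.suc-injective eq))
      X-zip Ψ (B ∷ z)   (v ∷ vs) eq = X-zip _ z vs (ℕ.suc-injective eq)
      X-zip Ψ (O t ∷ z) (v ∷ vs) eq = X-zip _ z vs (ℕ.suc-injective eq)

      Xᵥ-cong : ∀ {Ψ Φ} z → (∀ u → Ψ u ≈ Φ u) → Xᵥ Ψ z ≈ Xᵥ Φ z
      Xᵥ-cong []            h = h []
      Xᵥ-cong ((l , v) ∷ z) h = substitute-cong l (λ t → Xᵥ-cong z (λ u → h _))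

      Xᵥ-0 : ∀ z → Xᵥ (λ _ → 0#) z ≈ 0#
      Xᵥ-0 []            = R.refl
      Xᵥ-0 ((l , v) ∷ z) = R.trans (substitute-cong l (λ _ → Xᵥ-0 z)) (substitute-0 l)

      Xᵥ-+ : ∀ Ψ Φ z → Xᵥ (λ u → Ψ u + Φ u) z ≈ Xᵥ Ψ z + Xᵥ Φ z
      Xᵥ-+ Ψ Φ []            = R.refl
      Xᵥ-+ Ψ Φ ((l , v) ∷ z) = R.trans (substitute-cong l (λ t → Xᵥ-+ _ _ z)) (substitute-+ l _ _)

      Xᵥ-neg : ∀ Ψ z → Xᵥ (λ u → - Ψ u) z ≈ - Xᵥ Ψ z
      Xᵥ-neg Ψ []            = R.refl
      Xᵥ-neg Ψ ((l , v) ∷ z) = R.trans (substitute-cong l (λ t → Xᵥ-neg _ z)) (substitute-neg l _)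

      Xᵥ-*ˡ : ∀ k Ψ z → Xᵥ (λ u → k * Ψ u) z ≈ k * Xᵥ Ψ z
      Xᵥ-*ˡ k Ψ []            = R.refl
      Xᵥ-*ˡ k Ψ ((l , v) ∷ z) = R.trans (substitute-cong l (λ t → Xᵥ-*ˡ k _ z))
        (R.trans (substitute-cong l (λ t → *-comm k _)) (R.trans (substitute-*ʳ l _ k) (*-comm _ k)))

      Xᵥ-alt : ∀ {C : Set} (φ : List (T × V) → C → List C → Carrier) cs z →
        Xᵥ (λ u → alt (φ u) cs) z ≈ alt (λ c cs′ → Xᵥ (λ u → φ u c cs′) z) cs
      Xᵥ-alt φ []       z = Xᵥ-0 z
      Xᵥ-alt φ (c ∷ cs) z = R.trans (Xᵥ-+ _ _ z)
        (+-congˡ (R.trans (Xᵥ-neg _ z) (-‿cong (Xᵥ-alt _ cs z))))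

      -- Here the substituted word is itself the list being expanded, so the deleted letter is
      -- substituted apart from the rest; substitutions at different places commute.
      Xᵥ-alt-columns : ∀ (φ : T × V → List (T × V) → Carrier) z →
        Xᵥ (alt φ) z ≈ alt (λ (l , v) z′ → substitute l (λ t → Xᵥ (φ (t , v)) z′)) z
      Xᵥ-alt-columns φ []            = R.refl
      Xᵥ-alt-columns φ ((l , v) ∷ z) = R.trans
        (substitute-cong l (λ t → R.trans (Xᵥ-+ _ _ z) (+-congˡ (R.trans (Xᵥ-neg _ z)
          (-‿cong (Xᵥ-alt-columns (λ y ys → φ y ((t , v) ∷ ys)) z))))))
        (R.trans (substitute-+ l _ _) (+-congˡ (R.trans (substitute-neg l _) (-‿cong
          (R.trans (substitute-alt l _ z)
            (alt-cong z (λ { {l′ , v′} {z′} _ → substitute-swap l l′ _ })))))))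

      -- Multilinearity: each row enters every term of the expansion once, so a sum over its tag can
      -- be taken inside the matrix entries.
      X-rows : ∀ {Q : Set} (k : T × V → Q → Carrier) z cs →
        Xᵥ (λ rs → detL k rs cs) z ≈ detL (λ (l , v) c → substitute l (λ t → k (t , v) c)) z cs
      X-rows k []            []      = R.refl
      X-rows k []            (_ ∷ _) = R.refl
      X-rows k ((l , v) ∷ z) cs      = R.trans
        (substitute-cong l (λ t → R.trans (Xᵥ-alt _ cs z)
          (alt-cong cs (λ {c} {cs′} _ → R.trans (Xᵥ-*ˡ _ _ z) (*-congˡ (X-rows k z cs′))))))
        (R.trans (substitute-alt l _ cs) (alt-cong cs (λ {c} _ → substitute-*ʳ l _ _)))

      X-columns : ∀ {P : Set} (k : P → T × V → Carrier) rs z →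
        Xᵥ (λ cs → detL k rs cs) z ≈ detL (λ r (l , v) → substitute l (λ t → k r (t , v))) rs z
      X-columns k []       []            = R.refl
      X-columns k []       ((l , v) ∷ z) =
        R.trans (substitute-cong l (λ t → Xᵥ-0 z)) (substitute-0 l)
      X-columns k (r ∷ rs) z             = R.trans (Xᵥ-alt-columns _ z)
        (alt-cong z (λ { {l , v} {z′} _ → R.trans
          (substitute-cong l (λ t → R.trans (Xᵥ-*ˡ _ _ z′) (*-congˡ (X-columns k rs z′))))
          (substitute-*ʳ l _ _) }))

  δ : T → T → Carrier
  δ s t with s ≟ t
  ... | yes _ = 1#
  ... | no _  = 0#

  δ-≡ : ∀ {s t} → s ≡ t → δ s t ≈ 1#
  δ-≡ {s} {t} eq with s ≟ t
  ... | yes _ = R.refl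
  ... | no ≢  = ⊥-elim (≢ eq)

  δ-≢ : ∀ {s t} → s ≢ t → δ s t ≈ 0#
  δ-≢ {s} {t} ≢ with s ≟ t
  ... | yes eq = ⊥-elim (≢ eq)
  ... | no _   = R.refl

  module _ {V W : Set} (ξ : V → W → Carrier) where

    masked : T × V → T × W → Carrier
    masked (s , v) (t , w) = δ s t * ξ v w

    -- Moving rows from a to b is adjoint to moving columns from b to a.
    X-adjoint : ∀ {a b} → a ≢ b → ∀ z vs y ws → length z ≡ length vs → length y ≡ length ws →
      X (λ u → detL masked (zip (map toTag u) vs) (zip (map (toTag {b} {a}) y) ws)) z ≈
      X (λ u → detL masked (zip (map (toTag {a} {b}) z) vs) (zip (map toTag u) ws)) y
    X-adjoint {a} {b} a≢b z vs y ws ez ey = R.trans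
      (R.trans (X-zip (λ rs → detL masked rs (zip (map toTag y) ws)) z vs ez)
        (X-rows masked (zip z vs) (zip (map toTag y) ws)))
      (R.trans (R.trans rows≈ (detL-cong kernel (zip z vs) (zip y ws)))
        (R.trans columns≈ (R.sym (R.trans (X-zip (detL masked (zip (map toTag z) vs)) y ws ey)
          (X-columns masked (zip (map toTag z) vs) (zip y ws))))))
      where
      untag : ∀ {a b} {V : Set} → Letter (Other a b) × V → T × V
      untag (l , v) = toTag l , v
      zip-map : ∀ {a b} {V : Set} (z : List (Letter (Other a b))) (vs : List V) →
                zip (map toTag z) vs ≡ map untag (zip z vs)
      zip-map []      vs       = refl
      zip-map (l ∷ z) []       = refl
      zip-map (l ∷ z) (v ∷ vs) = cong (_ ∷_) (zip-map z vs)
      rowKernel : Letter (Other a b) × V → T × W → Carrier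
      rowKernel (l , v) c = substitute l (λ t → masked (t , v) c)
      columnKernel : T × V → Letter (Other b a) × W → Carrier
      columnKernel r (l , w) = substitute l (λ t → masked r (t , w))
      rows≈ : detL rowKernel (zip z vs) (zip (map toTag y) ws) ≈
              detL (λ p q → rowKernel p (untag q)) (zip z vs) (zip y ws)
      rows≈ = R.trans
        (R.reflexive (cong₂ (detL rowKernel) (sym (List.map-id (zip z vs))) (zip-map y ws)))
        (detL-map rowKernel id untag (zip z vs) (zip y ws))
      columns≈ : detL (λ p q → columnKernel (untag p) q) (zip z vs) (zip y ws) ≈
                 detL columnKernel (zip (map toTag z) vs) (zip y ws)
      columns≈ = R.trans
        (R.sym (detL-map columnKernel untag id (zip z vs) (zip y ws)))
        (R.reflexive (cong₂ (detL columnKernel) (sym (zip-map z vs)) (List.map-id (zip y ws))))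
      +0 : ∀ {x y} → y ≈ 0# → x + y ≈ x
      +0 y≈0 = R.trans (+-congˡ y≈0) (+-identityʳ _)
      0* : ∀ {s t} → s ≢ t → ∀ {x} → δ s t * x ≈ 0#
      0* ≢ = R.trans (*-congʳ (δ-≢ ≢)) (zeroˡ _)
      -- In `y` the letter `A` stands for `b` and `B` for `a`. Row `A` against column `A` gives
      -- `δ a b + δ b b` on the left and `δ a b + δ a a` on the right; elsewhere the two entries
      -- coincide or differ by a `δ` of distinct tags.
      kernel : ∀ p q → rowKernel p (untag q) ≈ columnKernel (untag p) q
      kernel (A , v) (A , w) = +-cong R.refl (*-congʳ (R.trans (δ-≡ refl) (R.sym (δ-≡ refl))))
      kernel (A , v) (B , w) = +0 (0* (a≢b ∘ sym))
      kernel (A , v) (O t , w) = +0 (0* (Other.≢a t ∘ sym))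
      kernel (B , v) (A , w) = R.sym (+0 (0* (a≢b ∘ sym)))
      kernel (B , v) (B , w) = R.refl
      kernel (B , v) (O t , w) = R.refl
      kernel (O t , v) (A , w) = R.sym (+0 (0* (Other.≢a t)))
      kernel (O t , v) (B , w) = R.refl
      kernel (O t , v) (O u , w) = R.refl

-- Sorting by tags and block determinants

below? : ∀ {h} → Fin h → Fin h → ℕ
below? d c with d Fin.<? c
... | yes _ = 1
... | no _  = 0

below?-refl : ∀ {h} {d c : Fin h} → d ≡ c → below? d c ≡ 0
below?-refl {d = d} {c} refl with d Fin.<? c
... | yes d<d = ⊥-elim (ℕ.<-irrefl refl d<d)
... | no _    = refl

module _ {h : ℕ} {V : Set} where

  column : Fin h → List (Fin h × V) → List V
  column c []             = []
  column c ((d , v) ∷ zs) with c Fin.≟ d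
  ... | yes _ = v ∷ column c zs
  ... | no _  = column c zs

  column-≡ : ∀ {c d} → c ≡ d → ∀ v zs → column c ((d , v) ∷ zs) ≡ v ∷ column c zs
  column-≡ {c} {d} eq v zs with c Fin.≟ d
  ... | yes _ = refl
  ... | no ne = ⊥-elim (ne eq)

  column-≢ : ∀ {c d} → c ≢ d → ∀ v zs → column c ((d , v) ∷ zs) ≡ column c zs
  column-≢ {c} {d} ne v zs with c Fin.≟ d
  ... | yes eq = ⊥-elim (ne eq)
  ... | no _   = refl

  size : Fin h → List (Fin h × V) → ℕ
  size c zs = length (column c zs)

  below : Fin h → List (Fin h × V) → ℕ
  below c []             = 0
  below c ((d , _) ∷ zs) = below? d c ℕ.+ below c zs

  pick-column : ∀ {c d u ps zs} → c ≢ d → Pick (d , u) ps zs → column c zs ≡ column c ps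
  pick-column {c} ne (here {xs}) = column-≢ ne _ xs
  pick-column {c} ne (there {e , v} p) with c Fin.≟ e
  ... | yes _ = cong (v ∷_) (pick-column ne p)
  ... | no _  = pick-column ne p

  pick-size : ∀ {d u ps zs} → Pick (d , u) ps zs → size d zs ≡ suc (size d ps)
  pick-size {d} (here {xs}) = cong length (column-≡ refl _ xs)
  pick-size {d} (there {e , v} p) with d Fin.≟ e
  ... | yes _ = cong suc (pick-size p)
  ... | no _  = pick-size p

  pick-below : ∀ {c d u ps zs} → Pick (d , u) ps zs → below c zs ≡ below? d c ℕ.+ below c ps
  pick-below here = refl
  pick-below {c} {d} (there {e , v} {ys = ys} p) = trans (cong (below? e c ℕ.+_) (pick-below p))
    (trans (sym (ℕ.+-assoc (below? e c) (below? d c) _))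
      (trans (cong (ℕ._+ below c ys) (ℕ.+-comm (below? e c) (below? d c))) (ℕ.+-assoc (below? d c) (below? e c) _)))

  find-pick : ∀ {d} zs → 0 < size d zs → ∃[ u ] ∃[ ps ] Pick (d , u) ps zs
  find-pick {d} ((e , v) ∷ zs) pos with d Fin.≟ e
  ... | yes refl = v , zs , here
  ... | no _     = let u , ps , p = find-pick zs pos in u , (e , v) ∷ ps , there p

module _ {h : ℕ} {V W : Set} where

  SameSizes : List (Fin h × V) → List (Fin h × W) → Set
  SameSizes zs ys = ∀ c → size c zs ≡ size c ys

  sameSizes-∷ : ∀ {c v u zs ps ys} → Pick (c , u) ps ys →
                (SameSizes ((c , v) ∷ zs) ys → SameSizes zs ps) ×
                (SameSizes zs ps → SameSizes ((c , v) ∷ zs) ys)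
  sameSizes-∷ {c} {v} {zs = zs} p = to , from
    where
    to : _
    to same e with e Fin.≟ c | same e
    ... | yes refl | eq = ℕ.suc-injective (trans eq (pick-size p))
    ... | no e≢c   | eq = trans eq (cong length (pick-column e≢c p))
    from : _
    from same e with e Fin.≟ c
    ... | yes refl = trans (cong suc (same e)) (sym (pick-size p))
    ... | no e≢c   = trans (same e) (sym (cong length (pick-column e≢c p)))

  -- `below` depends only on the multiset of tags, and equal sizes mean equal multisets; the tags
  -- are matched off one at a time.
  sameSizes-below : ∀ zs ys → SameSizes zs ys → ∀ c → below c zs ≡ below c ys
  sameSizes-below []             []             same c = refl
  sameSizes-below []             ((d , v) ∷ ys) same c with same d
  ... | eq with () ← trans eq (cong length (column-≡ {c = d} refl v ys))
  sameSizes-below ((d , v) ∷ zs) ys             same c =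
    let u , ps , p = find-pick {d = d} ys
          (subst (0 <_) (trans (sym (cong length (column-≡ {c = d} refl v zs))) (same d)) (s≤s z≤n))
    in trans (cong (below? d c ℕ.+_) (sameSizes-below zs ps (proj₁ (sameSizes-∷ p) same) c))
             (sym (pick-below p))

module BlockDeterminant (R : CommutativeRing 0ℓ 0ℓ) {h : ℕ} where
  open CommutativeRing R hiding (refl; sym; trans; zero)
  private module R = CommutativeRing R
  open RingProperties ring using (-‿distribˡ-*; -‿distribʳ-*; -‿involutive)
  open RawMonoidOps *-rawMonoid using () renaming (sum to product)
  open NaturalSolver commutativeSemiring using (solve; _:=_; _:*_)
  open Laplace R
  open Adjunction R (Fin._≟_ {h})

  sign : ℕ → Carrier
  sign zero    = 1#
  sign (suc n) = - sign n

  sign-+ : ∀ m n → sign (m ℕ.+ n) ≈ sign m * sign n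
  sign-+ zero    n = R.sym (*-identityˡ _)
  sign-+ (suc m) n = R.trans (-‿cong (sign-+ m n)) (-‿distribˡ-* _ _)

  sign² : ∀ n → sign n * sign n ≈ 1#
  sign² zero    = *-identityˡ 1#
  sign² (suc n) = R.trans (R.sym (-‿distribˡ-* _ _))
    (R.trans (-‿cong (R.sym (-‿distribʳ-* _ _))) (R.trans (-‿involutive _) (sign² n)))

  module _ {V : Set} where

    -- The sign of the permutation that sorts the tags.
    σ : List (Fin h × V) → Carrier
    σ []             = 1#
    σ ((c , _) ∷ zs) = sign (below c zs) * σ zs

    σ² : ∀ zs → σ zs * σ zs ≈ 1#
    σ² []             = *-identityˡ 1#
    σ² ((c , _) ∷ zs) = R.trans
      (solve 2 (λ s t → (s :* t) :* (s :* t) := (s :* s) :* (t :* t)) R.refl _ _)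
      (R.trans (*-cong (sign² (below c zs)) (σ² zs)) (*-identityˡ 1#))

  δ*-cong : ∀ {s t : Fin h} {x y} → (s ≡ t → x ≈ y) → δ s t * x ≈ δ s t * y
  δ*-cong {s} {t} h with s Fin.≟ t
  ... | yes eq = *-congˡ (h eq)
  ... | no _   = R.trans (zeroˡ _) (R.sym (zeroˡ _))

  sign-flip : ∀ {c d : Fin h} → c ≢ d → - sign (below? c d) ≈ sign (below? d c)
  sign-flip {c} {d} c≢d with c Fin.<? d | d Fin.<? c
  ... | yes c<d | yes d<c = ⊥-elim (ℕ.<-asym c<d d<c)
  ... | yes _   | no _    = -‿involutive 1#
  ... | no _    | yes _   = R.refl
  ... | no c≮d  | no d≮c  = ⊥-elim (c≢d (Fin.toℕ-injective
          (ℕ.≤-antisym (ℕ.≮⇒≥ d≮c) (ℕ.≮⇒≥ c≮d))))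

  module _ {V : Set} (c : Fin h) where

    -- Only entries with tag `c` survive the mask. For such an entry, its position in the list
    -- exceeds its position in the column by the number of other tags before it, and its removal
    -- changes `σ` by the inversions it takes part in. Together, larger tags before it count twice
    -- and smaller tags, on either side, once; this is `sign (below c zs)` whichever entry is
    -- deleted.
    alt-masked : ∀ (θ : V → List V → Carrier) zs →
      alt (λ p ps → δ c (proj₁ p) * (σ ps * θ (proj₂ p) (column c ps))) zs ≈
      sign (below c zs) * (σ zs * alt θ (column c zs))
    alt-masked θ [] = R.sym (R.trans (*-congˡ (zeroʳ _)) (zeroʳ _))
    alt-masked θ ((d , u) ∷ zs) with c Fin.≟ d
    ... | yes refl = R.trans
      (+-cong (*-identityˡ _) (-‿cong (R.trans (alt-cong zs absorb) (R.trans (alt-*ˡ L _ zs)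
          (R.trans (*-congˡ (alt-masked _ zs)) (R.trans (R.sym (*-assoc L L _)) (L²≈1 _)))))))
      (R.trans (R.trans (+-congˡ (-‿distribʳ-* _ _)) (R.sym (distribˡ _ _ _)))
        (R.sym (R.trans (*-congʳ (R.reflexive (cong (λ n → sign (n ℕ.+ below c zs)) (below?-refl {d = c} refl))))
          (R.trans (*-congˡ (*-assoc L _ _)) (R.trans (R.sym (*-assoc L L _)) (L²≈1 _))))))
      where
      L = sign (below c zs)
      L²≈1 : ∀ x → (L * L) * x ≈ x
      L²≈1 x = R.trans (*-congʳ (sign² (below c zs))) (*-identityˡ x)
      absorb : ∀ {p ps} → Pick p ps zs →
        δ c (proj₁ p) * ((sign (below c ps) * σ ps) * θ (proj₂ p) (u ∷ column c ps)) ≈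
        L * (δ c (proj₁ p) * (σ ps * θ (proj₂ p) (u ∷ column c ps)))
      absorb {p} {ps} pick = R.trans
        (δ*-cong {c} {proj₁ p} (λ { refl → R.trans (*-assoc _ _ _)
          (*-cong (R.reflexive (cong sign (sym (trans (pick-below pick) (cong (ℕ._+ below c ps) (below?-refl refl))))))
                  R.refl) }))
        (solve 3 (λ a b c → a :* (b :* c) := b :* (a :* c)) R.refl _ _ _)
    ... | no c≢d = R.trans
      (R.trans (+-cong (zeroˡ _) (-‿cong (R.trans (alt-cong zs absorb) (R.trans (alt-*ˡ K _ zs) (*-congˡ (alt-masked _ zs))))))
        (+-identityˡ _))
      (R.trans (R.trans (-‿distribˡ-* _ _) (*-congʳ (R.trans (-‿distribʳ-* _ _) (*-congˡ (sign-flip c≢d)))))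
        (R.sym (R.trans (*-congʳ (sign-+ (below? d c) (below c zs)))
          (solve 5 (λ s t u v w → (s :* t) :* ((u :* v) :* w) := (u :* s) :* (t :* (v :* w))) R.refl _ _ _ _ _))))
      where
      K = sign (below d zs) * sign (below? c d)
      unsplit : ∀ {p ps} → Pick p ps zs → c ≡ proj₁ p → sign (below d ps) ≈ K
      unsplit {p} {ps} pick refl = R.sym (R.trans
        (*-congʳ (R.trans (R.reflexive (cong sign (pick-below pick))) (sign-+ (below? c d) (below d ps))))
        (R.trans (solve 2 (λ s t → (s :* t) :* s := (s :* s) :* t) R.refl _ _)
          (R.trans (*-congʳ (sign² (below? c d))) (*-identityˡ _))))
      absorb : ∀ {p ps} → Pick p ps zs →
        δ c (proj₁ p) * ((sign (below d ps) * σ ps) * θ (proj₂ p) (column c ps)) ≈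
        K * (δ c (proj₁ p) * (σ ps * θ (proj₂ p) (column c ps)))
      absorb {p} {ps} pick = R.trans
        (δ*-cong {c} {proj₁ p} (λ eq → R.trans (*-assoc _ _ _)
          (*-congʳ (unsplit pick eq))))
        (solve 3 (λ a b c → a :* (b :* c) := b :* (a :* c)) R.refl _ _ _)

  productExcept : ∀ {m} → Fin m → (Fin m → Carrier) → Carrier
  productExcept zero    F = product (F ∘ suc)
  productExcept (suc c) F = F zero * productExcept c (F ∘ suc)

  product-split : ∀ {m} (c : Fin m) F → product F ≈ F c * productExcept c F
  product-split zero    F = R.refl
  product-split (suc c) F = R.trans (*-congˡ (product-split c (F ∘ suc)))
    (solve 3 (λ a b c → a :* (b :* c) := b :* (a :* c)) R.refl _ _ _)

  product-cong : ∀ {m} {F G : Fin m → Carrier} → (∀ e → F e ≈ G e) → product F ≈ product G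
  product-cong {zero}  h = R.refl
  product-cong {suc m} h = *-cong (h zero) (product-cong (λ e → h (suc e)))

  productExcept-cong : ∀ {m} (c : Fin m) {F G} → (∀ e → e ≢ c → F e ≈ G e) →
                       productExcept c F ≈ productExcept c G
  productExcept-cong zero    h = product-cong (λ e → h (suc e) (λ ()))
  productExcept-cong (suc c) h = *-cong (h zero (λ ()))
    (productExcept-cong c (λ e e≢c → h (suc e) (λ { refl → e≢c refl })))

  product-1 : ∀ {m} {F : Fin m → Carrier} → (∀ e → F e ≈ 1#) → product F ≈ 1#
  product-1 {zero}  h = R.refl
  product-1 {suc m} h = R.trans (*-cong (h zero) (product-1 (λ e → h (suc e)))) (*-identityˡ 1#)

  module _ {V W : Set} (ξ : V → W → Carrier) where

    -- Once rows and columns are sorted by tag the matrix is block diagonal, and `σ` pays for the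
    -- sorting. In the induction the sign left by `alt-masked` is absorbed into `σ zs`, because
    -- `below` agrees for rows and columns.
    detL-blocks : ∀ zs ys → SameSizes zs ys →
      detL (masked ξ) zs ys ≈ (σ zs * σ ys) * product (λ c → detL ξ (column c zs) (column c ys))
    detL-blocks [] [] same = R.sym (R.trans (*-cong (*-identityˡ 1#) (product-1 {m = h} (λ _ → R.refl))) (*-identityˡ 1#))
    detL-blocks [] ((d , w) ∷ ys) same with same d
    ... | eq with () ← trans eq (cong length (column-≡ {c = d} refl w ys))
    detL-blocks ((c , v) ∷ zs) ys same = R.trans (alt-cong ys term)
      (R.trans (alt-*ˡ K _ ys) (R.trans (*-congˡ (alt-masked c θ ys)) (R.trans
        (solve 5 (λ s e b t d → (s :* e) :* (b :* (t :* d)) := ((b :* s) :* t) :* (d :* e)) R.refl _ _ _ _ _)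
        (*-cong (*-congʳ (*-congʳ (R.reflexive (cong sign (sym below≡)))))
          (R.sym (R.trans (product-split c blocks)
            (*-congʳ (R.reflexive (cong (λ l → detL ξ l (column c ys)) (column-≡ refl v zs))))))))))
      where
      blocks = λ e → detL ξ (column e ((c , v) ∷ zs)) (column e ys)
      K = σ zs * productExcept c blocks
      θ : W → List W → Carrier
      θ u us = ξ v u * detL ξ (column c zs) us
      below≡ : below c zs ≡ below c ys
      below≡ = trans (cong (ℕ._+ below c zs) (sym (below?-refl {d = c} refl)))
        (sameSizes-below ((c , v) ∷ zs) ys same c)
      term : ∀ {p ps} → Pick p ps ys →
        masked ξ (c , v) p * detL (masked ξ) zs ps ≈
        K * (δ c (proj₁ p) * (σ ps * θ (proj₂ p) (column c ps)))
      term {d , u} {ps} pick = R.trans (*-assoc _ _ _) (R.trans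
        (δ*-cong {c} {d} (λ { refl → R.trans (*-congˡ (R.trans
            (detL-blocks zs ps (proj₁ (sameSizes-∷ pick) same))
            (*-congˡ (R.trans (product-split c _) (*-congˡ (productExcept-cong c (λ e e≢c →
              R.reflexive (cong₂ (detL ξ) (sym (column-≢ e≢c v zs)) (sym (pick-column e≢c pick))))))))))
            (solve 5 (λ x s t d e → x :* ((s :* t) :* (d :* e)) := (s :* e) :* (t :* (x :* d))) R.refl _ _ _ _ _) }))
        (solve 3 (λ a b c → a :* (b :* c) := b :* (a :* c)) R.refl _ _ _))

    -- Some diagonal block is not square. Deleting a row and a column with the same tag preserves
    -- the mismatch, so every term of the expansion vanishes.
    detL-mismatch : ∀ zs ys → ¬ SameSizes zs ys → detL (masked ξ) zs ys ≈ 0#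
    detL-mismatch []             []       ¬same = ⊥-elim (¬same (λ _ → refl))
    detL-mismatch []             (_ ∷ _)  ¬same = R.refl
    detL-mismatch ((c , v) ∷ zs) ys       ¬same = alt-0 ys (λ { {d , u} {ps} pick →
      R.trans (*-assoc _ _ _) (R.trans
        (δ*-cong {c} {d} (λ { refl → R.trans
          (*-congˡ (detL-mismatch zs ps (λ same → ¬same (proj₂ (sameSizes-∷ pick) same))))
          (R.trans (zeroʳ _) (R.sym (zeroʳ 0#))) }))
        (R.trans (*-congˡ (zeroʳ 0#)) (zeroʳ _))) })

-- Determinants of lists, and spans as subgroups

lookup-removeAt : ∀ {C : Set} {k} (xs : Vec C (suc k)) i j →
                  lookup (removeAt xs i) j ≡ lookup xs (punchIn i j)
lookup-removeAt (x ∷ xs)         zero    j       = refl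
lookup-removeAt (x ∷ xs@(_ ∷ _)) (suc i) zero    = refl
lookup-removeAt (x ∷ xs@(_ ∷ _)) (suc i) (suc j) = lookup-removeAt xs i j

module DeterminantOfLists (R : CommutativeRing 0ℓ 0ℓ) where
  open CommutativeRing R hiding (refl; sym; trans; zero)
  private module R = CommutativeRing R
  open RingProperties ring using (-1*x≈-x; -‿distribˡ-*; -‿+-comm; -0#≈0#)
  open RawMonoidOps +-rawMonoid using (sum)
  open RawSemiringOps (Semiring.rawSemiring semiring) using (_^_)
  open Determinant R
  open Laplace R

  sum-cong : ∀ {k} (F G : Fin k → Carrier) → (∀ j → F j ≈ G j) → sum F ≈ sum G
  sum-cong {zero}  F G h = R.refl
  sum-cong {suc k} F G h = +-cong (h zero) (sum-cong (F ∘ suc) (G ∘ suc) (λ j → h (suc j)))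

  sum-neg : ∀ {k} (F : Fin k → Carrier) → sum (λ j → - F j) ≈ - sum F
  sum-neg {zero}  F = R.sym -0#≈0#
  sum-neg {suc k} F = R.trans (+-congˡ (sum-neg (F ∘ suc))) (-‿+-comm _ _)

  det-cong : ∀ {k} {M N : Fin k → Fin k → Carrier} → (∀ i j → M i j ≈ N i j) → det M ≈ det N
  det-cong {zero}  h = R.refl
  det-cong {suc k} h = sum-cong {suc k} _ _ (λ j →
    *-congˡ {(- 1#) ^ toℕ j} (*-cong (h zero j) (det-cong (λ r c → h (suc r) (punchIn j c)))))

  sum-alternating : ∀ {C : Set} {k} (φ : C → List C → Carrier) (js : Vec C (suc k)) →
    sum (λ j → (- 1#) ^ toℕ j * φ (lookup js j) (toList (removeAt js j))) ≈ alt φ (toList js)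
  sum-alternating φ (x ∷ [])         = +-cong (*-identityˡ _) (R.sym -0#≈0#)
  sum-alternating φ (x ∷ js@(_ ∷ _)) = +-cong (*-identityˡ _) (R.trans
    (sum-cong (λ j → (- 1#) ^ suc (toℕ j) * ψ j) (λ j → - ((- 1#) ^ toℕ j * ψ j))
      (λ j → R.trans (*-congʳ (-1*x≈-x _)) (R.sym (-‿distribˡ-* _ _))))
    (R.trans (sum-neg (λ j → (- 1#) ^ toℕ j * ψ j))
      (-‿cong (sum-alternating (λ y ys → φ y (x ∷ ys)) js))))
    where ψ = λ j → φ (lookup js j) (x ∷ toList (removeAt js j))

  det≈detL : ∀ {P Q : Set} {k} (m : P → Q → Carrier) (is : Vec P k) (js : Vec Q k) →
    det (λ r c → m (lookup is r) (lookup js c)) ≈ detL m (toList is) (toList js)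
  det≈detL         m []       []           = R.refl
  det≈detL {k = suc k} m (i ∷ is) js = R.trans
    (sum-cong {suc k} _ (λ j → (- 1#) ^ toℕ j * φ (lookup js j) (toList (removeAt js j)))
      (λ j → *-congˡ {(- 1#) ^ toℕ j} (*-congˡ (R.trans
        (det-cong (λ r c → R.reflexive (cong (m (lookup is r)) (sym (lookup-removeAt js j c)))))
        (det≈detL m is (removeAt js j))))))
    (sum-alternating φ js)
    where φ = λ c cs → m i c * detL m (toList is) cs

module _ (M : RawMonoid 0ℓ 0ℓ) where
  open RawMonoid M
  open RawMonoidOps M using (sum)

  sum-induction : ∀ {k} (g : Fin k → Carrier) (P : Carrier → Set) → P ε →
                  (∀ j {x} → P x → P (g j ∙ x)) → P (sum g)
  sum-induction {zero}  g P z step = z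
  sum-induction {suc k} g P z step = step zero (sum-induction (g ∘ suc) P z (λ j → step (suc j)))

module SpanSubgroup (K : CommutativeRing 0ℓ 0ℓ) (Var : Set) where
  open Polynomials K Var
  open CommutativeRing commutativeRing
    using (zeroʳ; ring) renaming (+-identityʳ to +-idʳ)
  private
    module K = CommutativeRing K

  module _ {I : Set} (f : I → Poly) where

    Span-resp : ∀ {p q} → p ≈ q → Span f p → Span f q
    Span-resp p≈q (k , c , i , eq) = k , c , i , ≈-trans (≈-sym p≈q) eq

    Span-0 : Span f (con K.0#)
    Span-0 = 0 , (λ ()) , (λ ()) , ≈-refl

    Span-∷ : ∀ a j {p} → Span f p → Span f (con a * f j + p)
    Span-∷ a j (k , c , i , eq) = suc k , a Vector.∷ c , j Vector.∷ i , +-cong ≈-refl eq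

    -- Induction that adds one generator at a time in place of vectors of coefficients; closure
    -- under sums and scalars follows from it.
    Span-elim : (P : Poly → Set) → (∀ {p q} → p ≈ q → P p → P q) → P (con K.0#) →
                (∀ a j {p} → P p → P (con a * f j + p)) → ∀ {p} → Span f p → P p
    Span-elim P resp z cons (k , c , i , eq) = resp (≈-sym eq)
      (sum-induction (CommutativeRing.+-rawMonoid commutativeRing) (λ j → con (c j) * f (i j)) P z
        (λ j → cons (c j) (i j)))

    Span-+ : ∀ {p q} → Span f p → Span f q → Span f (p + q)
    Span-+ {q = q} sp sq = Span-elim (λ p → Span f (p + q))
      (λ eq → Span-resp (+-cong eq ≈-refl))
      (Span-resp (≈-sym (+-idˡ q)) sq)
      (λ a j {p} s → Span-resp (≈-sym (+-assoc (con a * f j) p q)) (Span-∷ a j s)) sp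

    Span-* : ∀ a {p} → Span f p → Span f (con a * p)
    Span-* a = Span-elim (λ p → Span f (con a * p))
      (λ eq → Span-resp (*-cong ≈-refl eq))
      (Span-resp (≈-sym (zeroʳ (con a))) Span-0)
      (λ b j {p} s → Span-resp
        (≈-trans (+-cong (≈-trans (*-cong (con-* a b) ≈-refl) (*-assoc (con a) (con b) (f j))) ≈-refl)
                 (≈-sym (distribˡ (con a) (con b * f j) p)))
        (Span-∷ (a K.* b) j s))

    Span-generator : ∀ j → Span f (f j)
    Span-generator j = Span-resp (≈-trans (+-idʳ (con K.1# * f j)) (*-idˡ (f j))) (Span-∷ K.1# j Span-0)

    con-neg1 : con (K.- K.1#) ≈ - con K.1#
    con-neg1 = RingProperties.+-inverseˡ-unique ring (con (K.- K.1#)) (con K.1#)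
      (≈-trans (≈-sym (con-+ (K.- K.1#) K.1#)) (con-cong (K.-‿inverseˡ K.1#)))

    Span-neg : ∀ {p} → Span f p → Span f (- p)
    Span-neg {p} sp = Span-resp
      (≈-trans (*-cong con-neg1 ≈-refl) (RingProperties.-1*x≈-x ring p)) (Span-* (K.- K.1#) sp)

    subgroup : AdditiveSubgroup commutativeRing
    subgroup = record
      { Mem = Span f ; resp = Span-resp ; 0∈ = Span-0 ; +∈ = Span-+ ; -∈ = Span-neg }

module _ (R : CommutativeRing 0ℓ 0ℓ) (𝓘 : AdditiveSubgroup R) {h : ℕ} where
  open CommutativeRing R hiding (refl; sym; trans; zero)
  open AdditiveSubgroup 𝓘
  open BlockDeterminant R {h}

  sign∈ : ∀ k {x} → Mem x → Mem (sign k * x)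
  sign∈ zero    m = resp (CommutativeRing.sym R (*-identityˡ _)) m
  sign∈ (suc k) m = resp (RingProperties.-‿distribˡ-* ring _ _) (-∈ (sign∈ k m))

  σ∈ : ∀ {V : Set} (zs : List (Fin h × V)) {x} → Mem x → Mem (σ zs * x)
  σ∈ []             m = resp (CommutativeRing.sym R (*-identityˡ _)) m
  σ∈ ((c , _) ∷ zs) m = resp (CommutativeRing.sym R (*-assoc _ _ _)) (sign∈ (below c zs) (σ∈ zs m))

  σσ∈ : ∀ {V W : Set} (zs : List (Fin h × V)) (ys : List (Fin h × W)) {x} →
        Mem x → Mem ((σ zs * σ ys) * x)
  σσ∈ zs ys m = resp (CommutativeRing.sym R (*-assoc _ _ _)) (σ∈ zs (σ∈ ys m))

  σσ∈⁻ : ∀ {V W : Set} (zs : List (Fin h × V)) (ys : List (Fin h × W)) {x} →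
         Mem ((σ zs * σ ys) * x) → Mem x
  σσ∈⁻ zs ys {x} m = resp (R.trans (R.sym (*-assoc _ _ _)) (R.trans (*-congʳ square) (*-identityˡ x))) (σσ∈ zs ys m)
    where
    module R = CommutativeRing R
    open CommutativeSemigroupProperties
      *-commutativeSemigroup using (interchange)
    square : (σ zs * σ ys) * (σ zs * σ ys) ≈ 1#
    square = R.trans (interchange _ _ _ _) (R.trans (*-cong (σ² zs) (σ² ys)) (*-identityˡ 1#))

open import Data.Nat using (_+_; _*_; _∸_; _^_)
open +-*-Solver using (solve; _:=_; _:*_; _:+_; con)

-- Exchanging two letters in a balanced prefix

module _ {T : Set} where

  swapLetter : Letter T → Letter T
  swapLetter A     = B
  swapLetter B     = A
  swapLetter (O t) = O t

  #A-swap : ∀ w → #A (map swapLetter w) ≡ #B w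
  #B-swap : ∀ w → #B (map swapLetter w) ≡ #A w
  #A-swap []        = refl
  #A-swap (A ∷ w)   = #A-swap w
  #A-swap (B ∷ w)   = cong suc (#A-swap w)
  #A-swap (O _ ∷ w) = #A-swap w
  #B-swap []        = refl
  #B-swap (A ∷ w)   = cong suc (#B-swap w)
  #B-swap (B ∷ w)   = #B-swap w
  #B-swap (O _ ∷ w) = #B-swap w

  ∣A∷∣-≥ : ∀ (w : List (Letter T)) → #B w ≤ #A w → ∣ A ∷ w ∣ʷ ≡ A ∷ ∣ w ∣ʷ
  ∣A∷∣-≥ w l with #B w ≤? #A w
  ... | yes _ = refl
  ... | no ≰  = ⊥-elim (≰ l)

  ∣A∷∣-< : ∀ (w : List (Letter T)) → #A w < #B w → ∣ A ∷ w ∣ʷ ≡ B ∷ ∣ w ∣ʷ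
  ∣A∷∣-< w l with #B w ≤? #A w
  ... | yes b≤a = ⊥-elim (ℕ.<⇒≱ l b≤a)
  ... | no _    = refl

  ∣B∷∣-≥ : ∀ (w : List (Letter T)) → #A w ≤ #B w → ∣ B ∷ w ∣ʷ ≡ A ∷ ∣ w ∣ʷ
  ∣B∷∣-≥ w l with #A w ≤? #B w
  ... | yes _ = refl
  ... | no ≰  = ⊥-elim (≰ l)

  ∣B∷∣-< : ∀ (w : List (Letter T)) → #B w < #A w → ∣ B ∷ w ∣ʷ ≡ B ∷ ∣ w ∣ʷ
  ∣B∷∣-< w l with #A w ≤? #B w
  ... | yes a≤b = ⊥-elim (ℕ.<⇒≱ l a≤b)
  ... | no _    = refl

  ∣∣-cong-A : ∀ (w v : List (Letter T)) → #A w ≡ #A v → #B w ≡ #B v → ∣ w ∣ʷ ≡ ∣ v ∣ʷ → ∣ A ∷ w ∣ʷ ≡ ∣ A ∷ v ∣ʷ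
  ∣∣-cong-A w v ea eb e with ℕ.≤-<-connex (#B w) (#A w)
  ... | inj₁ l = trans (∣A∷∣-≥ w l) (trans (cong (A ∷_) e) (sym (∣A∷∣-≥ v (subst₂ _≤_ eb ea l))))
  ... | inj₂ l = trans (∣A∷∣-< w l) (trans (cong (B ∷_) e) (sym (∣A∷∣-< v (subst₂ _<_ ea eb l))))

  ∣∣-cong-B : ∀ (w v : List (Letter T)) → #A w ≡ #A v → #B w ≡ #B v → ∣ w ∣ʷ ≡ ∣ v ∣ʷ → ∣ B ∷ w ∣ʷ ≡ ∣ B ∷ v ∣ʷ
  ∣∣-cong-B w v ea eb e with ℕ.≤-<-connex (#A w) (#B w)
  ... | inj₁ l = trans (∣B∷∣-≥ w l) (trans (cong (A ∷_) e) (sym (∣B∷∣-≥ v (subst₂ _≤_ ea eb l))))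
  ... | inj₂ l = trans (∣B∷∣-< w l) (trans (cong (B ∷_) e) (sym (∣B∷∣-< v (subst₂ _<_ eb ea l))))

  -- Negating a path keeps its absolute value. At height 0 this needs the convention that either
  -- letter becomes `A`.
  ∣∣-swap : ∀ w → ∣ map swapLetter w ∣ʷ ≡ ∣ w ∣ʷ
  ∣∣-swap []        = refl
  ∣∣-swap (O t ∷ w) = cong (O t ∷_) (∣∣-swap w)
  ∣∣-swap (A ∷ w) with ℕ.≤-<-connex (#B w) (#A w)
  ... | inj₁ l = trans (∣B∷∣-≥ _ (subst₂ _≤_ (sym (#A-swap w)) (sym (#B-swap w)) l))
                       (trans (cong (A ∷_) (∣∣-swap w)) (sym (∣A∷∣-≥ w l)))
  ... | inj₂ l = trans (∣B∷∣-< _ (subst₂ _<_ (sym (#B-swap w)) (sym (#A-swap w)) l))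
                       (trans (cong (B ∷_) (∣∣-swap w)) (sym (∣A∷∣-< w l)))
  ∣∣-swap (B ∷ w) with ℕ.≤-<-connex (#A w) (#B w)
  ... | inj₁ l = trans (∣A∷∣-≥ _ (subst₂ _≤_ (sym (#B-swap w)) (sym (#A-swap w)) l))
                       (trans (cong (A ∷_) (∣∣-swap w)) (sym (∣B∷∣-≥ w l)))
  ... | inj₂ l = trans (∣A∷∣-< _ (subst₂ _<_ (sym (#A-swap w)) (sym (#B-swap w)) l))
                       (trans (cong (B ∷_) (∣∣-swap w)) (sym (∣B∷∣-< w l)))

  dominates-swap : ∀ {z} w → Dominates z (map swapLetter w) → Dominates z w
  dominates-swap []        []        = []
  dominates-swap (O t ∷ w) (O∷ d)    = O∷ dominates-swap w d
  dominates-swap (A ∷ w)   (A∷B d)   = A∷A (dominates-swap w d)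
  dominates-swap (A ∷ w)   (B∷B d l) = B∷A (dominates-swap w d) (subst (_< _) (#B-swap w) l)
  dominates-swap (B ∷ w)   (A∷A d)   = A∷B (dominates-swap w d)
  dominates-swap (B ∷ w)   (B∷A d l) = B∷B (dominates-swap w d) (subst (_< _) (#A-swap w) l)

  -- Words being read backwards, the base case is a prefix of the path.
  data Flip : List (Letter T) → List (Letter T) → Set where
    base : ∀ v → #A v ≡ #B v → Flip v (map swapLetter v)
    _∷_  : ∀ x {v v′} → Flip v v′ → Flip (x ∷ v) (x ∷ v′)

  flip-#A : ∀ {v v′} → Flip v v′ → #A v ≡ #A v′
  flip-#B : ∀ {v v′} → Flip v v′ → #B v ≡ #B v′
  flip-#A (base v eq) = trans eq (sym (#A-swap v))
  flip-#A (A ∷ f)     = cong suc (flip-#A f)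
  flip-#A (B ∷ f)     = flip-#A f
  flip-#A (O _ ∷ f)   = flip-#A f
  flip-#B (base v eq) = trans (sym eq) (sym (#B-swap v))
  flip-#B (A ∷ f)     = flip-#B f
  flip-#B (B ∷ f)     = cong suc (flip-#B f)
  flip-#B (O _ ∷ f)   = flip-#B f

  flip-∣∣ : ∀ {v v′} → Flip v v′ → ∣ v ∣ʷ ≡ ∣ v′ ∣ʷ
  flip-∣∣ (base v _) = sym (∣∣-swap v)
  flip-∣∣ (O t ∷ f)  = cong (O t ∷_) (flip-∣∣ f)
  flip-∣∣ {A ∷ v} {A ∷ v′} (A ∷ f) = ∣∣-cong-A v v′ (flip-#A f) (flip-#B f) (flip-∣∣ f)
  flip-∣∣ {B ∷ v} {B ∷ v′} (B ∷ f) = ∣∣-cong-B v v′ (flip-#A f) (flip-#B f) (flip-∣∣ f)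

  flip-dominates : ∀ {v v′ z} → Flip v v′ → Dominates z v′ → Dominates z v
  flip-dominates (base v _) d         = dominates-swap v d
  flip-dominates (_ ∷ f)    (O∷ d)    = O∷ flip-dominates f d
  flip-dominates (_ ∷ f)    (A∷A d)   = A∷A (flip-dominates f d)
  flip-dominates (_ ∷ f)    (A∷B d)   = A∷B (flip-dominates f d)
  flip-dominates (_ ∷ f)    (B∷A d l) = B∷A (flip-dominates f d) (subst (_< _) (sym (flip-#A f)) l)
  flip-dominates (_ ∷ f)    (B∷B d l) = B∷B (flip-dominates f d) (subst (_< _) (sym (flip-#B f)) l)

triangular : ℕ → ℕ
triangular zero    = 0
triangular (suc n) = suc n + triangular n

-- Convexity. With `x′ = x + d` the sum forces `y = d + y′`, and `y ≤ x′` gives `y′ ≤ x`: each of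
-- the `d` steps up from `x` adds at least as much as the matching step up from `y′`.
triangular-spread : ∀ {x y x′ y′} → x′ + y′ ≡ x + y → x ≤ x′ → y ≤ x′ →
  triangular x + triangular y ≤ triangular x′ + triangular y′ ×
  (x < x′ → y < x′ → triangular x + triangular y < triangular x′ + triangular y′)
triangular-spread {x} {y} {x′} {y′} sum x≤x′ y≤x′ with ℕ.m≤n⇒∃[o]m+o≡n x≤x′
... | d , refl with refl ← ℕ.+-cancelˡ-≡ x _ _ (trans (sym (ℕ.+-assoc x d y′)) sum) =
    weak d (ℕ.+-cancelʳ-≤ d y′ x (ℕ.≤-trans (ℕ.≤-reflexive (ℕ.+-comm y′ d)) y≤x′))
  , strict d
  where
  weak : ∀ d → y′ ≤ x → triangular x + triangular (d + y′) ≤ triangular (x + d) + triangular y′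
  weak zero    l = ℕ.≤-reflexive (cong (λ n → triangular n + triangular y′) (sym (ℕ.+-identityʳ x)))
  weak (suc d) l rewrite ℕ.+-suc x d = subst₂ _≤_
    (solve 3 (λ s a b → s :+ (a :+ b) := a :+ (s :+ b)) refl (suc d + y′) (triangular x) (triangular (d + y′)))
    (sym (ℕ.+-assoc (suc (x + d)) (triangular (x + d)) (triangular y′)))
    (ℕ.+-mono-≤ (s≤s (ℕ.≤-trans (ℕ.≤-reflexive (ℕ.+-comm d y′)) (ℕ.+-monoˡ-≤ d l))) (weak d l))
  strict : ∀ d → x < x + d → d + y′ < x + d →
           triangular x + triangular (d + y′) < triangular (x + d) + triangular y′
  strict zero    x<x _ = ⊥-elim (ℕ.<-irrefl (sym (ℕ.+-identityʳ x)) x<x)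
  strict (suc d) _ l rewrite ℕ.+-suc x d = subst₂ _<_
    (solve 3 (λ s a b → s :+ (a :+ b) := a :+ (s :+ b)) refl (suc d + y′) (triangular x) (triangular (d + y′)))
    (sym (ℕ.+-assoc (suc (x + d)) (triangular (x + d)) (triangular y′)))
    (ℕ.+-mono-<-≤ l (weak d (ℕ.<⇒≤ (ℕ.+-cancelʳ-< d y′ x
      (ℕ.≤-trans (ℕ.≤-reflexive (cong suc (ℕ.+-comm y′ d))) (ℕ.≤-pred l))))))

-- Dominance statistics of words of labels

module Words {h : ℕ} where
  open LetterTags (Fin._≟_ {h}) public

  Word = List (Fin h)

  hit : Fin h → Fin h → ℕ
  hit c x with c Fin.≟ x
  ... | yes _ = 1
  ... | no _  = 0

  hit-≡ : ∀ {c x} → c ≡ x → hit c x ≡ 1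
  hit-≡ {c} {x} eq with c Fin.≟ x
  ... | yes _ = refl
  ... | no ne = ⊥-elim (ne eq)

  hit-≢ : ∀ {c x} → c ≢ x → hit c x ≡ 0
  hit-≢ {c} {x} ne with c Fin.≟ x
  ... | yes eq = ⊥-elim (ne eq)
  ... | no _   = refl

  count : Fin h → Word → ℕ
  count c []      = 0
  count c (x ∷ w) = hit c x + count c w

  -- Sums of ranks within columns: q w = Σ_c triangular (count c w), so q grows with
  -- the shape in dominance order and μ, its sum over all prefixes, with the tableau.
  q μ : Word → ℕ
  q []      = 0
  q (x ∷ w) = suc (count x w) + q w
  μ []      = 0
  μ (x ∷ w) = q (x ∷ w) + μ w

  count≤length : ∀ c w → count c w ≤ length w
  count≤length c []      = z≤n
  count≤length c (x ∷ w) with c Fin.≟ x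
  ... | yes _ = s≤s (count≤length c w)
  ... | no _  = ℕ.m≤n⇒m≤1+n (count≤length c w)

  -- The inductions raise `q` and `μ`; subtracting from an upper bound turns this into a
  -- well-founded descent.
  bound : ℕ → ℕ
  bound zero    = 0
  bound (suc n) = suc n + bound n

  q≤ : ∀ w → q w ≤ bound (length w)
  q≤ []      = z≤n
  q≤ (x ∷ w) = ℕ.+-mono-≤ (s≤s (count≤length x w)) (q≤ w)

  bound₂ : ℕ → ℕ
  bound₂ zero    = 0
  bound₂ (suc n) = bound (suc n) + bound₂ n

  μ≤ : ∀ w → μ w ≤ bound₂ (length w)
  μ≤ []      = z≤n
  μ≤ (x ∷ w) = ℕ.+-mono-≤ (q≤ (x ∷ w)) (μ≤ w)

  swap : Fin h → Fin h → Fin h → Fin h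
  swap a b x with x Fin.≟ a | x Fin.≟ b
  ... | yes _ | _     = b
  ... | no _  | yes _ = a
  ... | no _  | no _  = x

  swap-a : ∀ a b → swap a b a ≡ b
  swap-a a b with a Fin.≟ a
  ... | yes _ = refl
  ... | no ne = ⊥-elim (ne refl)

  swap-b : ∀ a b → swap a b b ≡ a
  swap-b a b with b Fin.≟ a | b Fin.≟ b
  ... | yes eq | _     = eq
  ... | no _   | yes _ = refl
  ... | no _   | no ne = ⊥-elim (ne refl)

  swap-other : ∀ {a b x} → x ≢ a → x ≢ b → swap a b x ≡ x
  swap-other {a} {b} {x} ≢a ≢b with x Fin.≟ a | x Fin.≟ b
  ... | yes eq | _      = ⊥-elim (≢a eq)
  ... | no _   | yes eq = ⊥-elim (≢b eq)
  ... | no _   | no _   = refl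

  data View (a b x : Fin h) : Set where
    isA   : x ≡ a → View a b x
    isB   : x ≡ b → View a b x
    isO   : x ≢ a → x ≢ b → View a b x

  view : ∀ a b x → View a b x
  view a b x with x Fin.≟ a | x Fin.≟ b
  ... | yes eq | _      = isA eq
  ... | no _   | yes eq = isB eq
  ... | no ≢a  | no ≢b  = isO ≢a ≢b

  swap-involutive : ∀ a b x → swap a b (swap a b x) ≡ x
  swap-involutive a b x with view a b x
  ... | isA refl = trans (cong (swap a b) (swap-a a b)) (swap-b a b)
  ... | isB refl = trans (cong (swap a b) (swap-b a b)) (swap-a a b)
  ... | isO ≢a ≢b = trans (cong (swap a b) (swap-other ≢a ≢b)) (swap-other ≢a ≢b)

  swap-sym : ∀ a b x → swap a b x ≡ swap b a x
  swap-sym a b x with view a b x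
  ... | isA refl = trans (swap-a a b) (sym (swap-b b a))
  ... | isB refl = trans (swap-b a b) (sym (swap-a b a))
  ... | isO ≢a ≢b = trans (swap-other ≢a ≢b) (sym (swap-other ≢b ≢a))

  swap-injective : ∀ a b {x y} → swap a b x ≡ swap a b y → x ≡ y
  swap-injective a b eq =
    trans (sym (swap-involutive a b _)) (trans (cong (swap a b) eq) (swap-involutive a b _))

  hit-swap : ∀ a b c x → hit (swap a b c) (swap a b x) ≡ hit c x
  hit-swap a b c x with c Fin.≟ x
  ... | yes eq = hit-≡ (cong (swap a b) eq)
  ... | no ne  = hit-≢ (ne ∘ swap-injective a b)

  count-swap : ∀ a b c w → count (swap a b c) (map (swap a b) w) ≡ count c w
  count-swap a b c []      = refl
  count-swap a b c (x ∷ w) = cong₂ _+_ (hit-swap a b c x) (count-swap a b c w)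

  count-swap′ : ∀ a b c w → count c (map (swap a b) w) ≡ count (swap a b c) w
  count-swap′ a b c w = trans (cong (λ d → count d (map (swap a b) w)) (sym (swap-involutive a b c)))
    (count-swap a b (swap a b c) w)

  count-swap-balanced : ∀ {a b} c w → count a w ≡ count b w → count c (map (swap a b) w) ≡ count c w
  count-swap-balanced {a} {b} c w eq with view a b c
  ... | isA refl = trans (count-swap′ a b a w) (trans (cong (λ d → count d w) (swap-a a b)) (sym eq))
  ... | isB refl = trans (count-swap′ a b b w) (trans (cong (λ d → count d w) (swap-b a b)) eq)
  ... | isO ≢a ≢b = trans (count-swap′ a b c w) (cong (λ d → count d w) (swap-other ≢a ≢b))

  q-swap : ∀ a b w → q (map (swap a b) w) ≡ q w
  q-swap a b []      = refl
  q-swap a b (x ∷ w) = cong₂ _+_ (cong suc (count-swap a b x w)) (q-swap a b w)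

  μ-swap : ∀ a b w → μ (map (swap a b) w) ≡ μ w
  μ-swap a b []      = refl
  μ-swap a b (x ∷ w) = cong₂ _+_ (q-swap a b (x ∷ w)) (μ-swap a b w)

  data FlipTags (a b : Fin h) : Word → Word → Set where
    base : ∀ v → count a v ≡ count b v → FlipTags a b v (map (swap a b) v)
    _∷_  : ∀ x {v v′} → FlipTags a b v v′ → FlipTags a b (x ∷ v) (x ∷ v′)

  module _ {a b : Fin h} where

    flip-sym : ∀ {v v′} → FlipTags a b v v′ → FlipTags b a v v′
    flip-sym (base v eq) = subst (FlipTags b a v) (List.map-cong (swap-sym b a) v) (base v (sym eq))
    flip-sym (x ∷ f)     = x ∷ flip-sym f

    flip-length : ∀ {v v′} → FlipTags a b v v′ → length v′ ≡ length v
    flip-length (base v _) = List.length-map (swap a b) v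
    flip-length (x ∷ f)    = cong suc (flip-length f)

    flip-count : ∀ {v v′} → FlipTags a b v v′ → ∀ c → count c v′ ≡ count c v
    flip-count (base v eq) c = count-swap-balanced c v eq
    flip-count (x ∷ f)     c = cong (hit c x +_) (flip-count f c)

    flip-q : ∀ {v v′} → FlipTags a b v v′ → q v′ ≡ q v
    flip-q (base v eq) = q-swap a b v
    flip-q (x ∷ f)     = cong₂ _+_ (cong suc (flip-count f x)) (flip-q f)

    flip-μ : ∀ {v v′} → FlipTags a b v v′ → μ v′ ≡ μ v
    flip-μ (base v eq) = μ-swap a b v
    flip-μ (x ∷ f)     = cong₂ _+_ (flip-q (x ∷ f)) (flip-μ f)

    toLetter-a : ∀ {x} → x ≡ a → toLetter a b x ≡ A
    toLetter-a {x} eq with x Fin.≟ a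
    ... | yes _ = refl
    ... | no ne = ⊥-elim (ne eq)

    toLetter-b : a ≢ b → ∀ {x} → x ≡ b → toLetter a b x ≡ B
    toLetter-b a≢b {x} refl with x Fin.≟ a | x Fin.≟ x
    ... | yes eq | _     = ⊥-elim (a≢b (sym eq))
    ... | no _   | yes _ = refl
    ... | no _   | no ne = ⊥-elim (ne refl)

    #A-toLetter : ∀ w → #A (map (toLetter a b) w) ≡ count a w
    #A-toLetter []      = refl
    #A-toLetter (x ∷ w) with x Fin.≟ a | x Fin.≟ b
    ... | yes eq | _     = trans (cong suc (#A-toLetter w)) (cong (_+ count a w) (sym (hit-≡ (sym eq))))
    ... | no ne  | yes _ = trans (#A-toLetter w) (cong (_+ count a w) (sym (hit-≢ (ne ∘ sym))))
    ... | no ne  | no _  = trans (#A-toLetter w) (cong (_+ count a w) (sym (hit-≢ (ne ∘ sym))))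

    module _ (a≢b : a ≢ b) where

      #B-toLetter : ∀ w → #B (map (toLetter a b) w) ≡ count b w
      #B-toLetter []      = refl
      #B-toLetter (x ∷ w) with x Fin.≟ a | x Fin.≟ b
      ... | yes eq | _      = trans (#B-toLetter w) (cong (_+ count b w)
              (sym (hit-≢ (λ b≡x → a≢b (trans (sym eq) (sym b≡x))))))
      ... | no _   | yes eq = trans (cong suc (#B-toLetter w)) (cong (_+ count b w) (sym (hit-≡ (sym eq))))
      ... | no _   | no ne  = trans (#B-toLetter w) (cong (_+ count b w) (sym (hit-≢ (ne ∘ sym))))

      toLetter-swap : ∀ x → toLetter a b (swap a b x) ≡ swapLetter (toLetter a b x)
      toLetter-swap x with view a b x
      ... | isA refl = trans (cong (toLetter a b) (swap-a a b))
        (trans (toLetter-b a≢b refl) (cong swapLetter (sym (toLetter-a refl))))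
      ... | isB refl = trans (cong (toLetter a b) (swap-b a b))
        (trans (toLetter-a refl) (cong swapLetter (sym (toLetter-b a≢b refl))))
      ... | isO ≢a ≢b rewrite swap-other ≢a ≢b with x Fin.≟ a | x Fin.≟ b
      ...   | yes eq | _      = ⊥-elim (≢a eq)
      ...   | no _   | yes eq = ⊥-elim (≢b eq)
      ...   | no _   | no _   = refl

      toLetter-flip : ∀ {v v′} → FlipTags a b v v′ → Flip (map (toLetter a b) v) (map (toLetter a b) v′)
      toLetter-flip (x ∷ f)     = toLetter a b x ∷ toLetter-flip f
      toLetter-flip (base v eq) = subst (Flip (map (toLetter a b) v))
        (trans (sym (List.map-∘ v)) (trans (List.map-cong (λ x → sym (toLetter-swap x)) v) (List.map-∘ v)))
        (base (map (toLetter a b) v) (trans (#A-toLetter v) (trans eq (sym (#B-toLetter v)))))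

      private
        tags : List (Letter (Other a b)) → Word
        tags = map toTag

      count-a-toTag : ∀ z → count a (tags z) ≡ #A z
      count-a-toTag []        = refl
      count-a-toTag (A ∷ z)   = cong₂ _+_ (hit-≡ refl) (count-a-toTag z)
      count-a-toTag (B ∷ z)   = cong₂ _+_ (hit-≢ a≢b) (count-a-toTag z)
      count-a-toTag (O t ∷ z) = cong₂ _+_ (hit-≢ (Other.≢a t ∘ sym)) (count-a-toTag z)

      count-b-toTag : ∀ z → count b (tags z) ≡ #B z
      count-b-toTag []        = refl
      count-b-toTag (A ∷ z)   = cong₂ _+_ (hit-≢ (a≢b ∘ sym)) (count-b-toTag z)
      count-b-toTag (B ∷ z)   = cong₂ _+_ (hit-≡ refl) (count-b-toTag z)
      count-b-toTag (O t ∷ z) = cong₂ _+_ (hit-≢ (Other.≢b t ∘ sym)) (count-b-toTag z)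

      count-other : ∀ {c} → c ≢ a → c ≢ b → ∀ {z w} → Dominates z w → count c (tags z) ≡ count c (tags w)
      count-other ≢a ≢b []        = refl
      count-other ≢a ≢b (O∷ d)    = cong (hit _ _ +_) (count-other ≢a ≢b d)
      count-other ≢a ≢b (A∷A d)   = cong (hit _ _ +_) (count-other ≢a ≢b d)
      count-other ≢a ≢b (A∷B d)   = cong₂ _+_ (trans (hit-≢ ≢a) (sym (hit-≢ ≢b))) (count-other ≢a ≢b d)
      count-other ≢a ≢b (B∷A d _) = cong₂ _+_ (trans (hit-≢ ≢b) (sym (hit-≢ ≢a))) (count-other ≢a ≢b d)
      count-other ≢a ≢b (B∷B d _) = cong (hit _ _ +_) (count-other ≢a ≢b d)

      count-dominates : ∀ {z w} → Dominates z w → #A z ≡ #A w → ∀ c → count c (tags z) ≡ count c (tags w)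
      count-dominates {z} {w} d eq c with view a b c
      ... | isA refl  = trans (count-a-toTag z) (trans eq (sym (count-a-toTag w)))
      ... | isB refl  = trans (count-b-toTag z) (trans
              (ℕ.+-cancelˡ-≡ (#A w) _ _ (trans (cong (_+ #B z) (sym eq)) (dominates-sum d)))
              (sym (count-b-toTag w)))
      ... | isO ≢a ≢b = count-other ≢a ≢b d

      -- Every column contributes the triangular number of its size to `q`, and the columns other
      -- than `a` and `b` have equal sizes in `z` and `w`. Terms are moved across to avoid
      -- subtraction.
      q-dominates : ∀ {z w} → Dominates z w →
        q (tags z) + (triangular (#A w) + triangular (#B w)) ≡
        q (tags w) + (triangular (#A z) + triangular (#B z))
      q-dominates []     = refl
      q-dominates {O t ∷ z} {O _ ∷ w} (O∷ d) rewrite count-other (Other.≢a t) (Other.≢b t) d =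
        trans (ℕ.+-assoc (suc (count (Other.tag t) (tags w))) _ _)
          (trans (cong (suc (count (Other.tag t) (tags w)) +_) (q-dominates d))
            (sym (ℕ.+-assoc (suc (count (Other.tag t) (tags w))) _ _)))
      q-dominates {A ∷ z} {A ∷ w} (A∷A d) rewrite count-a-toTag z | count-a-toTag w =
        exchange (suc (#A z)) (suc (#A w)) (q-dominates d)
        where
        exchange : ∀ m n {s t u v x y} → s + (t + u) ≡ v + (x + y) →
                   (m + s) + ((n + t) + u) ≡ (n + v) + ((m + x) + y)
        exchange m n {s} {t} {u} {v} {x} {y} eq = trans
          (solve 5 (λ m n s t u → (m :+ s) :+ ((n :+ t) :+ u) := (m :+ n) :+ (s :+ (t :+ u))) refl m n s t u)
          (trans (cong ((m + n) +_) eq)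
            (solve 5 (λ m n s t u → (m :+ n) :+ (s :+ (t :+ u)) := (n :+ s) :+ ((m :+ t) :+ u)) refl m n v x y))
      q-dominates {A ∷ z} {B ∷ w} (A∷B d) rewrite count-a-toTag z | count-b-toTag w =
        exchange (suc (#A z)) (suc (#B w)) (q-dominates d)
        where
        exchange : ∀ m n {s t u v x y} → s + (t + u) ≡ v + (x + y) →
                   (m + s) + (t + (n + u)) ≡ (n + v) + ((m + x) + y)
        exchange m n {s} {t} {u} {v} {x} {y} eq = trans
          (solve 5 (λ m n s t u → (m :+ s) :+ (t :+ (n :+ u)) := (m :+ n) :+ (s :+ (t :+ u))) refl m n s t u)
          (trans (cong ((m + n) +_) eq)
            (solve 5 (λ m n s t u → (m :+ n) :+ (s :+ (t :+ u)) := (n :+ s) :+ ((m :+ t) :+ u)) refl m n v x y))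
      q-dominates {B ∷ z} {A ∷ w} (B∷A d _) rewrite count-b-toTag z | count-a-toTag w =
        exchange (suc (#B z)) (suc (#A w)) (q-dominates d)
        where
        exchange : ∀ m n {s t u v x y} → s + (t + u) ≡ v + (x + y) →
                   (m + s) + ((n + t) + u) ≡ (n + v) + (x + (m + y))
        exchange m n {s} {t} {u} {v} {x} {y} eq = trans
          (solve 5 (λ m n s t u → (m :+ s) :+ ((n :+ t) :+ u) := (m :+ n) :+ (s :+ (t :+ u))) refl m n s t u)
          (trans (cong ((m + n) +_) eq)
            (solve 5 (λ m n s t u → (m :+ n) :+ (s :+ (t :+ u)) := (n :+ s) :+ (t :+ (m :+ u))) refl m n v x y))
      q-dominates {B ∷ z} {B ∷ w} (B∷B d _) rewrite count-b-toTag z | count-b-toTag w =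
        exchange (suc (#B z)) (suc (#B w)) (q-dominates d)
        where
        exchange : ∀ m n {s t u v x y} → s + (t + u) ≡ v + (x + y) →
                   (m + s) + (t + (n + u)) ≡ (n + v) + (x + (m + y))
        exchange m n {s} {t} {u} {v} {x} {y} eq = trans
          (solve 5 (λ m n s t u → (m :+ s) :+ (t :+ (n :+ u)) := (m :+ n) :+ (s :+ (t :+ u))) refl m n s t u)
          (trans (cong ((m + n) +_) eq)
            (solve 5 (λ m n s t u → (m :+ n) :+ (s :+ (t :+ u)) := (n :+ s) :+ (t :+ (m :+ u))) refl m n v x y))

      dominates-q≤ : ∀ {z w} → Dominates z w → q (tags w) ≤ q (tags z)
      dominates-q≤ {z} {w} d = ℕ.+-cancelʳ-≤ (triangular (#A w) + triangular (#B w)) _ _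
        (ℕ.≤-trans
          (ℕ.+-monoʳ-≤ (q (tags w)) (proj₁ (triangular-spread (dominates-sum d) (dominates-#A d) (dominates-#B d))))
          (ℕ.≤-reflexive (sym (q-dominates d))))

      dominates-q< : ∀ {z w} → Dominates z w → #A w < #A z → #B w < #A z → q (tags w) < q (tags z)
      dominates-q< {z} {w} d a< b< = ℕ.+-cancelʳ-< (triangular (#A w) + triangular (#B w)) _ _
        (ℕ.<-≤-trans
          (ℕ.+-monoʳ-< (q (tags w))
            (proj₂ (triangular-spread (dominates-sum d) (dominates-#A d) (dominates-#B d)) a< b<))
          (ℕ.≤-reflexive (sym (q-dominates d))))

      dominates-μ≤ : ∀ {z w} → Dominates z w → μ (tags w) ≤ μ (tags z)
      dominates-μ≤ []           = z≤n
      dominates-μ≤ d@(O∷ e)     = ℕ.+-mono-≤ (dominates-q≤ d) (dominates-μ≤ e)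
      dominates-μ≤ d@(A∷A e)    = ℕ.+-mono-≤ (dominates-q≤ d) (dominates-μ≤ e)
      dominates-μ≤ d@(A∷B e)    = ℕ.+-mono-≤ (dominates-q≤ d) (dominates-μ≤ e)
      dominates-μ≤ d@(B∷A e _)  = ℕ.+-mono-≤ (dominates-q≤ d) (dominates-μ≤ e)
      dominates-μ≤ d@(B∷B e _)  = ℕ.+-mono-≤ (dominates-q≤ d) (dominates-μ≤ e)

      private
        cons : ∀ {x z y w} → Dominates z w → Dominates (x ∷ z) (y ∷ w) →
          z ≡ ∣ w ∣ʷ ⊎ μ (tags w) < μ (tags z) →
          (z ≡ ∣ w ∣ʷ → x ∷ z ≡ ∣ y ∷ w ∣ʷ ⊎ #A (y ∷ w) < #A (x ∷ z) × #B (y ∷ w) < #A (x ∷ z)) →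
          x ∷ z ≡ ∣ y ∷ w ∣ʷ ⊎ μ (tags (y ∷ w)) < μ (tags (x ∷ z))
        cons d d′ (inj₂ lt) tie = inj₂ (ℕ.+-mono-≤-< (dominates-q≤ d′) lt)
        cons d d′ (inj₁ eq) tie with tie eq
        ... | inj₁ eq′       = inj₁ eq′
        ... | inj₂ (a< , b<) = inj₂ (ℕ.+-mono-<-≤ (dominates-q< d′ a< b<) (dominates-μ≤ d))

      -- `∣ w ∣ʷ` is the lowest path allowed. At the first position, in reading order, where `z`
      -- leaves it, `z` has more letters `A` than `w` has of either kind, so `q` of that prefix is
      -- strictly larger; no later prefix loses.
      dominates-μ : ∀ {z w} → Dominates z w → z ≡ ∣ w ∣ʷ ⊎ μ (tags w) < μ (tags z)
      dominates-μ []                = inj₁ refl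
      dominates-μ d@(O∷ e)          = cons e d (dominates-μ e) (λ { refl → inj₁ refl })
      dominates-μ {_} {A ∷ w} d@(A∷A e)   = cons e d (dominates-μ e) λ { refl → tie }
        where
        tie : A ∷ ∣ w ∣ʷ ≡ ∣ A ∷ w ∣ʷ ⊎ #A (A ∷ w) < #A (A ∷ ∣ w ∣ʷ) × #B (A ∷ w) < #A (A ∷ ∣ w ∣ʷ)
        tie with #B w ≤? #A w
        ... | yes _  = inj₁ refl
        ... | no b≰a = inj₂ (subst (λ n → suc (#A w) < suc n × #B w < suc n)
          (sym (#A-∣∣-≤ w (ℕ.<⇒≤ (ℕ.≰⇒> b≰a)))) (s≤s (ℕ.≰⇒> b≰a) , ℕ.≤-refl))
      dominates-μ {_} {B ∷ w} d@(A∷B e)   = cons e d (dominates-μ e) λ { refl → tie }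
        where
        tie : A ∷ ∣ w ∣ʷ ≡ ∣ B ∷ w ∣ʷ ⊎ #A (B ∷ w) < #A (A ∷ ∣ w ∣ʷ) × #B (B ∷ w) < #A (A ∷ ∣ w ∣ʷ)
        tie with #A w ≤? #B w
        ... | yes _  = inj₁ refl
        ... | no a≰b = inj₂ (subst (λ n → #A w < suc n × suc (#B w) < suc n)
          (sym (#A-∣∣-≥ w (ℕ.<⇒≤ (ℕ.≰⇒> a≰b)))) (ℕ.≤-refl , s≤s (ℕ.≰⇒> a≰b)))
      dominates-μ {_} {A ∷ w} d@(B∷A e l) = cons e d (dominates-μ e) λ { refl → tie l }
        where
        tie : #A w < #A ∣ w ∣ʷ →
              B ∷ ∣ w ∣ʷ ≡ ∣ A ∷ w ∣ʷ ⊎ #A (A ∷ w) < #A (B ∷ ∣ w ∣ʷ) × #B (A ∷ w) < #A (B ∷ ∣ w ∣ʷ)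
        tie l with #B w ≤? #A w
        ... | yes b≤a = ⊥-elim (ℕ.<-irrefl (sym (#A-∣∣-≥ w b≤a)) l)
        ... | no _    = inj₁ refl
      dominates-μ {_} {B ∷ w} d@(B∷B e l) = cons e d (dominates-μ e) λ { refl → tie l }
        where
        tie : #B w < #A ∣ w ∣ʷ →
              B ∷ ∣ w ∣ʷ ≡ ∣ B ∷ w ∣ʷ ⊎ #A (B ∷ w) < #A (B ∷ ∣ w ∣ʷ) × #B (B ∷ w) < #A (B ∷ ∣ w ∣ʷ)
        tie l with #A w ≤? #B w
        ... | yes a≤b = ⊥-elim (ℕ.<-irrefl (sym (#A-∣∣-≤ w a≤b)) l)
        ... | no _    = inj₁ refl

-- The exchange modulo larger labellings

module TwoColumns (R : CommutativeRing 0ℓ 0ℓ) (𝓘 : AdditiveSubgroup R) {h : ℕ} where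
  open CommutativeRing R using (Carrier)
  open AdditiveSubgroup 𝓘
  open Substitution R
  open Reflection R 𝓘
  open Words {h}

  -- `w` and `w′` have the same absolute path, and `reflect` ties each of them to it. A relation at
  -- a word of the weight of `w` has that word as top term and follows from `hi`. At any other
  -- weight there are more letters `A`, and since `b` is no more frequent than `a` in `w`, the shape
  -- has become strictly more dominant: this is `rel`.
  flip-step : ∀ {a b} → a ≢ b → (Ψ : Word → Carrier) →
    ∀ {w w′} → count b w ≤ count a w → FlipTags a b w w′ →
    (∀ v → length v ≡ length w → count a v ≢ count a w → Mem (Ψ v)) →
    (∀ (z : List (Letter (Other a b))) → length z ≡ length w →
       q w < q (map toTag z) → Mem (X (Ψ ∘ map toTag) z)) →
    (∀ v → length v ≡ length w → (∀ c → count c v ≡ count c w) → μ w < μ v → Mem (Ψ v)) →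
    Mem (Ψ w′) → Mem (Ψ w)
  flip-step {a} {b} a≢b Ψ {w} {w′} b≤a flip supp rel hi m =
    subst (Mem ∘ Ψ) (map-toTag-toLetter a b w) (proj₂ (reflect L (λ u e ne → suppL u (trans e lenL) (λ e′ → ne (trans e′ (sym #A≡)))) relL)
      (subst (λ v → Mem (X (Ψ ∘ map toTag) v)) (sym abs≡)
        (proj₁ (reflect L′ (λ u e ne → suppL u (trans e lenL′) (λ e′ → ne (trans e′ (sym (trans #A′ #A≡))))) relL′)
          (subst (Mem ∘ Ψ) (sym (map-toTag-toLetter a b w′)) m))))
    where
    L = map (toLetter a b) w
    L′ = map (toLetter a b) w′
    flipL : Flip L L′
    flipL = toLetter-flip a≢b flip
    abs≡ = flip-∣∣ flipL
    #A≡ : #A L ≡ count a w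
    #A≡ = #A-toLetter w
    #A′ : #A L′ ≡ #A L
    #A′ = sym (flip-#A flipL)
    lenL : length L ≡ length w
    lenL = List.length-map _ w
    lenL′ : length L′ ≡ length w
    lenL′ = trans (List.length-map _ w′) (flip-length flip)
    suppL : ∀ u → length u ≡ length w → #A u ≢ count a w → Mem (Ψ (map toTag u))
    suppL u eu ne = supp (map toTag u) (trans (List.length-map _ u) eu)
      (λ e → ne (trans (sym (count-a-toTag a≢b u)) e))
    relL : ∀ z → Dominates z L → z ≢ ∣ L ∣ʷ → Mem (X (Ψ ∘ map toTag) z)
    relL z d z≢ with #A z ℕ.≟ #A L
    ... | yes eq = proj₁ (X∈-top z low) (hi (map toTag z) (trans (List.length-map _ z) lenz)
      (λ c → trans (count-dominates a≢b d eq c) (cong (count c) (map-toTag-toLetter a b w)))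
      (higher (dominates-μ a≢b d)))
      where
      lenz = trans (dominates-length d) lenL
      low : ∀ u → length u ≡ length z → #A u < #A z → Mem (Ψ (map toTag u))
      low u e l = suppL u (trans e lenz) (λ e′ → ℕ.<-irrefl (trans e′ (sym (trans eq #A≡))) l)
      higher : z ≡ ∣ L ∣ʷ ⊎ μ (map toTag L) < μ (map toTag z) → μ w < μ (map toTag z)
      higher (inj₁ e)  = ⊥-elim (z≢ e)
      higher (inj₂ lt) = subst (λ v → μ v < μ (map toTag z)) (map-toTag-toLetter a b w) lt
    ... | no ne  = rel z (trans (dominates-length d) lenL)
      (subst (λ v → q v < q (map toTag z)) (map-toTag-toLetter a b w) (dominates-q< a≢b d A<
        (ℕ.≤-<-trans (subst₂ _≤_ (sym (#B-toLetter a≢b w)) (sym #A≡) b≤a) A<)))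
      where A< = ℕ.≤∧≢⇒< (dominates-#A d) (ne ∘ sym)
    relL′ : ∀ z → Dominates z L′ → z ≢ ∣ L′ ∣ʷ → Mem (X (Ψ ∘ map toTag) z)
    relL′ z d z≢ = relL z (flip-dominates flipL d) (λ eq → z≢ (trans eq abs≡))

-- Crossings, and the sum that measures them

module Uncrossing {h : ℕ} (N : ℕ) where
  open Words {h}

  -- The last letter of w among a and b is b, and it balances the two.
  data BalancedBy (a b : Fin h) : Word → Set where
    here : ∀ {v} → count a v ≡ suc (count b v) → BalancedBy a b (b ∷ v)
    skip : ∀ {x v} → x ≢ a → x ≢ b → BalancedBy a b v → BalancedBy a b (x ∷ v)

  -- The path #a - #b comes down to 0 and leaves upwards again. For the entries this says a_i < b_i
  -- < a_(i+1), with b_(i+1) later or absent, which covers all the patterns that `NonCrossing`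
  -- forbids.
  data Crossing (a b : Fin h) : Word → Set where
    here  : ∀ {w} → BalancedBy a b w → Crossing a b (a ∷ w)
    there : ∀ {x w} → Crossing a b w → Crossing a b (x ∷ w)

  balancedBy? : ∀ a b w → Dec (BalancedBy a b w)
  balancedBy? a b []      = no λ ()
  balancedBy? a b (x ∷ w) with x Fin.≟ b | x Fin.≟ a
  ... | yes refl | _ with count a w ℕ.≟ suc (count b w)
  ...   | yes eq = yes (here eq)
  ...   | no ne  = no λ { (here eq) → ne eq ; (skip _ ≢b _) → ≢b refl }
  balancedBy? a b (x ∷ w) | no ≢b | yes x≡a = no λ { (here _) → ≢b refl ; (skip ≢a _ _) → ≢a x≡a }
  balancedBy? a b (x ∷ w) | no ≢b | no ≢a =
    map′ (skip ≢a ≢b) (λ { (here _) → ⊥-elim (≢b refl) ; (skip _ _ p) → p }) (balancedBy? a b w)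

  crossing? : ∀ a b w → Dec (Crossing a b w)
  crossing? a b []      = no λ ()
  crossing? a b (x ∷ w) with crossing? a b w
  ... | yes p = yes (there p)
  ... | no ¬p with x Fin.≟ a
  ...   | yes refl = map′ here (λ { (here p) → p ; (there p) → ⊥-elim (¬p p) }) (balancedBy? x b w)
  ...   | no ≢a    = no λ { (here _) → ≢a refl ; (there p) → ¬p p }

  balanced : ∀ {a b w} → a ≢ b → BalancedBy a b w → count a w ≡ count b w
  balanced a≢b (here {v} eq)    = cong₂ _+_ (hit-≢ a≢b) eq ∙ cong (_+ count _ v) (sym (hit-≡ refl))
    where
    infixr 5 _∙_
    _∙_ = trans
  balanced a≢b (skip ≢a ≢b p) = cong₂ _+_ (trans (hit-≢ (≢a ∘ sym)) (sym (hit-≢ (≢b ∘ sym)))) (balanced a≢b p)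

  uncross : ∀ {a b w} → Crossing a b w → Word
  uncross {a} {b} (here {w} _)  = a ∷ map (swap a b) w
  uncross         (there {x} p) = x ∷ uncross p

  uncross-flip : ∀ {a b w} → a ≢ b → (p : Crossing a b w) → FlipTags a b w (uncross p)
  uncross-flip {a} a≢b (here {w} p)  = a ∷ base w (balanced a≢b p)
  uncross-flip     a≢b (there {x} p) = x ∷ uncross-flip a≢b p

  -- Position p weighs N ∸ p, and Π sums the products of the weights of consecutive
  -- entries of a column; nested arcs have a smaller sum than crossing ones.
  last : Fin h → Word → ℕ
  last c []      = 0
  last c (x ∷ w) with c Fin.≟ x
  ... | yes _ = N ∸ length w
  ... | no _  = last c w

  Π : Word → ℕ
  Π []      = 0
  Π (x ∷ w) = last x w * (N ∸ length w) + Π w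

  last-≡ : ∀ {c x} → c ≡ x → ∀ w → last c (x ∷ w) ≡ N ∸ length w
  last-≡ {c} {x} eq w with c Fin.≟ x
  ... | yes _ = refl
  ... | no ne = ⊥-elim (ne eq)

  last-≢ : ∀ {c x} → c ≢ x → ∀ w → last c (x ∷ w) ≡ last c w
  last-≢ {c} {x} ne w with c Fin.≟ x
  ... | yes eq = ⊥-elim (ne eq)
  ... | no _   = refl

  last-cong : ∀ c x {w w′} → length w ≡ length w′ → last c w ≡ last c w′ → last c (x ∷ w) ≡ last c (x ∷ w′)
  last-cong c x len eq with c Fin.≟ x
  ... | yes _ = cong (N ∸_) len
  ... | no _  = eq

  last-swap : ∀ a b c w → last (swap a b c) (map (swap a b) w) ≡ last c w
  last-swap a b c []      = refl
  last-swap a b c (x ∷ w) with c Fin.≟ x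
  ... | yes eq = trans (last-≡ (cong (swap a b) eq) _) (cong (N ∸_) (List.length-map _ w))
  ... | no ne  = trans (last-≢ (ne ∘ swap-injective a b) _) (last-swap a b c w)

  last-swap′ : ∀ a b c w → last c (map (swap a b) w) ≡ last (swap a b c) w
  last-swap′ a b c w = trans (cong (λ d → last d (map (swap a b) w)) (sym (swap-involutive a b c)))
    (last-swap a b (swap a b c) w)

  Π-swap : ∀ a b w → Π (map (swap a b) w) ≡ Π w
  Π-swap a b []      = refl
  Π-swap a b (x ∷ w) = cong₂ _+_
    (cong₂ _*_ (last-swap a b x w) (cong (N ∸_) (List.length-map _ w))) (Π-swap a b w)

  last-> : ∀ {c} w → length w ≤ N → 0 < count c w → N ∸ length w < last c w
  last-> {c} (x ∷ w) len pos with c Fin.≟ x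
  ... | yes _ = ℕ.∸-monoʳ-< ℕ.≤-refl len
  ... | no _  = ℕ.≤-<-trans (ℕ.∸-monoʳ-≤ N (ℕ.n≤1+n (length w))) (last-> w (ℕ.<⇒≤ len) pos)

  -- Weights decrease along the word, and the balancing `b` stands after every `a` of the prefix, of
  -- which there is at least one.
  last-balancedBy : ∀ {a b w} → a ≢ b → BalancedBy a b w → length w ≤ N → last b w < last a w
  last-balancedBy {a} {b} a≢b (here {v} eq) len = subst₂ _<_ (sym (last-≡ {b} refl v)) (sym (last-≢ a≢b v))
    (last-> v (ℕ.<⇒≤ len) (subst (0 <_) (sym eq) (s≤s z≤n)))
  last-balancedBy a≢b (skip {v = v} ≢a ≢b p) len = subst₂ _<_ (sym (last-≢ (≢b ∘ sym) v)) (sym (last-≢ (≢a ∘ sym) v))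
    (last-balancedBy a≢b p (ℕ.<⇒≤ len))

  -- Before the next b the two words differ in the last occurrence of b only.
  data Uncrossed (b : Fin h) (v v′ : Word) : Set where
    pending : ∀ {D n} → 0 < D → N ∸ length v < n → last b v′ ≡ last b v + D →
              Π v ≡ Π v′ + D * n → (∀ c → c ≢ b → last c v ≡ last c v′) → Uncrossed b v v′
    closed  : Π v′ < Π v → (∀ c → last c v ≡ last c v′) → Uncrossed b v v′

  uncrossed : ∀ {a b w} → a ≢ b → (p : Crossing a b w) → length w ≤ N → Uncrossed b w (uncross p)
  uncrossed {a} {b} a≢b (here {w} p) len =
    -- The exchange makes the predecessor of the letter `a` lighter by `D`, so `Π` falls by `D`
    -- times the weight of that letter, which is the witness `n`. The last `b` becomes heavier by
    -- `D` in return.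
    pending (ℕ.m<n⇒0<n∸m lt) (ℕ.∸-monoʳ-< ℕ.≤-refl len)
      (trans (last-≢ (a≢b ∘ sym) _) (trans lastb′ (trans (sym (ℕ.m+[n∸m]≡n (ℕ.<⇒≤ lt)))
        (cong (_+ D) (sym (last-≢ (a≢b ∘ sym) w))))))
      (trans (cong (λ k → k * (N ∸ length w) + Π w) (sym (ℕ.m+[n∸m]≡n (ℕ.<⇒≤ lt))))
        (trans (solve 4 (λ x d n p → (x :+ d) :* n :+ p := (x :* n :+ p) :+ d :* n) refl
                  (last b w) D (N ∸ length w) (Π w))
          (cong (_+ D * (N ∸ length w)) (sym (cong₂ _+_
            (cong₂ _*_ lasta′ (cong (N ∸_) (List.length-map _ w))) (Π-swap a b w))))))
      same
    where
    lt = last-balancedBy a≢b p (ℕ.<⇒≤ len)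
    D = last a w ∸ last b w
    lastb′ : last b (map (swap a b) w) ≡ last a w
    lastb′ = trans (last-swap′ a b b w) (cong (λ d → last d w) (swap-b a b))
    lasta′ : last a (map (swap a b) w) ≡ last b w
    lasta′ = trans (last-swap′ a b a w) (cong (λ d → last d w) (swap-a a b))
    same : ∀ c → c ≢ b → last c (a ∷ w) ≡ last c (a ∷ map (swap a b) w)
    same c c≢b with c Fin.≟ a
    ... | yes _  = cong (N ∸_) (sym (List.length-map _ w))
    ... | no c≢a = sym (trans (last-swap′ a b c w) (cong (λ d → last d w) (swap-other c≢a c≢b)))
  uncrossed {a} {b} a≢b (there {x} {w} p) len with uncrossed a≢b p (ℕ.<⇒≤ len)
  ... | closed lt same = closed
    (ℕ.+-mono-≤-< (ℕ.≤-reflexive (cong₂ _*_ (sym (same x)) (cong (N ∸_) len≡))) lt)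
    (λ c → last-cong c x (sym len≡) (same c))
    where len≡ = flip-length (uncross-flip a≢b p)
  ... | pending {D} {n} 0<D n> b≡ Π≡ same with x Fin.≟ b
  ...   | no x≢b = pending 0<D (ℕ.≤-<-trans (ℕ.∸-monoʳ-≤ N (ℕ.n≤1+n (length w))) n>)
      (trans (last-≢ (x≢b ∘ sym) _) (trans b≡ (cong (_+ D) (sym (last-≢ (x≢b ∘ sym) _)))))
      (trans (cong₂ _+_ (cong₂ _*_ (same x x≢b) (cong (N ∸_) (sym len≡))) Π≡) (sym (ℕ.+-assoc (last x (uncross p) * (N ∸ length (uncross p))) (Π (uncross p)) (D * n))))
      (λ c c≢b → last-cong c x (sym len≡) (same c c≢b))
      where len≡ = flip-length (uncross-flip a≢b p)
  -- The next `b` gives back `D * m`. It stands after the letter `a` that saved `D * n`, so `m < n`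
  -- and the balance stays strict.
  ...   | yes refl = closed lower same′
      where
      len≡ = flip-length (uncross-flip a≢b p)
      m = N ∸ length w
      lower : last x (uncross p) * (N ∸ length (uncross p)) + Π (uncross p) < last x w * m + Π w
      lower = subst₂ _<_
        (trans (solve 4 (λ l d m p → (l :* m :+ p) :+ d :* m := (l :+ d) :* m :+ p) refl (last x w) D m (Π (uncross p)))
          (cong₂ _+_ (cong₂ _*_ (sym b≡) (cong (N ∸_) (sym len≡))) refl))
        (trans (ℕ.+-assoc (last x w * m) (Π (uncross p)) (D * n)) (cong (last x w * m +_) (sym Π≡)))
        (ℕ.+-monoʳ-< (last x w * m + Π (uncross p)) (ℕ.*-monoʳ-< D {{ℕ.>-nonZero 0<D}} n>))
      same′ : ∀ c → last c (x ∷ w) ≡ last c (x ∷ uncross p)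
      same′ c with c Fin.≟ x
      ... | yes _  = cong (N ∸_) (sym len≡)
      ... | no c≢x = same c c≢x

  Π-uncross : ∀ {a b w} → a ≢ b → (p : Crossing a b w) → length w ≤ N → Π (uncross p) < Π w
  Π-uncross a≢b p len with uncrossed a≢b p len
  ... | closed lt _ = lt
  ... | pending {D} {n} 0<D n> _ Π≡ _ = subst (Π (uncross p) <_) (sym Π≡)
    (ℕ.m<m+n (Π (uncross p)) (ℕ.*-mono-≤ 0<D (ℕ.≤-<-trans z≤n n>)))

-- Ordering columns of equal length

rearrangement : ∀ {x y s t} → x < y → s < t → x * t + y * s < x * s + y * t
rearrangement {x} {y} {s} {t} x<y s<t with ℕ.m≤n⇒∃[o]m+o≡n x<y | ℕ.m≤n⇒∃[o]m+o≡n s<t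
... | d , refl | e , refl = subst (_< x * s + suc (x + d) * suc (s + e)) refl
  (subst (x * suc (s + e) + suc (x + d) * s <_)
    (solve 4 (λ x s d e → (x :* (con 1 :+ (s :+ e)) :+ (con 1 :+ (x :+ d)) :* s) :+ (con 1 :+ d) :* (con 1 :+ e) :=
       x :* s :+ (con 1 :+ (x :+ d)) :* (con 1 :+ (s :+ e))) refl x s d e)
    (ℕ.m<m+n _ (s≤s z≤n)))

module Arrangement {h : ℕ} where
  open Words {h}

  module _ (radix : ℕ) where

    -- The values of column `c` as a numeral in base `radix`, the rank within the column being the
    -- exponent; the last entry is the most significant digit.
    key : Fin h → Word → List ℕ → ℕ
    key c (x ∷ w) (v ∷ vs) = hit c x * (v * radix ^ count x w) + key c w vs
    key c _       _        = 0

  -- A linear functional Σᵢ wt xᵢ · tᵢ of the tags, where tᵢ depends on w only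
  -- through positions and ranks, decreases when two columns are put in order.
  module _ (wt : Fin h → ℕ) (radix : ℕ) where

    private
      κ = key radix

    Θ : Word → List ℕ → ℕ
    Θ (x ∷ w) (v ∷ vs) = wt x * (v * radix ^ count x w) + Θ w vs
    Θ _       _        = 0

    -- Exchanging the labels exchanges the two keys among the weights `wt a` and `wt b`, and leaves
    -- the rest of the sum alone. Terms are moved across to avoid subtraction.
    Θ-swap : ∀ {a b} → a ≢ b → ∀ w vs →
      Θ w vs + (wt a * κ b w vs + wt b * κ a w vs) ≡
      Θ (map (swap a b) w) vs + (wt a * κ a w vs + wt b * κ b w vs)
    Θ-swap {a} {b} a≢b []      vs       = refl
    Θ-swap {a} {b} a≢b (x ∷ w) []       = refl
    Θ-swap {a} {b} a≢b (x ∷ w) (v ∷ vs) rewrite count-swap a b x w = step (view a b x)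
      where
      t = v * radix ^ count x w
      ih = Θ-swap a≢b w vs
      kA = κ a w vs
      kB = κ b w vs
      S = Θ w vs
      S′ = Θ (map (swap a b) w) vs
      step : View a b x →
        wt x * t + S + (wt a * (hit b x * t + kB) + wt b * (hit a x * t + kA)) ≡
        wt (swap a b x) * t + S′ + (wt a * (hit a x * t + kA) + wt b * (hit b x * t + kB))
      step (isA refl) rewrite swap-a x b | hit-≡ {x} refl | hit-≢ (a≢b ∘ sym) = trans
        (solve 6 (λ wa wb t s ka kb → wa :* t :+ s :+ (wa :* (con 0 :* t :+ kb) :+ wb :* (con 1 :* t :+ ka)) :=
                                      (wa :* t :+ wb :* t) :+ (s :+ (wa :* kb :+ wb :* ka))) refl (wt x) (wt b) t S kA kB)
        (trans (cong ((wt x * t + wt b * t) +_) ih)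
        (solve 6 (λ wa wb t s ka kb → (wa :* t :+ wb :* t) :+ (s :+ (wa :* ka :+ wb :* kb)) :=
                                      wb :* t :+ s :+ (wa :* (con 1 :* t :+ ka) :+ wb :* (con 0 :* t :+ kb))) refl (wt x) (wt b) t S′ kA kB))
      step (isB refl) rewrite swap-b a x | hit-≡ {x} refl | hit-≢ a≢b = trans
        (solve 6 (λ wa wb t s ka kb → wb :* t :+ s :+ (wa :* (con 1 :* t :+ kb) :+ wb :* (con 0 :* t :+ ka)) :=
                                      (wa :* t :+ wb :* t) :+ (s :+ (wa :* kb :+ wb :* ka))) refl (wt a) (wt x) t S kA kB)
        (trans (cong ((wt a * t + wt x * t) +_) ih)
        (solve 6 (λ wa wb t s ka kb → (wa :* t :+ wb :* t) :+ (s :+ (wa :* ka :+ wb :* kb)) :=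
                                      wa :* t :+ s :+ (wa :* (con 0 :* t :+ ka) :+ wb :* (con 1 :* t :+ kb))) refl (wt a) (wt x) t S′ kA kB))
      step (isO ≢a ≢b) rewrite swap-other ≢a ≢b | hit-≢ (≢a ∘ sym) | hit-≢ (≢b ∘ sym) =
        trans (ℕ.+-assoc (wt x * t) S _) (trans (cong (wt x * t +_) ih) (sym (ℕ.+-assoc (wt x * t) S′ _)))

    Θ-decreases : ∀ {a b} → wt b < wt a → ∀ w vs → κ b w vs < κ a w vs →
                  Θ (map (swap a b) w) vs < Θ w vs
    Θ-decreases {a} {b} wb<wa w vs kb<ka = ℕ.+-cancelʳ-< (wt a * κ b w vs + wt b * κ a w vs) _ _
      (subst (Θ (map (swap a b) w) vs + (wt a * κ b w vs + wt b * κ a w vs) <_)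
        (sym (Θ-swap a≢b w vs))
        (ℕ.+-monoʳ-< (Θ (map (swap a b) w) vs) (subst₂ _<_
          (ℕ.+-comm (wt b * κ a w vs) (wt a * κ b w vs)) (ℕ.+-comm (wt b * κ b w vs) (wt a * κ a w vs))
          (rearrangement wb<wa kb<ka))))
      where
      a≢b : a ≢ b
      a≢b refl = ℕ.<-irrefl refl wb<wa

-- Termination for one labelling

module Normalisation (R : CommutativeRing 0ℓ 0ℓ) (𝓘 : AdditiveSubgroup R)
  {h : ℕ} (N : ℕ) (s : Fin h → ℕ) (radix : ℕ) (vs : List ℕ) where
  open CommutativeRing R using (Carrier)
  open AdditiveSubgroup 𝓘
  open Substitution R
  open TwoColumns R 𝓘 {h}
  open Words {h}
  open Uncrossing {h} N
  open Arrangement {h}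

  HasSizes : Word → Set
  HasSizes w = ∀ c → count c w ≡ s c

  record Normal (w : Word) : Set where
    field
      len       : length w ≡ N
      sizes     : HasSizes w
      planar    : ∀ {a b} → a ≢ b → ¬ Crossing a b w
      arranged  : ∀ {c d} → c Fin.< d → s c ≡ s d → key radix c w vs ≤ key radix d w vs

  -- Decreasing from left to right, so that moving a smaller key to the left lowers `Θ`.
  weight : Fin h → ℕ
  weight c = h ∸ toℕ c

  weight-< : ∀ {c d} → c Fin.< d → weight d < weight c
  weight-< {c} {d} c<d = ℕ.∸-monoʳ-< c<d (ℕ.<⇒≤ (Fin.toℕ<n d))

  data Progress (w : Word) : Set where
    flip   : ∀ {a b w′} → a ≢ b → count b w ≤ count a w → FlipTags a b w w′ →
             Π w′ < Π w ⊎ Π w′ ≡ Π w × Θ weight radix w′ vs < Θ weight radix w vs → Progress w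
    finish : Normal w → Progress w

  progress : ∀ w → length w ≡ N → HasSizes w → Progress w
  progress w len sizes
    with Fin.any? (λ a → Fin.any? (λ b → ¬? (a Fin.≟ b) ×-dec crossing? a b w))
  ... | yes (a , b , a≢b , crossing) with ℕ.≤-total (count b w) (count a w)
  ...   | inj₁ b≤a = flip a≢b b≤a (uncross-flip a≢b crossing)
            (inj₁ (Π-uncross a≢b crossing (ℕ.≤-reflexive len)))
  ...   | inj₂ a≤b = flip (a≢b ∘ sym) a≤b (flip-sym (uncross-flip a≢b crossing))
            (inj₁ (Π-uncross a≢b crossing (ℕ.≤-reflexive len)))
  progress w len sizes | no ¬crossing
    with Fin.any? (λ c → Fin.any? (λ d →
           (c Fin.<? d) ×-dec ((s c ℕ.≟ s d) ×-dec (key radix d w vs ℕ.<? key radix c w vs))))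
  ... | yes (c , d , c<d , sc≡sd , lt) =
          -- Columns of equal size are balanced on the whole word, so exchanging them entirely is a
          -- flip as well.
          flip (λ { refl → ℕ.<-irrefl refl c<d }) (ℕ.≤-reflexive (sym balance)) (base w balance)
            (inj₂ (Π-swap c d w , Θ-decreases weight radix (weight-< c<d) w vs lt))
          where
          balance : count c w ≡ count d w
          balance = trans (sizes c) (trans sc≡sd (sym (sizes d)))
  ... | no ¬unsorted = finish record
    { len = len
    ; sizes = sizes
    ; planar = λ a≢b p → ¬crossing (_ , _ , a≢b , p)
    ; arranged = λ c<d eq → ℕ.≮⇒≥ (λ lt → ¬unsorted (_ , _ , c<d , eq , lt)) }

  module _ (Ψ : Word → Carrier) (Q : ℕ)
    (q≡Q : ∀ w → length w ≡ N → HasSizes w → q w ≡ Q)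
    (support : ∀ w → length w ≡ N → ¬ HasSizes w → Mem (Ψ w))
    (relations : ∀ {a b} → a ≢ b → ∀ (z : List (Letter (Other a b))) → length z ≡ N →
                 Q < q (map toTag z) → Mem (X (Ψ ∘ map toTag) z))
    (normal : ∀ w → Normal w → Mem (Ψ w))
    where

    private
      -- Lexicographic descent. A flip keeps `μ` and lowers `Π`, or keeps both and lowers `Θ`; the
      -- error terms of a flip have larger `μ`, after which `Π` and `Θ` may be arbitrary.
      go : ∀ {m p t} → Acc _<_ m → Acc _<_ p → Acc _<_ t → ∀ w → length w ≡ N → HasSizes w →
           bound₂ N ∸ μ w ≡ m → Π w ≡ p → Θ weight radix w vs ≡ t → Mem (Ψ w)

      go′ : ∀ {m p t} → Acc _<_ m → Acc _<_ p → Acc _<_ t → ∀ w → length w ≡ N → HasSizes w →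
            bound₂ N ∸ μ w ≡ m → Π w ≡ p → Θ weight radix w vs ≡ t → Progress w → Mem (Ψ w)

      step : ∀ {m} → Acc _<_ m → ∀ {a b w w′} → a ≢ b → count b w ≤ count a w → FlipTags a b w w′ →
             length w ≡ N → HasSizes w → bound₂ N ∸ μ w ≡ m → Mem (Ψ w′) → Mem (Ψ w)

      go accm accp acct w len sizes em ep et =
        go′ accm accp acct w len sizes em ep et (progress w len sizes)

      go′ accm accp acct w len sizes em ep et (finish nf) = normal w nf
      go′ accm (acc recp) acct w len sizes em refl et (flip {w′ = w′} a≢b b≤a f (inj₁ lt)) =
        step accm a≢b b≤a f len sizes em
          (go accm (recp lt) (<-wellFounded _) w′ (trans (flip-length f) len)
            (λ c → trans (flip-count f c) (sizes c)) (trans (cong (bound₂ N ∸_) (flip-μ f)) em) refl refl)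
      go′ accm accp (acc rect) w len sizes em ep refl (flip {w′ = w′} a≢b b≤a f (inj₂ (eq , lt))) =
        step accm a≢b b≤a f len sizes em
          (go accm accp (rect lt) w′ (trans (flip-length f) len)
            (λ c → trans (flip-count f c) (sizes c)) (trans (cong (bound₂ N ∸_) (flip-μ f)) em) (trans eq ep) refl)

      step (acc rec) {a} {b} {w} a≢b b≤a f len sizes refl = flip-step a≢b Ψ b≤a f
        (λ v e ne → support v (trans e len) (λ sz → ne (trans (sz a) (sym (sizes a)))))
        (λ z e lt → relations a≢b z (trans e len) (subst (_< _) (q≡Q w len sizes) lt))
        (λ v e same lt → go (rec (ℕ.∸-monoʳ-< lt (subst (λ n → μ v ≤ bound₂ n) (trans e len) (μ≤ v))))
          (<-wellFounded _) (<-wellFounded _) v (trans e len)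
          (λ c → trans (same c) (sizes c)) refl refl refl)

    normalise : ∀ w → length w ≡ N → HasSizes w → Mem (Ψ w)
    normalise w len sizes = go (<-wellFounded _) (<-wellFounded _) (<-wellFounded _) w len sizes refl refl refl

-- Straightening rows and columns together

sumᶠ : ∀ {m} → (Fin m → ℕ) → ℕ
sumᶠ {zero}  F = 0
sumᶠ {suc m} F = F zero + sumᶠ (F ∘ suc)

sumᶠ-cong : ∀ {m} {F G : Fin m → ℕ} → (∀ c → F c ≡ G c) → sumᶠ F ≡ sumᶠ G
sumᶠ-cong {zero}  eq = refl
sumᶠ-cong {suc m} eq = cong₂ _+_ (eq zero) (sumᶠ-cong (eq ∘ suc))

sumᶠ-bump : ∀ {m} (F G : Fin m → ℕ) {k} x → F x ≡ k + G x → (∀ c → c ≢ x → F c ≡ G c) →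
            sumᶠ F ≡ k + sumᶠ G
sumᶠ-bump F G {k} zero    eq same = trans (cong₂ _+_ eq (sumᶠ-cong (λ c → same (suc c) (λ ()))))
  (ℕ.+-assoc k (G zero) _)
sumᶠ-bump F G {k} (suc x) eq same = trans
  (cong₂ _+_ (same zero (λ ())) (sumᶠ-bump (F ∘ suc) (G ∘ suc) x eq (λ c ne → same (suc c) (λ { refl → ne refl }))))
  (trans (sym (ℕ.+-assoc (G zero) k _)) (trans (cong (_+ sumᶠ (G ∘ suc)) (ℕ.+-comm (G zero) k)) (ℕ.+-assoc k (G zero) _)))

module _ {h : ℕ} where
  open Words {h}

  q-sum : ∀ w → q w ≡ sumᶠ (λ c → triangular (count c w))
  q-sum []      = sym (zeros h)
    where
    zeros : ∀ m → sumᶠ {m} (λ _ → 0) ≡ 0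
    zeros zero    = refl
    zeros (suc m) = zeros m
  q-sum (x ∷ w) = trans (cong (suc (count x w) +_) (q-sum w))
    (sym (sumᶠ-bump (λ c → triangular (hit c x + count c w)) (λ c → triangular (count c w)) x
      (cong (λ n → triangular (n + count x w)) (hit-≡ {x} refl))
      (λ c ne → cong (λ n → triangular (n + count c w)) (hit-≢ ne))))

  q-cong : ∀ w w′ → (∀ c → count c w ≡ count c w′) → q w ≡ q w′
  q-cong w w′ same = trans (q-sum w) (trans (sumᶠ-cong (λ c → cong triangular (same c))) (sym (q-sum w′)))

  count-++ : ∀ c u v → count c (u ++ v) ≡ count c u + count c v
  count-++ c []      v = refl
  count-++ c (x ∷ u) v = trans (cong (hit c x +_) (count-++ c u v)) (sym (ℕ.+-assoc (hit c x) _ _))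

  count-reverse : ∀ c w → count c (reverse w) ≡ count c w
  count-reverse c []      = refl
  count-reverse c (x ∷ w) = trans (cong (count c) (List.unfold-reverse x w))
    (trans (count-++ c (reverse w) (x ∷ []))
      (trans (cong₂ _+_ (count-reverse c w) (ℕ.+-identityʳ (hit c x))) (ℕ.+-comm (count c w) (hit c x))))

  size-zip : ∀ {V : Set} c f (vs : List V) → length f ≡ length vs → size c (zip f vs) ≡ count c f
  size-zip c []      []       _  = refl
  size-zip c (x ∷ f) (v ∷ vs) eq with c Fin.≟ x
  ... | yes _ = cong suc (size-zip c f vs (ℕ.suc-injective eq))
  ... | no _  = size-zip c f vs (ℕ.suc-injective eq)

module Straightening (R : CommutativeRing 0ℓ 0ℓ) (𝓘 : AdditiveSubgroup R) {h : ℕ} (N radix : ℕ)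
  {V W : Set} (ξ : V → W → CommutativeRing.Carrier R)
  (vs : List V) (ws : List W) (vs-length : length vs ≡ N) (ws-length : length ws ≡ N)
  (rowKeys columnKeys : List ℕ) where
  open CommutativeRing R hiding (refl; sym; trans; zero; _+_; _*_)
  private module R = CommutativeRing R
  open AdditiveSubgroup 𝓘
  open Substitution R
  open Reflection R 𝓘 using (X∈-≤)
  open Laplace R
  open Adjunction R (Fin._≟_ {h})
  open BlockDeterminant R {h}
  open Words {h}
  open Arrangement {h}
  open Normalisation R 𝓘 {h} N using (Normal; normalise)

  -- The words are reversed because their head is the label of the last row or column.
  D : Word → Word → Carrier
  D w w′ = detL (masked ξ) (zip (reverse w) vs) (zip (reverse w′) ws)

  SameCounts : Word → Word → Set
  SameCounts w w′ = ∀ c → count c w ≡ count c w′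

  private
    rev-length : ∀ {A : Set} (w : List A) {n} → length w ≡ n → length (reverse w) ≡ n
    rev-length w eq = trans (List.length-reverse w) eq

  size-D : ∀ {U : Set} (us : List U) → length us ≡ N → ∀ w → length w ≡ N →
           ∀ c → size c (zip (reverse w) us) ≡ count c w
  size-D us eu w ew c = trans (size-zip c (reverse w) us (trans (rev-length w ew) (sym eu))) (count-reverse c w)

  D-mismatch : ∀ w w′ → length w ≡ N → length w′ ≡ N → ¬ SameCounts w w′ → Mem (D w w′)
  D-mismatch w w′ ew ew′ ¬same = resp (R.sym (detL-mismatch ξ (zip (reverse w) vs) (zip (reverse w′) ws) (λ same → ¬same (λ c →
    trans (sym (size-D vs vs-length w ew c)) (trans (same c) (size-D ws ws-length w′ ew′ c)))))) 0∈

  private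
    toTag-reverse : ∀ {a b} (z : List (Letter (Other a b))) → map toTag (reverse z) ≡ reverse (map toTag z)
    toTag-reverse z = List.reverse-map toTag z

  -- The adjunction moves the substitution from the rows to the columns. What results is a sum of
  -- determinants that all have the row labelling `z`, whose shape may be more dominant than that of
  -- `w′`.
  X-rows∈ : ∀ {a b} → a ≢ b → ∀ w′ → length w′ ≡ N → ∀ (z : List (Letter (Other a b))) → length z ≡ N →
    (∀ v → length v ≡ N → Mem (D (map toTag z) v)) → Mem (X (λ v → D (map toTag v) w′) z)
  X-rows∈ {a} {b} a≢b w′ ew′ z ez good = resp (R.sym (R.trans
      (X-cong z (λ v → R.reflexive (cong₂ (λ r c → detL (masked ξ) (zip r vs) (zip c ws))
        (sym (toTag-reverse v)) (sym (map-toTag-toLetter b a (reverse w′))))))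
      (R.trans (X-reverse (λ v → detL (masked ξ) (zip (map toTag v) vs) (zip (map toTag y) ws)) z)
        (X-adjoint ξ a≢b (reverse z) vs y ws (trans (rev-length z ez) (sym vs-length)) (trans ey (sym ws-length))))))
    (X∈-≤ y (λ u eu _ → resp
      (R.reflexive (cong₂ (λ r c → detL (masked ξ) (zip r vs) (zip c ws))
        (sym (toTag-reverse z)) (List.reverse-involutive (map toTag u))))
      (good (reverse (map toTag u)) (rev-length (map toTag u) (trans (List.length-map toTag u) (trans eu ey))))))
    where
    y = map (toLetter b a) (reverse w′)
    ey : length y ≡ N
    ey = trans (List.length-map _ (reverse w′)) (rev-length w′ ew′)

  X-columns∈ : ∀ {a b} → a ≢ b → ∀ w → length w ≡ N → ∀ (z : List (Letter (Other a b))) → length z ≡ N →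
    (∀ v → length v ≡ N → Mem (D v (map toTag z))) → Mem (X (λ v → D w (map toTag v)) z)
  X-columns∈ {a} {b} a≢b w ew z ez good = resp (R.sym (R.trans
      (X-cong z (λ v → R.reflexive (cong₂ (λ r c → detL (masked ξ) (zip r vs) (zip c ws))
        (sym (map-toTag-toLetter b a (reverse w))) (sym (toTag-reverse v)))))
      (R.trans (X-reverse (λ v → detL (masked ξ) (zip (map toTag y) vs) (zip (map toTag v) ws)) z)
        (R.sym (X-adjoint ξ (a≢b ∘ sym) y vs (reverse z) ws (trans ey (sym vs-length)) (trans (rev-length z ez) (sym ws-length)))))))
    (X∈-≤ y (λ u eu _ → resp
      (R.reflexive (cong₂ (λ r c → detL (masked ξ) (zip r vs) (zip c ws))
        (List.reverse-involutive (map toTag u)) (sym (toTag-reverse z))))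
      (good (reverse (map toTag u)) (rev-length (map toTag u) (trans (List.length-map toTag u) (trans eu ey))))))
    where
    y = map (toLetter b a) (reverse w)
    ey : length y ≡ N
    ey = trans (List.length-map _ (reverse w)) (rev-length w ew)

  -- The mask sees labels only through their equality.
  D-swap : ∀ a b w w′ → D (map (swap a b) w) (map (swap a b) w′) ≈ D w w′
  D-swap a b w w′ = R.trans
    (R.reflexive (cong₂ (detL (masked ξ)) (zip-swap w vs) (zip-swap w′ ws)))
    (R.trans (detL-map (masked ξ) (relabelTag) (relabelTag) (zip (reverse w) vs) (zip (reverse w′) ws))
      (detL-cong (λ { (s , v) (t , u) → *-congʳ (δ-swap s t) }) (zip (reverse w) vs) (zip (reverse w′) ws)))
    where
    relabelTag : ∀ {U : Set} → Fin h × U → Fin h × U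
    relabelTag (t , u) = swap a b t , u
    zip-map : ∀ {U : Set} (f : Word) (us : List U) → zip (map (swap a b) f) us ≡ map relabelTag (zip f us)
    zip-map []      us       = refl
    zip-map (t ∷ f) []       = refl
    zip-map (t ∷ f) (u ∷ us) = cong (_ ∷_) (zip-map f us)
    zip-swap : ∀ {U : Set} (f : Word) (us : List U) →
               zip (reverse (map (swap a b) f)) us ≡ map relabelTag (zip (reverse f) us)
    zip-swap f us = trans (cong (λ r → zip r us) (sym (List.reverse-map (swap a b) f))) (zip-map (reverse f) us)
    δ-swap : ∀ s t → δ (swap a b s) (swap a b t) ≈ δ s t
    δ-swap s t with s Fin.≟ t
    ... | yes eq = δ-≡ (cong (swap a b) eq)
    ... | no ne  = δ-≢ (ne ∘ swap-injective a b)

  -- The sum of the labels. In base 1 with all values 1 the key of a column is its size, so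
  -- `Θ-decreases` also sorts the columns by size.
  Ξ : Word → ℕ
  Ξ w = Θ toℕ 1 w (replicate (length w) 1)

  key≡count : ∀ c w → key 1 c w (replicate (length w) 1) ≡ count c w
  key≡count c []      = refl
  key≡count c (x ∷ w) = cong₂ _+_
    (trans (cong (λ n → hit c x * (1 * n)) (ℕ.^-zeroˡ (count x w))) (ℕ.*-identityʳ (hit c x)))
    (key≡count c w)

  Ξ-swap : ∀ {c d} w → c Fin.< d → count c w < count d w → Ξ (map (swap d c) w) < Ξ w
  Ξ-swap {c} {d} w c<d lt = subst (λ n → Θ toℕ 1 (map (swap d c) w) (replicate n 1) < Ξ w)
    (sym (List.length-map _ w))
    (Θ-decreases toℕ 1 c<d w _ (subst₂ _<_ (sym (key≡count c w)) (sym (key≡count d w)) lt))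

  module _ (terminal : ∀ s → (∀ {c d} → c Fin.< d → s d ≤ s c) → ∀ w w′ →
              Normal s radix rowKeys w → Normal s radix columnKeys w′ → Mem (D w w′)) where

    private
      -- Outer induction on `q`, inner on `Ξ`: renaming the factors on both sides sorts the sizes
      -- without changing `q`.
      go : ∀ {m x} → Acc _<_ m → Acc _<_ x → ∀ w w′ → length w ≡ N → length w′ ≡ N →
           bound N ∸ q w ≡ m → Ξ w ≡ x → Mem (D w w′)

      sortedCase : ∀ {m} → Acc _<_ m → ∀ w w′ → length w ≡ N → length w′ ≡ N →
           bound N ∸ q w ≡ m → SameCounts w w′ → (∀ {c d} → c Fin.< d → count d w ≤ count c w) → Mem (D w w′)

      larger : ∀ {m} → Acc _<_ m → ∀ w → bound N ∸ q w ≡ m → ∀ v v′ → length v ≡ N → length v′ ≡ N →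
               q w < q v → Mem (D v v′)
      larger (acc rec) w refl v v′ ev ev′ lt =
        go (rec (ℕ.∸-monoʳ-< lt (subst (λ n → q v ≤ bound n) ev (q≤ v))))
           (<-wellFounded _) v v′ ev ev′ refl refl

      go accm (acc recx) w w′ ew ew′ em ex
        with Fin.all? (λ c → count c w ℕ.≟ count c w′)
           | Fin.any? (λ c → Fin.any? (λ d → (c Fin.<? d) ×-dec (count c w ℕ.<? count d w)))
      ... | no ¬same | _ = D-mismatch w w′ ew ew′ ¬same
      ... | yes same | no ¬unsorted = sortedCase accm w w′ ew ew′ em same
              (λ c<d → ℕ.≮⇒≥ (λ lt → ¬unsorted (_ , _ , c<d , lt)))
      ... | yes same | yes (c , d , c<d , lt) = resp (D-swap d c w w′)
              (go accm (recx (subst (Ξ (map (swap d c) w) <_) ex (Ξ-swap w c<d lt)))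
                (map (swap d c) w) (map (swap d c) w′)
                (trans (List.length-map _ w) ew) (trans (List.length-map _ w′) ew′)
                (trans (cong (bound N ∸_) (q-swap d c w)) em) refl)

      sortedCase accm w w′ ew ew′ em same sorted =
        -- The rows are normalised with `w′` held fixed. Only then are the columns, with the normal
        -- row labelling held fixed, so both end in the shape `s`.
        normalise s radix rowKeys (λ v → D v w′) (q w)
          (λ v _ sz → q-cong v w sz)
          (λ v ev ¬sz → D-mismatch v w′ ev ew′ (λ sm → ¬sz (λ c → trans (sm c) (sym (same c)))))
          (λ a≢b z ez lt → X-rows∈ a≢b w′ ew′ z ez
            (λ v ev → larger accm w em (map toTag z) v (trans (List.length-map _ z) ez) ev lt))
          (λ v nv → normalise s radix columnKeys (λ u → D v u) (q w)
            (λ u _ sz → q-cong u w sz)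
            (λ u eu ¬sz → D-mismatch v u (Normal.len nv) eu
              (λ sm → ¬sz (λ c → trans (sym (sm c)) (Normal.sizes nv c))))
            (λ a≢b z ez lt → X-columns∈ a≢b v (Normal.len nv) z ez (λ u eu → columnLarger u (map toTag z) eu
               (trans (List.length-map _ z) ez) lt))
            (λ u nu → terminal s sorted v u nv nu)
            w′ ew′ (λ c → sym (same c)))
          w ew (λ _ → refl)
        where
        s = λ c → count c w
        -- Here the column word has grown, while the induction watches the row word. Either the
        -- sizes differ and the determinant vanishes, or both words have the same larger `q`.
        columnLarger : ∀ u v → length u ≡ N → length v ≡ N → q w < q v → Mem (D u v)
        columnLarger u v eu ev lt with Fin.all? (λ c → count c u ℕ.≟ count c v)
        ... | no ¬sm = D-mismatch u v eu ev ¬sm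
        ... | yes sm = larger accm w em u v eu ev (subst (q w <_) (sym (q-cong u v sm)) lt)

    straighten : ∀ w w′ → length w ≡ N → length w′ ≡ N → Mem (D w w′)
    straighten w w′ ew ew′ = go (<-wellFounded _) (<-wellFounded _) w w′ ew ew′ refl refl

-- Sorted words and their columns

concat-tabulate-∷ : ∀ {m} {A : Set} (F G : Fin m → List A) {v} c → F c ≡ v ∷ G c →
  (∀ d → d ≢ c → F d ≡ G d) → concat (tabulate F) ↭ v ∷ concat (tabulate G)
concat-tabulate-∷ F G {v} zero    eq same = ↭-reflexive (cong₂ _++_ eq
  (cong concat (List.tabulate-cong (λ d → same (suc d) (λ ())))))
concat-tabulate-∷ F G {v} (suc c) eq same = ↭-trans
  (Perm.++⁺ (↭-reflexive (same zero (λ ())))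
    (concat-tabulate-∷ (F ∘ suc) (G ∘ suc) c eq (λ d ne → same (suc d) (λ { refl → ne refl }))))
  (Perm.shift v (G zero) (concat (tabulate (G ∘ suc))))

concat-empties : ∀ {m} {A : Set} {F : Fin m → List A} → (∀ c → F c ≡ []) → concat (tabulate F) ≡ []
concat-empties {zero}  h = refl
concat-empties {suc m} h = cong₂ _++_ (h zero) (concat-empties (h ∘ suc))

module _ {h : ℕ} {V : Set} where

  concat-columns : (zs : List (Fin h × V)) → concat (tabulate (λ c → column c zs)) ↭ map proj₂ zs
  concat-columns []             = ↭-reflexive (concat-empties {h} (λ _ → refl))
  concat-columns ((c , v) ∷ zs) = ↭-trans
    (concat-tabulate-∷ (λ d → column d ((c , v) ∷ zs)) (λ d → column d zs) c
      (column-≡ refl v zs) (λ d ne → column-≢ ne v zs))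
    (prep v (concat-columns zs))

  column-filter : ∀ c (zs : List (Fin h × V)) →
                  column c zs ≡ map proj₂ (filter (λ z → c Fin.≟ proj₁ z) zs)
  column-filter c []             = refl
  column-filter c ((d , v) ∷ zs) with c Fin.≟ d
  ... | yes _ = cong (v ∷_) (column-filter c zs)
  ... | no _  = column-filter c zs

  column-↭ : ∀ {c} {ys zs : List (Fin h × V)} → ys ↭ zs → column c ys ↭ column c zs
  column-↭ {c} {ys} {zs} p = subst₂ _↭_ (sym (column-filter c ys)) (sym (column-filter c zs))
    (Perm.map⁺ proj₂ (Perm.filter-↭ (λ z → c Fin.≟ proj₁ z) p))

  column-++ : ∀ c (ys zs : List (Fin h × V)) → column c (ys ++ zs) ≡ column c ys ++ column c zs
  column-++ c []             zs = refl
  column-++ c ((d , v) ∷ ys) zs with c Fin.≟ d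
  ... | yes _ = cong (v ∷_) (column-++ c ys zs)
  ... | no _  = column-++ c ys zs

  column-all : ∀ {P : V → Set} c (zs : List (Fin h × V)) → All P (map proj₂ zs) → All P (column c zs)
  column-all c []             []       = []
  column-all c ((d , v) ∷ zs) (p ∷ ps) with c Fin.≟ d
  ... | yes _ = p ∷ column-all c zs ps
  ... | no _  = column-all c zs ps

  column-allPairs : ∀ {_∼_ : V → V → Set} c (zs : List (Fin h × V)) →
                    AllPairs _∼_ (map proj₂ zs) → AllPairs _∼_ (column c zs)
  column-allPairs c []             []       = []
  column-allPairs c ((d , v) ∷ zs) (p ∷ ps) with c Fin.≟ d
  ... | yes _ = column-all c zs p ∷ column-allPairs c zs ps
  ... | no _  = column-allPairs c zs ps

  column-block : ∀ (c d : Fin h) (l : List V) → c ≡ d → column c (map (d ,_) l) ≡ l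
  column-block c d []      eq = refl
  column-block c d (v ∷ l) eq = trans (column-≡ eq v (map (d ,_) l)) (cong (v ∷_) (column-block c d l eq))

  column-other-block : ∀ (c d : Fin h) (l : List V) → c ≢ d → column c (map (d ,_) l) ≡ []
  column-other-block c d []      ne = refl
  column-other-block c d (v ∷ l) ne = trans (column-≢ ne v (map (d ,_) l)) (column-other-block c d l ne)

column-map : ∀ {h} {V U : Set} (g : V → U) c f (vs : List V) →
             column {h} c (zip f (map g vs)) ≡ map g (column c (zip f vs))
column-map g c []      vs       = refl
column-map g c (x ∷ f) []       = refl
column-map g c (x ∷ f) (v ∷ vs) with c Fin.≟ x
... | yes _ = cong (g v ∷_) (column-map g c f vs)
... | no _  = column-map g c f vs

module _ {A B : Set} where

  zip-projections : (zs : List (A × B)) → zip (map proj₁ zs) (map proj₂ zs) ≡ zs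
  zip-projections []       = refl
  zip-projections (z ∷ zs) = cong (z ∷_) (zip-projections zs)

  map-proj₂-zip : (as : List A) (bs : List B) → length as ≡ length bs → map proj₂ (zip as bs) ≡ bs
  map-proj₂-zip []       []       _  = refl
  map-proj₂-zip (a ∷ as) (b ∷ bs) eq = cong (b ∷_) (map-proj₂-zip as bs (ℕ.suc-injective eq))

  zip-∷ʳ : (as : List A) (bs : List B) → length as ≡ length bs → ∀ a b →
           zip (as ++ a ∷ []) (bs ++ b ∷ []) ≡ zip as bs ++ (a , b) ∷ []
  zip-∷ʳ []       []       _  a b = refl
  zip-∷ʳ (x ∷ as) (y ∷ bs) eq a b = cong (_ ∷_) (zip-∷ʳ as bs (ℕ.suc-injective eq) a b)

module _ {h : ℕ} {V : Set} (F : Fin h → List V) where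

  tagged : List (Fin h × V)
  tagged = concat (tabulate (λ c → map (c ,_) (F c)))

  values-tagged : map proj₂ tagged ≡ concat (tabulate F)
  values-tagged = trans (sym (List.concat-map (tabulate (λ c → map (c ,_) (F c)))))
    (cong concat (trans (List.map-tabulate (λ c → map (c ,_) (F c)) (map proj₂))
      (List.tabulate-cong (λ c → trans (sym (List.map-∘ (F c))) (List.map-id (F c))))))

  column-tagged : ∀ c → column c tagged ≡ F c
  column-tagged c = general (λ d → d) (λ eq → eq) c
    where
    general : ∀ {m} (g : Fin m → Fin h) → (∀ {d e} → g d ≡ g e → d ≡ e) → ∀ d →
              column (g d) (concat (tabulate (λ e → map (g e ,_) (F (g e))))) ≡ F (g d)
    absent : ∀ {m} (g : Fin m → Fin h) c → (∀ d → c ≢ g d) →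
             column c (concat (tabulate (λ e → map (g e ,_) (F (g e))))) ≡ []
    absent {zero}  g c ne = refl
    absent {suc m} g c ne = trans (column-++ c (map (g zero ,_) (F (g zero))) _)
      (cong₂ _++_ (column-other-block c (g zero) (F (g zero)) (ne zero)) (absent (g ∘ suc) c (ne ∘ suc)))
    general g inj zero    = trans (column-++ (g zero) (map (g zero ,_) (F (g zero))) _)
      (trans (cong₂ _++_ (column-block (g zero) (g zero) (F (g zero)) refl)
        (absent (g ∘ suc) (g zero) (λ d eq → Fin.0≢1+n (inj eq)))) (List.++-identityʳ _))
    general g inj (suc d) = trans (column-++ (g (suc d)) (map (g zero ,_) (F (g zero))) _)
      (cong₂ _++_ (column-other-block (g (suc d)) (g zero) (F (g zero)) (λ eq → Fin.0≢1+n (sym (inj eq))))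
        (general (g ∘ suc) (λ eq → Fin.suc-injective (inj eq)) d))

module _ {n : ℕ} where

  WeaklySorted StrictlySorted : List (Fin n) → Set
  WeaklySorted   = AllPairs Fin._≤_
  StrictlySorted = AllPairs Fin._<_

  strict⇒weak : ∀ {l} → StrictlySorted l → WeaklySorted l
  strict⇒weak []       = []
  strict⇒weak (p ∷ ps) = All.map ℕ.<⇒≤ p ∷ strict⇒weak ps

  sorted-unique : ∀ {l l′} → WeaklySorted l → WeaklySorted l′ → l ↭ l′ → l ≡ l′
  sorted-unique s s′ p = ≋⇒≡ (↗↭↗⇒≋ (Fin.≤-totalOrder n) (AllPairs⇒Linked s) (AllPairs⇒Linked s′) (↭⇒↭ₛ p))

  occurrences : List (Fin n) → Fin n → ℕ
  occurrences α v = length (filter (v Fin.≟_) α)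

  segments-cong : ∀ {μ ν : Fin n → ℕ} → (∀ v → μ v ≡ ν v) → segments μ ≡ segments ν
  segments-cong eq = cong concat (List.map-cong (λ v → cong (λ k → replicate k v) (eq v)) (allFin n))

  segments-tabulate : ∀ μ → segments μ ≡ concat (tabulate {n = n} (λ v → replicate (μ v) v))
  segments-tabulate μ = cong concat (List.map-tabulate id (λ v → replicate (μ v) v))

  occurrences-↭ : ∀ {α β} → α ↭ β → ∀ v → occurrences α v ≡ occurrences β v
  occurrences-↭ p v = Perm.↭-length (Perm.filter-↭ (v Fin.≟_) p)

  -- The word that `IsNonCrossing` attaches to a filling with entries `α`; its positions are the
  -- elements of the multiplicity-free tableau.
  sortedWord : List (Fin n) → List (Fin n)
  sortedWord α = segments (occurrences α)

  sortedWord-↭ : ∀ α → sortedWord α ↭ α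
  sortedWord-↭ α = ↭-trans (↭-reflexive (trans (segments-tabulate (occurrences α))
      (cong concat (List.tabulate-cong (λ v → sym (fibre v α))))))
    (↭-trans (concat-columns (map (λ x → x , x) α))
      (↭-reflexive (trans (sym (List.map-∘ α)) (List.map-id α))))
    where
    fibre : ∀ v α → column v (map (λ x → x , x) α) ≡ replicate (occurrences α v) v
    fibre v []      = refl
    fibre v (x ∷ α) with v Fin.≟ x
    ... | yes refl = cong (v ∷_) (fibre v α)
    ... | no _     = fibre v α

  segments-sorted : ∀ μ → WeaklySorted (segments μ)
  segments-sorted μ = subst WeaklySorted (sym (segments-tabulate μ)) (AllPairs.concat⁺
    (All.tabulate⁺ (λ v → constant v (μ v)))
    (AllPairs.tabulate⁺-< (λ {u} {v} u<v → All.replicate⁺ (μ u) (All.replicate⁺ (μ v) (ℕ.<⇒≤ u<v)))))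
    where
    constant : ∀ v k → WeaklySorted (replicate k v)
    constant v zero    = []
    constant v (suc k) = All.replicate⁺ k ℕ.≤-refl ∷ constant v k

  strict-or-repeated : ∀ {l} → WeaklySorted l → StrictlySorted l ⊎ AdjacentEqual l
  strict-or-repeated {[]}        []       = inj₁ []
  strict-or-repeated {x ∷ []}    (_ ∷ _)  = inj₁ ([] ∷ [])
  strict-or-repeated {x ∷ y ∷ l} ((x≤y ∷ _) ∷ s) with strict-or-repeated s
  ... | inj₂ eq = inj₂ (there eq)
  ... | inj₁ (ys ∷ s′) with x Fin.≟ y
  ...   | yes refl = inj₂ here
  ...   | no x≢y   = inj₁ ((x<y ∷ All.map (ℕ.<-trans x<y) ys) ∷ ys ∷ s′)
    where x<y = ℕ.≤∧≢⇒< x≤y (x≢y ∘ Fin.toℕ-injective)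

  vecAll : ∀ {P : Fin n → Set} {k} (v : Vec (Fin n) k) → All P (toList v) → VecAll.All P v
  vecAll []      []       = VecAll.[]
  vecAll (x ∷ v) (p ∷ ps) = p VecAll.∷ vecAll v ps

  strict⇒unique : ∀ {k} (v : Vec (Fin n) k) → StrictlySorted (toList v) → Unique v
  strict⇒unique []      []       = VecAllPairs.[]
  strict⇒unique (x ∷ v) (p ∷ ps) =
    vecAll v (All.map (λ x<y x≡y → ℕ.<-irrefl (cong toℕ x≡y) x<y) p) VecAllPairs.∷ strict⇒unique v ps

  strict⇒linked : ∀ {k} (v : Vec (Fin n) k) → StrictlySorted (toList v) → VecLinked.Linked Fin._<_ v
  strict⇒linked []          []             = []
  strict⇒linked (x ∷ [])    ([] ∷ [])      = [-]
  strict⇒linked (x ∷ y ∷ v) ((p ∷ _) ∷ ps) = p ∷ strict⇒linked (y ∷ v) ps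

  linked⇒strict : ∀ {k} (v : Vec (Fin n) k) → VecLinked.Linked Fin._<_ v → StrictlySorted (toList v)
  linked⇒strict []          []       = []
  linked⇒strict (x ∷ [])    [-]      = [] ∷ []
  linked⇒strict (x ∷ y ∷ v) (p ∷ ps) with linked⇒strict (y ∷ v) ps
  ... | qs ∷ s = (p ∷ All.map (ℕ.<-trans p) qs) ∷ qs ∷ s

  finSet : ∀ {k} (v : Vec (Fin n) k) → StrictlySorted (toList v) → FinSet n k
  finSet v s = record { elems = v ; increasing = strict⇒linked v s }

toVec : ∀ {A : Set} {k} (l : List A) → length l ≡ k → Vec A k
toVec l refl = fromList l

toList-toVec : ∀ {A : Set} {k} (l : List A) (eq : length l ≡ k) → toList (toVec l eq) ≡ l
toList-toVec l refl = Vec.toList∘fromList l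

-- Numerals and the order of columns

-- Base-r numerals, least significant digit first: for digits below r they order
-- vectors of equal length as ≺ does.
code : ℕ → List ℕ → ℕ
code r []      = 0
code r (v ∷ l) = v + r * code r l

code-∷ʳ : ∀ r l v → code r (l ++ v ∷ []) ≡ code r l + v * r ^ length l
code-∷ʳ r []      v = cong₂ _+_ refl (ℕ.*-zeroʳ r) ∙ ℕ.+-identityʳ v ∙ sym (ℕ.*-identityʳ v)
  where
  infixr 5 _∙_
  _∙_ = trans
code-∷ʳ r (u ∷ l) v = trans (cong (λ c → u + r * c) (code-∷ʳ r l v))
  (trans (cong (u +_) (ℕ.*-distribˡ-+ r (code r l) (v * r ^ length l)))
    (trans (sym (ℕ.+-assoc u (r * code r l) _)) (cong (u + r * code r l +_)
      (trans (sym (ℕ.*-assoc r v _)) (trans (cong (_* r ^ length l) (ℕ.*-comm r v)) (ℕ.*-assoc v r _))))))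

vecCode : ∀ {n k} → Vec (Fin n) k → ℕ
vecCode {n} a = code n (map toℕ (toList a))

≺-extend : ∀ {n} x y {k} (a b : Vec (Fin n) k) → a ≺ b × vecCode a < vecCode b →
         (x ∷ a) ≺ (y ∷ b) × vecCode (x ∷ a) < vecCode (y ∷ b)
≺-extend {n} x y a b ((s , lt , eq) , c<) =
    (suc s , lt , λ { (suc t) (s≤s s<t) → eq t s<t })
  , ℕ.<-≤-trans (ℕ.+-monoˡ-< (n * vecCode a) (Fin.toℕ<n x))
      (ℕ.≤-trans (ℕ.≤-reflexive (sym (ℕ.*-suc n (vecCode a))))
        (ℕ.≤-trans (ℕ.*-monoʳ-≤ n c<) (ℕ.m≤n+m _ (toℕ y))))

-- The last difference decides both orders. Running them through one trichotomy also yields the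
-- passage back from codes to `≺`.
≺-compare : ∀ {n k} (a b : Vec (Fin n) k) →
  (a ≺ b × vecCode a < vecCode b) ⊎ a ≡ b ⊎ (b ≺ a × vecCode b < vecCode a)
≺-compare []      []      = inj₂ (inj₁ refl)
≺-compare {n} (x ∷ a) (y ∷ b) with ≺-compare a b
... | inj₁ lt         = inj₁ (≺-extend x y a b lt)
... | inj₂ (inj₂ gt)  = inj₂ (inj₂ (≺-extend y x b a gt))
... | inj₂ (inj₁ refl) with Fin.<-cmp x y
...   | tri< lt _ _   = inj₁ ((zero , lt , λ { (suc t) _ → refl }) , ℕ.+-monoˡ-< _ lt)
...   | tri≈ _ refl _ = inj₂ (inj₁ refl)
...   | tri> _ _ gt   = inj₂ (inj₂ ((zero , gt , λ { (suc t) _ → refl }) , ℕ.+-monoˡ-< _ gt))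

code≤⇒≺ : ∀ {n k} (a b : Vec (Fin n) k) → vecCode a ≤ vecCode b → a ≢ b → a ≺ b
code≤⇒≺ a b le a≢b with ≺-compare a b
... | inj₁ (lt , _)          = lt
... | inj₂ (inj₁ eq)         = ⊥-elim (a≢b eq)
... | inj₂ (inj₂ (_ , gt))   = ⊥-elim (ℕ.<⇒≱ gt le)

-- Positions in a labelled word

module _ {h : ℕ} where
  open Words {h}
  open Arrangement {h}

  key≡code : ∀ r c w us → length w ≡ length us →
             key r c w us ≡ code r (column c (zip (reverse w) (reverse us)))
  key≡code r c []      []       _  = refl
  key≡code r c (x ∷ w) (u ∷ us) eq = sym (trans (cong (code r ∘ column c)
      (trans (cong₂ zip (List.unfold-reverse x w) (List.unfold-reverse u us))
        (zip-∷ʳ (reverse w) (reverse us) eq′ x u)))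
    (trans (cong (code r) (column-++ c (zip (reverse w) (reverse us)) ((x , u) ∷ []))) final))
    where
    eq′ : length (reverse w) ≡ length (reverse us)
    eq′ = trans (List.length-reverse w) (trans (ℕ.suc-injective eq) (sym (List.length-reverse us)))
    l = column c (zip (reverse w) (reverse us))
    ih = key≡code r c w us (ℕ.suc-injective eq)
    final : code r (l ++ column c ((x , u) ∷ [])) ≡ hit c x * (u * r ^ count x w) + key r c w us
    final with c Fin.≟ x
    ... | yes refl = trans (code-∷ʳ r l u) (trans (ℕ.+-comm (code r l) _)
      (cong₂ _+_ (trans (cong (λ k → u * r ^ k) (trans (size-zip c (reverse w) (reverse us) eq′) (count-reverse c w)))
        (sym (ℕ.*-identityˡ _))) (sym ih)))
    ... | no _     = trans (cong (code r) (List.++-identityʳ l)) (sym ih)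

  -- A position is given by the prefix before it. Ranks start at 0, like the indices of a `FinSet`.
  record At (f : Word) (c : Fin h) (e i : ℕ) : Set where
    constructor at
    field
      before after : Word
      split  : f ≡ before ++ c ∷ after
      place  : length before ≡ e
      rank   : count c before ≡ i

  at-lookup : ∀ {V : Set} c f (vs : List V) (i : Fin (length (column c (zip f vs)))) →
    ∃[ us ] ∃[ ws ] vs ≡ us ++ List.lookup (column c (zip f vs)) i ∷ ws × At f c (length us) (toℕ i)
  at-lookup c (x ∷ f) (v ∷ vs) i with c Fin.≟ x
  at-lookup c (x ∷ f) (v ∷ vs) zero    | yes refl = [] , vs , refl , at [] f refl refl refl
  at-lookup c (x ∷ f) (v ∷ vs) (suc i) | yes refl with at-lookup c f vs i
  ... | us , ws , eq , at b a split place rank = v ∷ us , ws , cong (v ∷_) eq ,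
    at (x ∷ b) a (cong (x ∷_) split) (cong suc place) (cong₂ _+_ (hit-≡ refl) rank)
  at-lookup c (x ∷ f) (v ∷ vs) i | no ne with at-lookup c f vs i
  ... | us , ws , eq , at b a split place rank = v ∷ us , ws , cong (v ∷_) eq ,
    at (x ∷ b) a (cong (x ∷_) split) (cong suc place) (cong₂ _+_ (hit-≢ ne) rank)

  tabulate-split : ∀ {A : Set} {m} (g : Fin m → A) us {v ws} → tabulate g ≡ us ++ v ∷ ws →
                   ∃[ j ] toℕ j ≡ length us × g j ≡ v
  tabulate-split {m = suc m} g []       eq = zero , refl , List.∷-injectiveˡ eq
  tabulate-split {m = suc m} g (u ∷ us) eq =
    let j , p , q = tabulate-split (g ∘ suc) us (List.∷-injectiveʳ eq) in suc j , cong suc p , q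

  at-position : ∀ N c f {k} (eq : length (column c (zip f (allFin N))) ≡ k) (i : Fin k) →
    At f c (toℕ (Vec.lookup (toVec (column c (zip f (allFin N))) eq) i)) (toℕ i)
  at-position N c f refl i =
    let us , ws , eq , p = at-lookup c f (allFin N) i
        j , j≡ , v≡ = tabulate-split id us eq
    in subst (λ e → At f c e (toℕ i))
         (trans (sym j≡) (cong toℕ (trans v≡ (sym (lookup-fromList (column c (zip f (allFin N))) i))))) p
    where
    lookup-fromList : ∀ {A : Set} (l : List A) i → Vec.lookup (fromList l) i ≡ List.lookup l i
    lookup-fromList (x ∷ l) zero    = refl
    lookup-fromList (x ∷ l) (suc i) = lookup-fromList l i

  split-earlier : ∀ {A : Set} (u u′ : List A) {x y v v′} → u ++ x ∷ v ≡ u′ ++ y ∷ v′ →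
                  length u < length u′ → ∃[ t ] u′ ≡ u ++ x ∷ t
  split-earlier []      (z ∷ u′) eq _ = u′ , cong (_∷ u′) (sym (List.∷-injectiveˡ eq))
  split-earlier (z ∷ u) (z′ ∷ u′) eq (s≤s l) =
    let t , p = split-earlier u u′ (List.∷-injectiveʳ eq) l in t , cong₂ _∷_ (sym (List.∷-injectiveˡ eq)) p

  module _ (N : ℕ) where
    open Uncrossing {h} N

    balancedBy-++ : ∀ {a b} u {v} → count a u ≡ 0 → count b u ≡ 0 → BalancedBy a b v → BalancedBy a b (u ++ v)
    balancedBy-++ []      _  _  p = p
    balancedBy-++ {a} {b} (x ∷ u) za zb p = skip
      (λ { refl → ℕ.0≢1+n (trans (sym (ℕ.m+n≡0⇒m≡0 (hit a x) za)) (hit-≡ refl)) })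
      (λ { refl → ℕ.0≢1+n (trans (sym (ℕ.m+n≡0⇒m≡0 (hit b x) zb)) (hit-≡ refl)) })
      (balancedBy-++ u (ℕ.m+n≡0⇒n≡0 (hit a x) za) (ℕ.m+n≡0⇒n≡0 (hit b x) zb) p)

    crossing-++ : ∀ {a b} u {v} → Crossing a b v → Crossing a b (u ++ v)
    crossing-++ []      p = p
    crossing-++ (x ∷ u) p = there (crossing-++ u p)

    -- The `a` at `e₃` has exactly `i + 1` letters `a` before it, and these already precede the `b`
    -- at `e₂`, so no `a` lies between. By the last hypothesis the following `b` is later than `e₃`
    -- or missing, so no `b` lies between either, and the prefix ending in the `b` at `e₂` is
    -- balanced.
    crossing-at : ∀ {a b f i e₁ e₂ e₃} → a ≢ b → At f a e₁ i → At f b e₂ i → At f a e₃ (suc i) →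
      e₁ < e₂ → e₂ < e₃ → (∃[ e₄ ] e₃ < e₄ × At f b e₄ (suc i)) ⊎ count b f ≡ suc i →
      Crossing a b (reverse f)
    crossing-at {a} {b} {f} {i} a≢b (at u₁ _ s₁ refl r₁) (at u₂ _ s₂ refl r₂) (at u₃ v₃ s₃ refl r₃) l₁ l₂ next
      with split-earlier u₁ u₂ (trans (sym s₁) s₂) l₁ | split-earlier u₂ u₃ (trans (sym s₂) s₃) l₂
    ... | t₁ , refl | t₂ , refl = subst (Crossing a b) (sym rev≡)
      (crossing-++ (reverse v₃) (here (balancedBy-++ (reverse t₂)
        (trans (count-reverse a t₂) a∉t₂) (trans (count-reverse b t₂) b∉t₂)
        (here (trans (count-reverse a u₂) (trans a≡ (cong suc (sym (trans (count-reverse b u₂) r₂)))))))))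
      where
      rev≡ : reverse f ≡ reverse v₃ ++ a ∷ (reverse t₂ ++ b ∷ reverse u₂)
      rev≡ = trans (cong reverse s₃) (trans (rev-split u₃ v₃) (cong (λ r → reverse v₃ ++ a ∷ r) (rev-split u₂ t₂)))
        where
        rev-split : ∀ u v {x} → reverse (u ++ x ∷ v) ≡ reverse v ++ x ∷ reverse u
        rev-split u v {x} = trans (List.reverse-++ u (x ∷ v)) (trans (cong (_++ reverse u) (List.unfold-reverse x v))
          (List.++-assoc (reverse v) (x ∷ []) (reverse u)))
      count-split : ∀ c u {x} v → count c (u ++ x ∷ v) ≡ count c u + (hit c x + count c v)
      count-split c u v = count-++ c u _
      a₂≥ : suc i ≤ count a u₂
      a₂≥ = subst (suc i ≤_) (sym (trans (count-split a u₁ t₁) (cong₂ _+_ r₁ (cong (_+ count a t₁) (hit-≡ refl)))))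
        (subst (suc i ≤_) (sym (ℕ.+-suc i (count a t₁))) (s≤s (ℕ.m≤m+n i _)))
      a₃≡ : count a u₂ + count a t₂ ≡ suc i
      a₃≡ = trans (sym (trans (count-split a u₂ t₂) (cong (λ k → count a u₂ + (k + count a t₂)) (hit-≢ a≢b)))) r₃
      a≡ : count a u₂ ≡ suc i
      a≡ = ℕ.≤-antisym (ℕ.≤-trans (ℕ.m≤m+n _ _) (ℕ.≤-reflexive a₃≡)) a₂≥
      a∉t₂ : count a t₂ ≡ 0
      a∉t₂ = ℕ.+-cancelˡ-≡ (suc i) _ _ (trans (cong (_+ count a t₂) (sym a≡)) (trans a₃≡ (sym (ℕ.+-identityʳ (suc i)))))
      b₃≡ : count b u₃ ≡ suc (i + count b t₂)
      b₃≡ = trans (count-split b u₂ t₂) (trans (cong₂ _+_ r₂ (cong (_+ count b t₂) (hit-≡ refl))) (ℕ.+-suc i _))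
      b₃≤ : (∃[ e₄ ] length u₃ < e₄ × At f b e₄ (suc i)) ⊎ count b f ≡ suc i → count b u₃ ≤ suc i
      b₃≤ (inj₂ total) = ℕ.≤-trans (ℕ.m≤m+n _ (count b (a ∷ v₃)))
            (ℕ.≤-reflexive (trans (sym (count-++ b u₃ (a ∷ v₃))) (trans (cong (count b) (sym s₃)) total)))
      b₃≤ (inj₁ (_ , l₃ , at u₄ _ s₄ refl r₄)) with split-earlier u₃ u₄ (trans (sym s₃) s₄) l₃
      ... | t₃ , refl = ℕ.≤-trans (ℕ.m≤m+n _ (count b (a ∷ t₃)))
            (ℕ.≤-reflexive (trans (sym (count-++ b u₃ (a ∷ t₃))) r₄))
      b∉t₂ : count b t₂ ≡ 0
      b∉t₂ = ℕ.n≤0⇒n≡0 (ℕ.+-cancelˡ-≤ i _ _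
        (ℕ.≤-pred (subst₂ _≤_ b₃≡ (cong suc (sym (ℕ.+-identityʳ i))) (b₃≤ next))))

-- From a normal labelling to a non-crossing tableau

-- Straightening keeps the number of factors, so some may become empty, while the columns of a Young
-- diagram are positive. An empty factor has no entries and minor 1.
record PositivePart (R : CommutativeRing 0ℓ 0ℓ) {h} (s : Fin h → ℕ) : Set₁ where
  open CommutativeRing R using (Carrier; _≈_; 1#; *-rawMonoid)
  open RawMonoidOps *-rawMonoid using () renaming (sum to product)
  field
    {width}   : ℕ
    ι         : Fin width → Fin h
    ι-mono    : ∀ {c d} → c Fin.< d → ι c Fin.< ι d
    positive  : ∀ c → 0 < s (ι c)
    concat-ι  : ∀ {A : Set} (F : Fin h → List A) → (∀ c → s c ≡ 0 → F c ≡ []) →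
                concat (tabulate (F ∘ ι)) ≡ concat (tabulate F)
    product-ι : ∀ (G : Fin h → Carrier) → (∀ c → s c ≡ 0 → G c ≈ 1#) → product (G ∘ ι) ≈ product G

module _ (R : CommutativeRing 0ℓ 0ℓ) where
  open CommutativeRing R using (*-congˡ) renaming (sym to ≈-sym; refl to ≈-refl)
  open PositivePart

  -- The sizes decrease, so the empty columns form a final segment: at the first of them the
  -- recursion stops.
  positivePart : ∀ {h} (s : Fin h → ℕ) → (∀ {c d} → c Fin.< d → s d ≤ s c) → PositivePart R s
  positivePart {zero}  s sorted = record
    { ι = id ; ι-mono = id ; positive = λ () ; concat-ι = λ _ _ → refl ; product-ι = λ _ _ → ≈-refl }
  positivePart {suc h} s sorted with s zero ℕ.≟ 0
  ... | yes s₀≡0 = record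
    { width = 0
    ; ι = λ ()
    ; ι-mono = λ { {()} }
    ; positive = λ ()
    ; concat-ι = λ F empty → sym (concat-empties (λ c → empty c (vanish c)))
    ; product-ι = λ G one → ≈-sym (BlockDeterminant.product-1 R {h} {F = G} (λ c → one c (vanish c))) }
    where
    vanish : ∀ c → s c ≡ 0
    vanish zero    = s₀≡0
    vanish (suc c) = ℕ.n≤0⇒n≡0 (subst (s (suc c) ≤_) s₀≡0 (sorted {zero} {suc c} (s≤s z≤n)))
  ... | no s₀≢0 = record
    { ι = λ { zero → zero ; (suc c) → suc (ι tail c) }
    ; ι-mono = λ { {zero} {suc d} _ → s≤s z≤n ; {suc c} {suc d} (s≤s lt) → s≤s (ι-mono tail lt) }
    ; positive = λ { zero → ℕ.n≢0⇒n>0 s₀≢0 ; (suc c) → positive tail c }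
    ; concat-ι = λ F empty → cong (F zero ++_) (concat-ι tail (F ∘ suc) (empty ∘ suc))
    ; product-ι = λ G one → *-congˡ (product-ι tail (G ∘ suc) (one ∘ suc)) }
    where tail = positivePart (s ∘ suc) (λ lt → sorted (s≤s lt))

module _ {n h : ℕ} {s : Fin h → ℕ} {diagram : IsYoungDiagram s} where

  -- The word in `IsNonCrossing` is computed from `T`, but `T` is built from `ω`. With the equation
  -- as an argument it can be matched, and `T̂` need not be transported.
  isNonCrossing : (T : Filling n s) (ω : List (Fin n)) → ω ≡ segments (multiplicity T) →
    (T̂ : Filling (length ω) s) → IsMultiplicityFreeNCT diagram T̂ →
    (∀ c → Unique (relabel ω (T̂ c))) →
    List.tabulate (λ c → toList (relabel ω (T̂ c))) ↭ columns T →
    (∀ {c d} → c Fin.< d → (eq : s c ≡ s d) → Vec.cast eq (elems (T c)) ≢ elems (T d) →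
       Vec.cast eq (elems (T c)) ≺ elems (T d)) →
    IsNonCrossing diagram T
  isNonCrossing T _ refl T̂ nct unique relabelled arranged = record
    { T̂ = T̂ ; T̂-isNCT = nct ; transversal = unique ; relabelled = relabelled ; arranged = arranged }

module Tableau (R : CommutativeRing 0ℓ 0ℓ) {n h : ℕ} (α : List (Fin n))
  (s : Fin h → ℕ) (sorted : ∀ {c d} → c Fin.< d → s d ≤ s c)
  (part : PositivePart R s)
  (w : Words.Word {h}) (N : ℕ) (length≡ : length w ≡ length (sortedWord α))
  (sizes : ∀ c → Words.count c w ≡ s c)
  (planar : ∀ {a b} → a ≢ b → ¬ Uncrossing.Crossing {h} N a b w)
  (arranged : ∀ {c d} → c Fin.< d → s c ≡ s d →
     Arrangement.key n c w (reverse (map toℕ (sortedWord α))) ≤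
     Arrangement.key n d w (reverse (map toℕ (sortedWord α))))
  (strict : ∀ c → StrictlySorted (column c (zip (reverse w) (sortedWord α))))
  where
  open PositivePart part
  open Words {h}

  ω = sortedWord α
  f = reverse w

  length-f : length f ≡ length ω
  length-f = trans (List.length-reverse w) length≡

  places : Fin h → List (Fin (length ω))
  places c = column c (zip f (allFin (length ω)))

  entriesOf : Fin h → List (Fin n)
  entriesOf c = column c (zip f ω)

  length-allFin : length f ≡ length (allFin (length ω))
  length-allFin = trans length-f (sym (List.length-tabulate id))

  length-places : ∀ c → length (places c) ≡ s c
  length-places c = trans (size-zip c f (allFin (length ω)) length-allFin)
    (trans (count-reverse c w) (sizes c))

  length-entriesOf : ∀ c → length (entriesOf c) ≡ s c
  length-entriesOf c = trans (size-zip c f ω length-f) (trans (count-reverse c w) (sizes c))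

  relabel-places : ∀ c → map (List.lookup ω) (places c) ≡ entriesOf c
  relabel-places c = trans (sym (column-map (List.lookup ω) c f (allFin (length ω))))
    (cong (column c ∘ zip f) (trans (List.map-tabulate id (List.lookup ω)) (List.tabulate-lookup ω)))

  shape : Vector.Vector ℕ width
  shape = s ∘ ι

  diagram : IsYoungDiagram shape
  diagram = record { positive = positive ; decreasing = λ lt → sorted (ι-mono lt) }

  placeVec : ∀ c → Vec (Fin (length ω)) (shape c)
  placeVec c = toVec (places (ι c)) (length-places (ι c))

  toList-placeVec : ∀ c → toList (placeVec c) ≡ places (ι c)
  toList-placeVec c = toList-toVec (places (ι c)) (length-places (ι c))

  T̂ : Filling (length ω) shape
  T̂ c = finSet (placeVec c) (subst StrictlySorted (sym (toList-placeVec c))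
    (column-allPairs (ι c) (zip f (allFin (length ω)))
      (subst StrictlySorted (sym (map-proj₂-zip f (allFin (length ω)) length-allFin)) (AllPairs.tabulate⁺-< id))))

  toList-relabel : ∀ c → toList (relabel ω (T̂ c)) ≡ entriesOf (ι c)
  toList-relabel c = trans (Vec.toList-map (List.lookup ω) (placeVec c))
    (trans (cong (map (List.lookup ω)) (toList-placeVec c)) (relabel-places (ι c)))

  strict-relabel : ∀ c → StrictlySorted (toList (relabel ω (T̂ c)))
  strict-relabel c = subst StrictlySorted (sym (toList-relabel c)) (strict (ι c))

  -- Built by relabelling `T̂`, so that the field `relabelled` holds by reflexivity.
  T : Filling n shape
  T c = finSet (relabel ω (T̂ c)) (strict-relabel c)

  empty-column : ∀ {A : Set} {l : List A} → length l ≡ 0 → l ≡ []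
  empty-column {l = []} _ = refl

  entries-T : entries T ↭ ω
  entries-T = ↭-trans
    (↭-reflexive (trans (cong concat (List.tabulate-cong toList-relabel))
      (concat-ι entriesOf (λ c z → empty-column (trans (length-entriesOf c) z)))))
    (↭-trans (concat-columns (zip f ω)) (↭-reflexive (map-proj₂-zip f ω length-f)))

  content : entries T ↭ α
  content = ↭-trans entries-T (sortedWord-↭ α)

  partition : entries T̂ ↭ allFin (length ω)
  partition = ↭-trans
    (↭-reflexive (trans (cong concat (List.tabulate-cong toList-placeVec))
      (concat-ι places (λ c z → empty-column (trans (length-places c) z)))))
    (↭-trans (concat-columns (zip f (allFin (length ω))))
      (↭-reflexive (map-proj₂-zip f (allFin (length ω)) length-allFin)))

  place-at : ∀ c (i : Fin (shape c)) {r} → toℕ i ≡ r → At f (ι c) (toℕ (T̂ c ! i)) r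
  place-at c i refl = at-position (length ω) (ι c) f (length-places (ι c)) i

  crossing-free : ∀ {a b i e₁ e₂ e₃} → a ≢ b → At f a e₁ i → At f b e₂ i → At f a e₃ (suc i) →
    e₁ < e₂ → e₂ < e₃ → ¬ ((∃[ e₄ ] e₃ < e₄ × At f b e₄ (suc i)) ⊎ count b f ≡ suc i)
  crossing-free a≢b p₁ p₂ p₃ l₁ l₂ next = planar a≢b
    (subst (Uncrossing.Crossing N _ _) (List.reverse-involutive w) (crossing-at N a≢b p₁ p₂ p₃ l₁ l₂ next))

  T̂-isNCT : IsMultiplicityFreeNCT diagram T̂
  T̂-isNCT = record { partition = partition ; noncrossing = noncrossing }
    where
    noncrossing : ∀ {c d} (c<d : c Fin.< d) → NonCrossing (sorted (ι-mono c<d)) (T̂ c) (T̂ d)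
    noncrossing {c} {d} c<d =
        (λ i i⁺ i⁺≡ →
            (λ (l₁ , l₂ , l₃) → crossing-free c≢d (atₐ i refl) (atᵦ i refl) (atₐ i⁺ i⁺≡) l₁ l₂
               (inj₁ (_ , l₃ , atᵦ i⁺ i⁺≡)))
          , (λ (l₁ , l₂ , l₃) → crossing-free (c≢d ∘ sym) (atᵦ i refl) (atₐ i refl) (atᵦ i⁺ i⁺≡) l₁ l₂
               (inj₁ (_ , l₃ , atₐ i⁺ i⁺≡))))
      , (λ i j i≡ j≡ (l₁ , l₂) → crossing-free c≢d (atₐ i refl) (atᵦ i refl)
           (place-at c j (trans j≡ (sym i≡))) l₁ l₂
           -- `i` is the last index of the shorter column, so no further `b` can follow.
           (inj₂ (trans (count-reverse (ι d) w) (trans (sizes (ι d)) (sym i≡)))))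
      where
      q≤p = sorted (ι-mono c<d)
      c≢d : ι c ≢ ι d
      c≢d eq = ℕ.<-irrefl (cong toℕ eq) (ι-mono c<d)
      atₐ : ∀ i {r} → toℕ i ≡ r → At f (ι c) (toℕ (T̂ c ! inject≤ i q≤p)) r
      atₐ i eq = place-at c (inject≤ i q≤p) (trans (Fin.toℕ-inject≤ i q≤p) eq)
      atᵦ : ∀ i {r} → toℕ i ≡ r → At f (ι d) (toℕ (T̂ d ! i)) r
      atᵦ = place-at d

  key≡vecCode : ∀ c → Arrangement.key n (ι c) w (reverse (map toℕ ω)) ≡ vecCode (elems (T c))
  key≡vecCode c = trans
    (key≡code n (ι c) w (reverse (map toℕ ω))
      (trans length≡ (trans (sym (List.length-map toℕ ω)) (sym (List.length-reverse (map toℕ ω))))))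
    (cong (code n) (trans (cong (column (ι c) ∘ zip f) (List.reverse-involutive (map toℕ ω)))
      (trans (column-map toℕ (ι c) f ω) (cong (map toℕ) (sym (toList-relabel c))))))

  T-isNonCrossing : IsNonCrossing diagram T
  T-isNonCrossing = isNonCrossing T ω
    (segments-cong (λ v → sym (occurrences-↭ content v)))
    T̂ T̂-isNCT (λ c → strict⇒unique (relabel ω (T̂ c)) (strict-relabel c)) ↭-refl
    (λ {c} {d} c<d eq → code≤⇒≺ (Vec.cast eq (elems (T c))) (elems (T d))
      (subst₂ _≤_ (trans (key≡vecCode c) (cong (code n ∘ map toℕ) (sym (Vec.toList-cast eq (elems (T c))))))
        (key≡vecCode d) (arranged (ι-mono c<d) eq)))

-- Bideterminants as combinations of non-crossing bitableaux

module Straightened (P : CommutativeRing 0ℓ 0ℓ) (𝓘 : AdditiveSubgroup P) {n : ℕ}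
  (X : Fin n → Fin n → CommutativeRing.Carrier P)
  (α β : List (Fin n)) (length≡ : length α ≡ length β) where
  private
    module P = CommutativeRing P
  open P using (Carrier; _≈_)
  open RawMonoidOps P.*-rawMonoid using () renaming (sum to product)
  open Determinant P using (det)
  open Laplace P
  open DeterminantOfLists P using (det≈detL)
  open AdditiveSubgroup 𝓘
  open Bideterminants n using (NonCrossingBitableau)

  minorOf : ∀ {k} → FinSet n k → FinSet n k → Carrier
  minorOf I J = det (λ r c → X (I ! r) (J ! c))

  N = length (sortedWord α)

  length-β : length (sortedWord β) ≡ N
  length-β = trans (Perm.↭-length (sortedWord-↭ β)) (trans (sym length≡) (sym (Perm.↭-length (sortedWord-↭ α))))

  minor≈detL : ∀ {k} (I J : FinSet n k) → minorOf I J ≈ detL X (toList (elems I)) (toList (elems J))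
  minor≈detL I J = det≈detL X (elems I) (elems J)

  keys : List (Fin n) → List ℕ
  keys γ = reverse (map toℕ (sortedWord γ))

  ContainsMonomials : Set
  ContainsMonomials = (M : NonCrossingBitableau α β) → let open NonCrossingBitableau M in
    Mem (product (λ c → minorOf (T c) (T′ c)))

  module _ (generator∈ : ContainsMonomials) {h : ℕ} where
    open Words {h}
    open Normalisation P 𝓘 {h} N using (Normal)
    open Straightening P 𝓘 {h} N n X (sortedWord α) (sortedWord β) refl length-β (keys α) (keys β)
    open BlockDeterminant P {h}

    -- Columns increase weakly because the words are sorted. A repeated value makes two neighbouring
    -- rows or columns of a block equal and the product 0; otherwise both labellings are tableaux of
    -- one shape.
    normal∈ : ∀ s → (∀ {c d} → c Fin.< d → s d ℕ.≤ s c) → ∀ w w′ →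
              Normal s n (keys α) w → Normal s n (keys β) w′ → Mem (D w w′)
    normal∈ s sorted w w′ nw nw′ = resp (P.sym (detL-blocks X zs ys same)) (σσ∈ P 𝓘 zs ys product∈)
      where
      module nw  = Normal s n (keys α) nw
      module nw′ = Normal s n (keys β) nw′
      zs = zip (reverse w) (sortedWord α)
      ys = zip (reverse w′) (sortedWord β)
      size-zs : ∀ c → size c zs ≡ s c
      size-zs c = trans (size-D (sortedWord α) refl w nw.len c) (nw.sizes c)
      size-ys : ∀ c → size c ys ≡ s c
      size-ys c = trans (size-D (sortedWord β) length-β w′ nw′.len c) (nw′.sizes c)
      same : SameSizes zs ys
      same c = trans (size-zs c) (sym (size-ys c))
      block : Fin h → Carrier
      block c = detL X (column c zs) (column c ys)
      weak-zs : ∀ c → WeaklySorted (column c zs)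
      weak-zs c = column-allPairs c zs (subst WeaklySorted
        (sym (map-proj₂-zip (reverse w) (sortedWord α) (trans (List.length-reverse w) nw.len)))
        (segments-sorted (occurrences α)))
      weak-ys : ∀ c → WeaklySorted (column c ys)
      weak-ys c = column-allPairs c ys (subst WeaklySorted
        (sym (map-proj₂-zip (reverse w′) (sortedWord β)
          (trans (List.length-reverse w′) (trans nw′.len (sym length-β)))))
        (segments-sorted (occurrences β)))
      vanish : ∀ c → block c ≈ P.0# → Mem (product block)
      vanish c eq = resp (P.sym (P.trans (product-split c block) (P.trans (P.*-congʳ eq) (P.zeroˡ _)))) 0∈
      findRepeated : ∀ {m} (F : Fin m → List (Fin n)) → (∀ c → WeaklySorted (F c)) →
                     (∀ c → StrictlySorted (F c)) ⊎ (∃[ c ] AdjacentEqual (F c))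
      findRepeated {zero}  F weak = inj₁ λ ()
      findRepeated {suc m} F weak with strict-or-repeated (weak zero) | findRepeated (F ∘ suc) (weak ∘ suc)
      ... | inj₂ eq | _             = inj₂ (zero , eq)
      ... | inj₁ _  | inj₂ (c , eq) = inj₂ (suc c , eq)
      ... | inj₁ st | inj₁ sts      = inj₁ λ { zero → st ; (suc c) → sts c }
      product∈ : Mem (product block)
      product∈ with findRepeated (λ c → column c zs) weak-zs | findRepeated (λ c → column c ys) weak-ys
      ... | inj₂ (c , eq) | _             = vanish c (detL-equalRows X eq (column c ys))
      ... | inj₁ _        | inj₂ (c , eq) = vanish c (detL-equalColumns X (column c zs) eq)
      ... | inj₁ strict   | inj₁ strict′  = resp
        (P.trans
          (product-cong (λ c → P.trans (minor≈detL (Rows.T c) (Cols.T c))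
            (P.reflexive (cong₂ (detL X) (Rows.toList-relabel c) (Cols.toList-relabel c)))))
          (PositivePart.product-ι part block (λ c z → P.reflexive (cong₂ (detL X)
            (Rows.empty-column {l = column c zs} (trans (size-zs c) z))
            (Rows.empty-column {l = column c ys} (trans (size-ys c) z))))))
        (generator∈ bitableau)
        where
        part = positivePart P s sorted
        module Rows = Tableau P α s sorted part w N nw.len nw.sizes nw.planar nw.arranged strict
        module Cols = Tableau P β s sorted part w′ N (trans nw′.len (sym length-β))
          nw′.sizes nw′.planar nw′.arranged strict′
        bitableau : NonCrossingBitableau α β
        bitableau = record
          { diagram = Rows.diagram ; T = Rows.T ; T′ = Cols.T
          ; noncrossing = Rows.T-isNonCrossing ; noncrossing′ = Cols.T-isNonCrossing
          ; content = Rows.content , Cols.content }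

    -- Arrange the tagged entries so that their values form the sorted word. Each column then is a
    -- sorted list with the entries of `F c`, and sorted lists with the same entries are equal.
    labelling : ∀ {γ} {size : Vector.Vector ℕ h} (F : Filling n size) → entries F ↭ γ →
      ∃[ zs ] map proj₂ zs ≡ sortedWord γ × (∀ c → column c zs ≡ toList (elems (F c)))
    labelling {γ} F content =
      let zs , values , p = Perm.↭-map-inv proj₂ (↭-trans (↭-reflexive (values-tagged G))
                              (↭-trans content (↭-sym (sortedWord-↭ γ))))
      in zs , sym values , λ c → sorted-unique
        (column-allPairs c zs (subst WeaklySorted values (segments-sorted (occurrences γ))))
        (strict⇒weak (linked⇒strict (elems (F c)) (increasing (F c))))
        (↭-trans (column-↭ (↭-sym p)) (↭-reflexive (column-tagged G c)))
      where
      G : Fin h → List (Fin n)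
      G c = toList (elems (F c))

    product∈ : ∀ {size : Vector.Vector ℕ h} (F G : Filling n size) → entries F ↭ α → entries G ↭ β →
               Mem (product (λ c → minorOf (F c) (G c)))
    product∈ F G F↭α G↭β = resp
      (product-cong (λ c → P.trans (P.reflexive (cong₂ (detL X) (columns-zs c) (columns-ys c)))
        (P.sym (minor≈detL (F c) (G c)))))
      (σσ∈⁻ P 𝓘 zs ys (resp
        (P.trans (P.reflexive (cong₂ (detL (masked X)) (unlabel zs values-zs) (unlabel ys values-ys)))
          (detL-blocks X zs ys same))
        (straighten normal∈ (labels zs) (labels ys)
          (length-labels zs values-zs refl) (length-labels ys values-ys length-β))))
      where
      open Adjunction P (Fin._≟_ {h}) using (masked)
      row = labelling F F↭α
      col = labelling G G↭β
      zs = proj₁ row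
      ys = proj₁ col
      values-zs = proj₁ (proj₂ row)
      values-ys = proj₁ (proj₂ col)
      columns-zs = proj₂ (proj₂ row)
      columns-ys = proj₂ (proj₂ col)
      labels : List (Fin h × Fin n) → Word
      labels us = reverse (map proj₁ us)
      unlabel : ∀ us {ω} → map proj₂ us ≡ ω → zip (reverse (labels us)) ω ≡ us
      unlabel us refl = trans (cong (λ l → zip l (map proj₂ us)) (List.reverse-involutive (map proj₁ us)))
        (zip-projections us)
      length-labels : ∀ us {ω} → map proj₂ us ≡ ω → length ω ≡ N → length (labels us) ≡ N
      length-labels us refl eq = trans (List.length-reverse (map proj₁ us)) (trans (List.length-map proj₁ us)
        (trans (sym (List.length-map proj₂ us)) eq))
      same : SameSizes zs ys
      same c = trans (cong length (columns-zs c)) (trans (length-toList (elems (F c)))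
        (sym (trans (cong length (columns-ys c)) (length-toList (elems (G c))))))
        where
        length-toList : ∀ {k} (v : Vec (Fin n) k) → length (toList v) ≡ k
        length-toList Vec.[]      = refl
        length-toList (x Vec.∷ v) = cong suc (length-toList v)

theorem18 : ∀ (n : ℕ) (α β : List (Fin n)) → length α ≡ length β →
    let open Bideterminants n in
    V α β ≐ Span (monomial {α} {β})
theorem18 n α β length≡ =
    Span-elim ⟦_⟧ (Span monomial) (Span-resp monomial) (Span-0 monomial)
      (λ a M sp → Span-+ monomial (Span-* monomial a (bideterminant∈ M)) sp)
  , λ (k , c , i , eq) → k , c , (λ j → bideterminant (i j)) , eq
  where
  open Bideterminants n
  open SpanSubgroup ℂ-commutativeRing (Fin n × Fin n)
  bideterminant∈ : (M : Bideterminant α β) → Span monomial ⟦ M ⟧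
  bideterminant∈ M = Straightened.product∈ commutativeRing (subgroup (monomial {α} {β})) X α β length≡
    (Span-generator monomial) rows cols (proj₁ content) (proj₂ content)
    where open Bideterminant M
  bideterminant : NonCrossingBitableau α β → Bideterminant α β
  bideterminant M = record { rows = T ; cols = T′ ; content = content }
    where open NonCrossingBitableau M
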